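{- For every $\epsilon>0$ there is a constant $Q=Q(\epsilon)$ such that for every prime power $q>Q$ and every divisor $d$ of $q-1$ with $2\le d\le q^{1/10-\epsilon}$, there are no sets $A,B,C\subset\mathbb{F}_q$ with $|A|,|B|,|C|\ge2$ and $S_d=A+B+C$, where $S_d=\{x^d:x\in\mathbb{F}_q^*\}$.
   Context: $\mathbb{F}_q$ is the finite field with $q$ elements. $A+B+C=\{a+b+c:a\in A,b\in B,c\in C\}$. -}

module Defs where

open import Level using (0ℓ)
open import Data.Nat using (ℕ; zero; suc; _^_; _≤_)
open import Data.Nat.Primality using (Prime)
open import Data.Fin using (Fin)
open import Data.Product using (Σ; ∃; _×_; _,_)
open import Relation.Nullary using (¬_)
open import Relation.Binary.PropositionalEquality using (_≡_)
open import Algebra.Structures using (IsCommutativeRing)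
open import Function.Bundles using (_↔_)

IsPrimePower : ℕ → Set
IsPrimePower q = Σ ℕ λ p → Σ ℕ λ k → Prime p × (1 ≤ k) × (q ≡ p ^ k)

record FiniteField (q : ℕ) : Set₁ where
  field
    Carrier : Set
    _+_ _*_ : Carrier → Carrier → Carrier
    -_      : Carrier → Carrier
    0# 1#   : Carrier
    isCommutativeRing : IsCommutativeRing _≡_ _+_ _*_ -_ 0# 1#
    0≢1     : ¬ (0# ≡ 1#)
    inverse : ∀ x → ¬ (x ≡ 0#) → ∃ λ y → (x * y) ≡ 1#
    enumeration : Fin q ↔ Carrier

  infixl 6 _+_
  infixl 7 _*_

  pow : Carrier → ℕ → Carrier
  pow x zero    = 1#
  pow x (suc n) = x * pow x n

  S : ℕ → Carrier → Set
  S d x = ∃ λ y → ¬ (y ≡ 0#) × (x ≡ pow y d)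

  SumSet : (Carrier → Set) → (Carrier → Set) → (Carrier → Set) → Carrier → Set
  SumSet A B C x = ∃ λ a → ∃ λ b → ∃ λ c →
    A a × B b × C c × (x ≡ (a + b) + c)

  AtLeastTwo : (Carrier → Set) → Set
  AtLeastTwo A = ∃ λ a → ∃ λ a' → A a × A a' × ¬ (a ≡ a')

{-# OPTIONS --safe #-}

-- Let q = d m + 1, so that S_d is the group G of the m-th roots of unity. If G = A + Y, then Y lies in the
-- intersection of the translates G - a, a ∈ A. For a product f of k powers of linear factors, the first of them with
-- exponent 1, Stepanov's method gives at most q/n + O(k n √q) solutions of f(x)^((q-1)/n) = ζ: the auxiliary polynomial
-- is a combination of terms X^u X^(q j) f^(m e), and it does not vanish because these terms have distinct orders at the
-- first root of f. For a prime ℓ dividing d, averaging over the exponents of the other factors turns this into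
-- |Y| ≤ q/ℓ^k + O(k d √q) for all k ≤ |A|.
--
-- With k about log q this is |Y| = O(d √q log q). A smaller A would contradict |A| |Y| ≥ m: a second moment computation
-- for |G ∩ (G - t)| gives |A| ≥ d, and then q |A| / ℓ^|A| is well below q/d, except for |A| = d = 2 and |A| = d = 4. There
-- one uses the parity of the number of squares among x - t, x, x + t, and a mixture of conditions on squares and fourth
-- powers, respectively.
--
-- So if G = A + B + C, then the three sumsets of two of A, B, C have O(d √q log q) elements, and
-- |A + B + C|² ≤ |A + B| |A + C| |B + C| forces (q/d)² = O(d³ q^(3/2) log³ q), which fails for d ≤ q^(1/10 - ε), q large.

module Submission where

open import Level using (Level; 0ℓ)
open import Defs
open import Data.Nat as ℕ using (ℕ; zero; suc; _≤_; _<_; z≤n; s≤s; s<s; NonZero; _∸_; ∣_-_∣)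
open import Data.Nat.Combinatorics using (nCn≡1; k>n⇒nCk≡0; nCk+nC[k+1]≡[n+1]C[k+1]) renaming (_C_ to _choose_)
open import Data.Nat.Coprimality using (prime⇒coprime; coprime-Bézout)
open import Data.Nat.DivMod using (m≡m%n+[m/n]*n; m%n<n; /-monoˡ-≤; m*n/n≡m; _/_; _%_; m<n*o⇒m/o<n; m/n*n≤m)
open import Data.Nat.Divisibility using (_∣_; divides; >⇒∤)
open import Data.Nat.GCD using (module Bézout)
open import Data.Nat.Primality using (Prime; prime⇒nonZero; prime⇒nonTrivial; prime?; euclidsLemma)
open import Data.Nat.Primality.Factorisation using (factorise)
import Data.Nat.Properties as ℕ
open import Data.Nat.Solver using (module +-*-Solver)
open import Data.Empty using (⊥; ⊥-elim)
open import Data.Fin as Fin using (Fin; zero; suc; toℕ; fromℕ; fromℕ<; inject₁; punchIn; combine; remQuot; finToFun; funToFin)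
open import Data.Fin.Permutation using (Permutation; permutation)
import Data.Fin.Properties as Fin
open import Data.Fin.Properties using (toℕ-fromℕ; toℕ-inject₁; toℕ<n)
open import Data.List using (List; []; _∷_; _++_; map; length; filter; cartesianProductWith; tabulate; upTo; take; deduplicate)
import Data.List.Membership.DecPropositional
open import Data.List.Membership.Propositional using (_∈_; find; lose)
open import Data.List.Membership.Propositional.Properties using
  (∈-∃++; ∈-++⁺ˡ; ∈-++⁺ʳ; ∈-++⁻; ∈-map⁻; ∈-filter⁺;
   ∈-tabulate⁺; ∈-filter⁻; ∈-upTo⁻; ∈-cartesianProductWith⁺; ∈-cartesianProductWith⁻; ∈-deduplicate⁺; ∈-deduplicate⁻)
open import Data.List.Properties using (length-map; length-++; length-tabulate; length-upTo; length-take)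
open import Data.List.Relation.Binary.Subset.Propositional using (_⊆_)
open import Data.List.Relation.Unary.All as All using (All; []; _∷_; all?)
import Data.List.Relation.Unary.All.Properties as All
open import Data.List.Relation.Unary.AllPairs using ([]; _∷_)
open import Data.List.Relation.Unary.Any using (here; there; Any; any?)
import Data.List.Relation.Unary.Unique.DecPropositional.Properties
open import Data.List.Relation.Unary.Unique.Propositional using (Unique)
open import Data.List.Relation.Unary.Unique.Propositional.Properties using (tabulate⁺; filter⁺; upTo⁺; map⁺; take⁺)
open import Data.Product using (∃; _×_; _,_; proj₁; proj₂; Σ)
open import Data.Sum using (inj₁; inj₂; _⊎_)
open import Function using (_∘_; case_of_; Inverse; id)
open import Function.Bundles using (_⇔_; mk⇔; Equivalence)
open import Relation.Binary using (tri<; tri≈; tri>)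
import Relation.Binary.Reasoning.Setoid
open import Relation.Nullary using (¬_; Dec; yes; no; contradiction)
open import Relation.Nullary.Decidable using (from-yes; map′; ¬?; _×-dec_)
open import Relation.Unary using (Pred; Decidable)
open import Algebra.Bundles using (CommutativeRing)
import Algebra.Properties.CommutativeMonoid.Sum
import Algebra.Properties.CommutativeSemiring.Binomial
import Algebra.Properties.CommutativeSemiring.Exp
import Algebra.Properties.Ring
import Algebra.Properties.Semiring.Mult
import Algebra.Solver.Ring.NaturalCoefficients.Default
open import Relation.Binary.PropositionalEquality as ≡ using (_≡_)

-- The Frobenius map

-- Stepanov's method takes the place of Weil's bound for character sums. The obstacle is the
-- characteristic: derivatives of order `p` and more vanish identically, so orders of vanishing have
-- to be read off power series. At a point `a` the variable is expanded as `a + ρ w`, where `ρ` is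
-- the value at `a` of the product of all linear factors. With this scale the expansion of `f` is
-- `f(a)` times a series whose coefficients are polynomials in `a` of small degree, although `f` may
-- have a large degree. A condition "the l-th coefficient vanishes at every solution" thus becomes a
-- few linear equations that do not mention the solutions, and a count of unknowns against equations
-- yields the auxiliary polynomial. The exponent 1 of the first factor makes `f` vanish to order
-- exactly 1 at its root, which is what separates the orders of the terms. The averaging needs a
-- prime `ℓ` because then every non-trivial ℓ-th root of unity generates all of them. In the
-- exceptional cases the main term `q |A| / ℓ^|A|` equals `q/d`, so that the general bound just
-- fails to give a contradiction.

absorption : ∀ n k → suc k ℕ.* (suc n choose suc k) ≡ suc n ℕ.* (n choose k)
absorption zero zero = ≡.refl
absorption zero (suc k) = ≡.trans (≡.cong (suc (suc k) ℕ.*_) (k>n⇒nCk≡0 {1} {2 ℕ.+ k} (ℕ.s≤s (ℕ.s≤s ℕ.z≤n))))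
  (≡.trans (ℕ.*-zeroʳ (2 ℕ.+ k)) (≡.sym (≡.trans (≡.cong (1 ℕ.*_) (k>n⇒nCk≡0 {0} {1 ℕ.+ k} (ℕ.s≤s ℕ.z≤n))) (ℕ.*-zeroʳ 1))))
absorption (suc n) zero = begin
  1 ℕ.* (suc (suc n) choose 1) ≡⟨ ≡.cong (1 ℕ.*_) (nCk+nC[k+1]≡[n+1]C[k+1] (suc n) 0) ⟨
  1 ℕ.* (1 ℕ.+ (suc n choose 1)) ≡⟨ ℕ.*-distribˡ-+ 1 1 (suc n choose 1) ⟩
  1 ℕ.+ 1 ℕ.* (suc n choose 1) ≡⟨ ≡.cong (1 ℕ.+_) (absorption n 0) ⟩
  1 ℕ.+ suc n ℕ.* 1 ∎
  where open ≡.≡-Reasoning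
absorption (suc n) (suc k) = begin
  (2 ℕ.+ k) ℕ.* (suc (suc n) choose (2 ℕ.+ k)) ≡⟨ ≡.cong ((2 ℕ.+ k) ℕ.*_) (nCk+nC[k+1]≡[n+1]C[k+1] (suc n) (suc k)) ⟨
  (2 ℕ.+ k) ℕ.* ((suc n choose suc k) ℕ.+ (suc n choose (2 ℕ.+ k)))
    ≡⟨ +-*-Solver.solve 3 (λ k x y → (con 2 :+ k) :* (x :+ y) := x :+ (con 1 :+ k) :* x :+ (con 2 :+ k) :* y) ≡.refl k (suc n choose suc k) _ ⟩
  (suc n choose suc k) ℕ.+ suc k ℕ.* (suc n choose suc k) ℕ.+ (2 ℕ.+ k) ℕ.* (suc n choose (2 ℕ.+ k))
    ≡⟨ ≡.cong₂ (λ u v → (suc n choose suc k) ℕ.+ u ℕ.+ v) (absorption n k) (absorption n (suc k)) ⟩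
  (suc n choose suc k) ℕ.+ suc n ℕ.* (n choose k) ℕ.+ suc n ℕ.* (n choose suc k)
    ≡⟨ +-*-Solver.solve 4 (λ x n a b → x :+ n :* a :+ n :* b := x :+ n :* (a :+ b)) ≡.refl (suc n choose suc k) (suc n) (n choose k) (n choose suc k) ⟩
  (suc n choose suc k) ℕ.+ suc n ℕ.* ((n choose k) ℕ.+ (n choose suc k))
    ≡⟨ ≡.cong (λ u → (suc n choose suc k) ℕ.+ suc n ℕ.* u) (nCk+nC[k+1]≡[n+1]C[k+1] n k) ⟩
  suc (suc n) ℕ.* (suc n choose suc k) ∎
  where
  open ≡.≡-Reasoning
  open +-*-Solver using (con; _:+_; _:*_; _:=_)

-- By absorption `p` divides `k` times the binomial coefficient, and it does not divide `k`.
prime∣binomial : ∀ {p} → Prime p → ∀ k → 0 ℕ.< k → k ℕ.< p → p ∣ (p choose k)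
prime∣binomial {suc p} pr (suc k) 0<k k<p with euclidsLemma (suc k) (suc p choose suc k) pr
    (divides (p choose k) (≡.trans (absorption p k) (ℕ.*-comm (suc p) (p choose k))))
... | inj₁ h = contradiction h (>⇒∤ k<p)
... | inj₂ h = h

module _ (R : CommutativeRing 0ℓ 0ℓ) where
  open CommutativeRing R hiding (zero)
  open Algebra.Properties.CommutativeSemiring.Exp commutativeSemiring
  open Algebra.Properties.Semiring.Mult semiring using (×-assocˡ; ×-assoc-*; ×-congʳ; ×-homo-1) renaming (_×_ to _·_)
  open Algebra.Properties.CommutativeMonoid.Sum +-commutativeMonoid using (sum; sum-cong-≋; sum-replicate-zero; sum-init-last)
  private module B = Algebra.Properties.CommutativeSemiring.Binomial commutativeSemiring
  open Relation.Binary.Reasoning.Setoid setoid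

  n×0≈0 : ∀ n → n · 0# ≈ 0#
  n×0≈0 zero    = refl
  n×0≈0 (suc n) = trans (+-identityˡ _) (n×0≈0 n)

  module _ {p : ℕ} (prime : Prime p) (p×1≈0 : p · 1# ≈ 0#) where

    multiple×≈0 : ∀ {n} → p ∣ n → ∀ x → n · x ≈ 0#
    multiple×≈0 (divides m ≡.refl) x = begin
      (m ℕ.* p) · x ≈⟨ ×-assocˡ x m p ⟨
      m · (p · x) ≈⟨ ×-congʳ m (×-congʳ p (sym (*-identityˡ x))) ⟩
      m · (p · (1# * x)) ≈⟨ ×-congʳ m (sym (×-assoc-* p 1# x)) ⟩
      m · ((p · 1#) * x) ≈⟨ ×-congʳ m (trans (*-congʳ p×1≈0) (zeroˡ x)) ⟩
      m · 0# ≈⟨ n×0≈0 m ⟩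
      0# ∎

    frobenius : ∀ x y → (x + y) ^ p ≈ x ^ p + y ^ p
    frobenius x y = go p ≡.refl
      where
      go : ∀ n → p ≡ n → (x + y) ^ n ≈ x ^ n + y ^ n
      go zero    eq = contradiction eq (ℕ.≢-nonZero⁻¹ p {{prime⇒nonZero prime}})
      go (suc n) ≡.refl = begin
        (x + y) ^ p ≈⟨ B.theorem p x y ⟩
        term zero + sum (term ∘ suc) ≈⟨ +-cong bottom (trans (sum-init-last (term ∘ suc)) (+-cong middle top)) ⟩
        y ^ p + (0# + x ^ p) ≈⟨ +-congˡ (+-identityˡ _) ⟩
        y ^ p + x ^ p ≈⟨ +-comm _ _ ⟩
        x ^ p + y ^ p ∎
        where
        term = B.binomialTerm x y p
        bottom : term zero ≈ y ^ p
        bottom = trans (×-homo-1 _) (*-identityˡ _)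
        middle : sum (λ i → term (suc (inject₁ i))) ≈ 0#
        middle = trans (sum-cong-≋ (λ i → multiple×≈0
          (prime∣binomial prime (suc (toℕ (inject₁ i))) (ℕ.s≤s ℕ.z≤n)
            (ℕ.s≤s (≡.subst (ℕ._< n) (≡.sym (toℕ-inject₁ i)) (toℕ<n i)))) _)) (sum-replicate-zero n)
        top : term (suc (fromℕ n)) ≈ x ^ p
        top = begin
          (p choose suc (toℕ (fromℕ n))) · (x ^ suc (toℕ (fromℕ n)) * y ^ (n ∸ toℕ (fromℕ n)))
            ≡⟨ ≡.cong (λ z → (p choose suc z) · (x ^ suc z * y ^ (n ∸ z))) (toℕ-fromℕ n) ⟩
          (p choose p) · (x ^ p * y ^ (n ∸ n)) ≡⟨ ≡.cong₂ (λ u v → u · (x ^ p * y ^ v)) (nCn≡1 p) (ℕ.n∸n≡0 n) ⟩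
          1 · (x ^ p * 1#) ≈⟨ trans (×-homo-1 _) (*-identityʳ _) ⟩
          x ^ p ∎

    -- The ring is arbitrary because the map is applied to power series: there it makes
    -- `(a + ρ w)^q` constant up to order `q`.
    frobenius^ : ∀ k x y → (x + y) ^ (p ℕ.^ k) ≈ x ^ (p ℕ.^ k) + y ^ (p ℕ.^ k)
    frobenius^ zero    x y = trans (*-identityʳ _) (sym (+-cong (*-identityʳ _) (*-identityʳ _)))
    frobenius^ (suc k) x y = begin
      (x + y) ^ (p ℕ.* p ℕ.^ k) ≈⟨ ^-assocʳ (x + y) p (p ℕ.^ k) ⟨
      ((x + y) ^ p) ^ (p ℕ.^ k) ≈⟨ ^-congˡ (p ℕ.^ k) (frobenius x y) ⟩
      (x ^ p + y ^ p) ^ (p ℕ.^ k) ≈⟨ frobenius^ k (x ^ p) (y ^ p) ⟩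
      (x ^ p) ^ (p ℕ.^ k) + (y ^ p) ^ (p ℕ.^ k) ≈⟨ +-cong (^-assocʳ x p (p ℕ.^ k)) (^-assocʳ y p (p ℕ.^ k)) ⟩
      x ^ (p ℕ.* p ℕ.^ k) + y ^ (p ℕ.* p ℕ.^ k) ∎

open ≡ hiding ([_]; J)

-- Counting with lists

module Counting where
  open import Data.Nat
  open import Data.Nat.Properties
  open import Algebra.Properties.CommutativeSemigroup +-commutativeSemigroup using (interchange; x∙yz≈y∙xz)

  private variable
    a b p r : Level
    A : Set a
    B : Set b
    P : Set p
    R : Set r

  ∑ : List A → (A → ℕ) → ℕ
  ∑ []       f = 0
  ∑ (x ∷ xs) f = f x + ∑ xs f

  ∑-mono : (xs : List A) {f g : A → ℕ} → (∀ {x} → x ∈ xs → f x ≤ g x) → ∑ xs f ≤ ∑ xs g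
  ∑-mono []       h = z≤n
  ∑-mono (x ∷ xs) h = +-mono-≤ (h (here refl)) (∑-mono xs (h ∘ there))

  ∑-cong : (xs : List A) {f g : A → ℕ} → (∀ {x} → x ∈ xs → f x ≡ g x) → ∑ xs f ≡ ∑ xs g
  ∑-cong []       h = refl
  ∑-cong (x ∷ xs) h = cong₂ _+_ (h (here refl)) (∑-cong xs (h ∘ there))

  ∑-distrib-+ : (xs : List A) (f g : A → ℕ) → ∑ xs (λ x → f x + g x) ≡ ∑ xs f + ∑ xs g
  ∑-distrib-+ []       f g = refl
  ∑-distrib-+ (x ∷ xs) f g = trans (cong (f x + g x +_) (∑-distrib-+ xs f g)) (interchange (f x) (g x) _ _)

  ∑-*ˡ : (xs : List A) (c : ℕ) (f : A → ℕ) → ∑ xs (λ x → c * f x) ≡ c * ∑ xs f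
  ∑-*ˡ []       c f = sym (*-zeroʳ c)
  ∑-*ˡ (x ∷ xs) c f = trans (cong (c * f x +_) (∑-*ˡ xs c f)) (sym (*-distribˡ-+ c (f x) _))

  ∑-*ʳ : (xs : List A) (c : ℕ) (f : A → ℕ) → ∑ xs (λ x → f x * c) ≡ ∑ xs f * c
  ∑-*ʳ xs c f = trans (∑-cong xs (λ {x} _ → *-comm (f x) c)) (trans (∑-*ˡ xs c f) (*-comm c _))

  ∑-const : (xs : List A) (c : ℕ) → ∑ xs (λ _ → c) ≡ length xs * c
  ∑-const []       c = refl
  ∑-const (x ∷ xs) c = cong (c +_) (∑-const xs c)

  ∑-comm : (xs : List A) (ys : List B) (f : A → B → ℕ) →
           ∑ xs (λ x → ∑ ys (f x)) ≡ ∑ ys (λ y → ∑ xs (λ x → f x y))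
  ∑-comm []       ys f = sym (trans (∑-const ys 0) (*-zeroʳ (length ys)))
  ∑-comm (x ∷ xs) ys f = trans (cong (∑ ys (f x) +_) (∑-comm xs ys f)) (sym (∑-distrib-+ ys (f x) _))

  ∑-++ : (xs ys : List A) (f : A → ℕ) → ∑ (xs ++ ys) f ≡ ∑ xs f + ∑ ys f
  ∑-++ []       ys f = refl
  ∑-++ (x ∷ xs) ys f = trans (cong (f x +_) (∑-++ xs ys f)) (sym (+-assoc (f x) _ _))

  ∑-map : (φ : A → B) (xs : List A) (f : B → ℕ) → ∑ (map φ xs) f ≡ ∑ xs (f ∘ φ)
  ∑-map φ []       f = refl
  ∑-map φ (x ∷ xs) f = cong (f (φ x) +_) (∑-map φ xs f)

  ∑-* : (xs : List A) (ys : List B) (f : A → ℕ) (g : B → ℕ) →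
        ∑ xs f * ∑ ys g ≡ ∑ xs (λ x → ∑ ys (λ y → f x * g y))
  ∑-* xs ys f g = trans (sym (∑-*ʳ xs (∑ ys g) f)) (∑-cong xs (λ {x} _ → sym (∑-*ˡ ys (f x) g)))

  term≤∑ : {xs : List A} {x : A} (f : A → ℕ) → x ∈ xs → f x ≤ ∑ xs f
  term≤∑ f (here refl) = m≤m+n _ _
  term≤∑ f (there {x = y} x∈) = ≤-trans (term≤∑ f x∈) (m≤n+m _ (f y))

  ∑-⊆ : {xs ys : List A} (f : A → ℕ) → Unique xs → xs ⊆ ys → ∑ xs f ≤ ∑ ys f
  ∑-⊆ {xs = []} f u s = z≤n
  ∑-⊆ {xs = x ∷ xs} {ys} f (x∉ ∷ u) s with ∈-∃++ (s (here refl))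
  ... | us , vs , refl = begin
    f x + ∑ xs f ≤⟨ +-monoʳ-≤ (f x) (∑-⊆ f u drop) ⟩
    f x + ∑ (us ++ vs) f ≡⟨ cong (f x +_) (∑-++ us vs f) ⟩
    f x + (∑ us f + ∑ vs f) ≡⟨ x∙yz≈y∙xz (f x) (∑ us f) (∑ vs f) ⟩
    ∑ us f + (f x + ∑ vs f) ≡⟨ ∑-++ us (x ∷ vs) f ⟨
    ∑ (us ++ x ∷ vs) f ∎
    where
    open ≤-Reasoning
    drop : xs ⊆ us ++ vs
    drop {y} y∈ with ∈-++⁻ us (s (there y∈))
    ... | inj₁ h = ∈-++⁺ˡ h
    ... | inj₂ (here refl) = contradiction refl (All.lookup x∉ y∈)
    ... | inj₂ (there h) = ∈-++⁺ʳ us h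

  ∑-one : (xs : List A) → ∑ xs (λ _ → 1) ≡ length xs
  ∑-one xs = trans (∑-const xs 1) (*-identityʳ _)

  length-⊆ : {xs ys : List A} → Unique xs → xs ⊆ ys → length xs ≤ length ys
  length-⊆ {xs = xs} {ys} u s = subst₂ _≤_ (∑-one xs) (∑-one ys) (∑-⊆ (λ _ → 1) u s)

  unique-map : {xs : List A} {φ : A → B} →
               (∀ {x y} → x ∈ xs → y ∈ xs → φ x ≡ φ y → x ≡ y) → Unique xs → Unique (map φ xs)
  unique-map {xs = []} inj [] = []
  unique-map {xs = x ∷ xs} {φ} inj (x∉ ∷ u) =
    All.tabulate (λ {z} z∈ eq → case ∈-map⁻ φ z∈ of λ where
      (y , y∈ , refl) → All.lookup x∉ y∈ (inj (here refl) (there y∈) eq))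
    ∷ unique-map (λ x∈ y∈ → inj (there x∈) (there y∈)) u

  ∑-injection : {xs : List A} {ys : List B} (φ : A → B) (f : B → ℕ) →
                (∀ {x y} → x ∈ xs → y ∈ xs → φ x ≡ φ y → x ≡ y) → Unique xs →
                (∀ {x} → x ∈ xs → φ x ∈ ys) → ∑ xs (f ∘ φ) ≤ ∑ ys f
  ∑-injection {xs = xs} φ f inj u into = subst (_≤ _) (∑-map φ xs f)
    (∑-⊆ f (unique-map inj u) (λ z∈ → case ∈-map⁻ φ z∈ of λ where (y , y∈ , refl) → into y∈))

  length-injection : {xs : List A} {ys : List B} (φ : A → B) →
                (∀ {x y} → x ∈ xs → y ∈ xs → φ x ≡ φ y → x ≡ y) → Unique xs →
                (∀ {x} → x ∈ xs → φ x ∈ ys) → length xs ≤ length ys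
  length-injection {xs = xs} {ys} φ inj u into =
    subst₂ _≤_ (∑-one xs) (∑-one ys) (∑-injection φ (λ _ → 1) inj u into)

  -- With indicators, cardinalities become sums, and double counting is an exchange of two sums by
  -- `∑-comm`.
  ⟦_⟧ : Dec P → ℕ
  ⟦ yes _ ⟧ = 1
  ⟦ no  _ ⟧ = 0

  ⟦⟧-yes : (d : Dec P) → P → ⟦ d ⟧ ≡ 1
  ⟦⟧-yes (yes _) p = refl
  ⟦⟧-yes (no ¬p) p = contradiction p ¬p

  ⟦⟧-no : (d : Dec P) → ¬ P → ⟦ d ⟧ ≡ 0
  ⟦⟧-no (yes p) ¬p = contradiction p ¬p
  ⟦⟧-no (no _)  ¬p = refl

  ⟦⟧≤1 : (d : Dec P) → ⟦ d ⟧ ≤ 1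
  ⟦⟧≤1 (yes _) = ≤-refl
  ⟦⟧≤1 (no _)  = z≤n

  ⟦⟧-mono : (d : Dec P) (e : Dec R) → (P → R) → ⟦ d ⟧ ≤ ⟦ e ⟧
  ⟦⟧-mono (yes p) e h = ≤-reflexive (sym (⟦⟧-yes e (h p)))
  ⟦⟧-mono (no _)  e h = z≤n

  ⟦⟧-cong : (d : Dec P) (e : Dec R) → (P → R) → (R → P) → ⟦ d ⟧ ≡ ⟦ e ⟧
  ⟦⟧-cong d e f g = ≤-antisym (⟦⟧-mono d e f) (⟦⟧-mono e d g)

  length-filter-∑ : {P : Pred A p} (P? : Decidable P) (xs : List A) → length (filter P? xs) ≡ ∑ xs (λ x → ⟦ P? x ⟧)
  length-filter-∑ P? [] = refl
  length-filter-∑ P? (x ∷ xs) with P? x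
  ... | yes _ = cong suc (length-filter-∑ P? xs)
  ... | no  _ = length-filter-∑ P? xs

  ∑-filter : {P : Pred A p} (P? : Decidable P) (xs : List A) (f : A → ℕ) → ∑ (filter P? xs) f ≡ ∑ xs (λ x → ⟦ P? x ⟧ * f x)
  ∑-filter P? [] f = refl
  ∑-filter P? (x ∷ xs) f with P? x
  ... | yes _ = cong₂ _+_ (sym (+-identityʳ (f x))) (∑-filter P? xs f)
  ... | no  _ = ∑-filter P? xs f

  length≤count : {P : Pred A p} (P? : Decidable P) {xs ys : List A} → Unique xs →
                 (∀ {x} → x ∈ xs → x ∈ ys × P x) → length xs ≤ ∑ ys (λ x → ⟦ P? x ⟧)
  length≤count P? {xs} {ys} u h = subst (_ ≤_) (length-filter-∑ P? ys)
    (length-⊆ u (λ x∈ → let (x∈ys , Px) = h x∈ in ∈-filter⁺ P? x∈ys Px))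

  length-cartesianProductWith : {C : Set r} (f : A → B → C) (xs : List A) (ys : List B) →
                                length (cartesianProductWith f xs ys) ≡ length xs * length ys
  length-cartesianProductWith f []       ys = refl
  length-cartesianProductWith f (x ∷ xs) ys =
    trans (length-++ (map (f x) ys)) (cong₂ _+_ (length-map (f x) ys) (length-cartesianProductWith f xs ys))

open Counting

-- Estimates for natural numbers

module NatBounds where
  open import Data.Nat
  open import Data.Nat.Properties
  open +-*-Solver using (solve; con; _:+_; _:*_; _:=_)

  ∣-∣-square : ∀ a b → ∣ a - b ∣ * ∣ a - b ∣ + 2 * (a * b) ≡ a * a + b * b
  ∣-∣-square a b with ≤-total a b
  ... | inj₁ a≤b with m≤n⇒∃[o]m+o≡n a≤b
  ... | k , refl rewrite ∣m-m+n∣≡n a k = solve 2 (λ a k → k :* k :+ con 2 :* (a :* (a :+ k)) := a :* a :+ (a :+ k) :* (a :+ k)) refl a k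
  ∣-∣-square a b | inj₂ b≤a with m≤n⇒∃[o]m+o≡n b≤a
  ... | k , refl rewrite ∣-∣-comm (b + k) b | ∣m-m+n∣≡n b k = solve 2 (λ b k → k :* k :+ con 2 :* ((b :+ k) :* b) := (b :+ k) :* (b :+ k) :+ b :* b) refl b k

  square-cancel-≤ : ∀ {a b} → a * a ≤ b * b → a ≤ b
  square-cancel-≤ {a} {b} h with ≤-<-connex a b
  ... | inj₁ a≤b = a≤b
  ... | inj₂ b<a = contradiction h (<⇒≱ (*-mono-< b<a b<a))

  4ab≤[a+b]² : ∀ a b → 4 * (a * b) ≤ (a + b) * (a + b)
  4ab≤[a+b]² a b with ≤-total a b
  ... | inj₁ a≤b with m≤n⇒∃[o]m+o≡n a≤b
  ... | k , refl = ≤-trans (m≤m+n _ (k * k)) (≤-reflexive (solve 2 (λ a k → con 4 :* (a :* (a :+ k)) :+ k :* k := (a :+ (a :+ k)) :* (a :+ (a :+ k))) refl a k))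
  4ab≤[a+b]² a b | inj₂ b≤a with m≤n⇒∃[o]m+o≡n b≤a
  ... | k , refl = ≤-trans (m≤m+n _ (k * k)) (≤-reflexive (solve 2 (λ b k → con 4 :* ((b :+ k) :* b) :+ k :* k := (b :+ k :+ b) :* (b :+ k :+ b)) refl b k))

  -- This is `√(uv) + √(st) ≤ √((u+s)(v+t))` without roots. The cross term is the inequality of
  -- arithmetic and geometric means for `ut` and `sv`. It glues the two halves in the induction for
  -- `sumset-inequality`.
  cauchy-schwarz-step : ∀ Z {x y u v s t} → x * x ≤ Z * (u * v) → y * y ≤ Z * (s * t) →
                        (x + y) * (x + y) ≤ Z * ((u + s) * (v + t))
  cauchy-schwarz-step Z {x} {y} {u} {v} {s} {t} hx hy = begin
    (x + y) * (x + y) ≡⟨ solve 2 (λ x y → (x :+ y) :* (x :+ y) := x :* x :+ con 2 :* (x :* y) :+ y :* y) refl x y ⟩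
    x * x + 2 * (x * y) + y * y ≤⟨ +-mono-≤ (+-mono-≤ hx cross) hy ⟩
    Z * (u * v) + Z * (u * t + s * v) + Z * (s * t) ≡⟨ solve 5 (λ Z u v s t → Z :* (u :* v) :+ Z :* (u :* t :+ s :* v) :+ Z :* (s :* t) := Z :* ((u :+ s) :* (v :+ t))) refl Z u v s t ⟩
    Z * ((u + s) * (v + t)) ∎
    where
    open ≤-Reasoning
    cross : 2 * (x * y) ≤ Z * (u * t + s * v)
    cross = square-cancel-≤ (begin
      2 * (x * y) * (2 * (x * y)) ≡⟨ solve 2 (λ x y → con 2 :* (x :* y) :* (con 2 :* (x :* y)) := con 4 :* (x :* x :* (y :* y))) refl x y ⟩
      4 * (x * x * (y * y)) ≤⟨ *-monoʳ-≤ 4 (*-mono-≤ hx hy) ⟩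
      4 * (Z * (u * v) * (Z * (s * t))) ≡⟨ solve 5 (λ Z u v s t → con 4 :* (Z :* (u :* v) :* (Z :* (s :* t))) := Z :* Z :* (con 4 :* (u :* t :* (s :* v)))) refl Z u v s t ⟩
      Z * Z * (4 * (u * t * (s * v))) ≤⟨ *-monoʳ-≤ (Z * Z) (4ab≤[a+b]² (u * t) (s * v)) ⟩
      Z * Z * ((u * t + s * v) * (u * t + s * v)) ≡⟨ solve 2 (λ Z p → Z :* Z :* (p :* p) := Z :* p :* (Z :* p)) refl Z (u * t + s * v) ⟩
      Z * (u * t + s * v) * (Z * (u * t + s * v)) ∎)

  prime-divisor : ∀ d → 2 ≤ d → ∃ λ ℓ → ∃ λ e → Prime ℓ × d ≡ ℓ * e
  prime-divisor d@(suc _) 2≤d with factorise d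
  ... | record { factors = [] ; isFactorisation = d≡1 } = contradiction 2≤d (<⇒≱ (s≤s (≤-reflexive d≡1)))
  ... | record { factors = ℓ ∷ ps ; isFactorisation = d≡ ; factorsPrime = ℓ-prime ∷ _ } = ℓ , _ , ℓ-prime , d≡

  -- There is equality at `α = 5`, since `25/32 = 5²/2⁵`, and `α²/2^α` decreases from there. The
  -- remaining 7/32 absorbs the error terms in `generic-contradiction`.
  32α²≤25·2^α : ∀ k → 32 * ((5 + k) * (5 + k)) ≤ 25 * 2 ^ (5 + k)
  32α²≤25·2^α zero    = ≤-refl
  32α²≤25·2^α (suc k) = begin
    32 * ((6 + k) * (6 + k)) ≤⟨ *-monoʳ-≤ 32 (≤-trans (m≤m+n _ (k * k + 8 * k + 14)) (≤-reflexive
        (solve 1 (λ k → (con 6 :+ k) :* (con 6 :+ k) :+ (k :* k :+ con 8 :* k :+ con 14) := con 2 :* ((con 5 :+ k) :* (con 5 :+ k))) refl k))) ⟩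
    32 * (2 * ((5 + k) * (5 + k))) ≡⟨ solve 1 (λ x → con 32 :* (con 2 :* x) := con 2 :* (con 32 :* x)) refl ((5 + k) * (5 + k)) ⟩
    2 * (32 * ((5 + k) * (5 + k))) ≤⟨ *-monoʳ-≤ 2 (32α²≤25·2^α k) ⟩
    2 * (25 * 2 ^ (5 + k)) ≡⟨ solve 1 (λ x → con 2 :* (con 25 :* x) := con 25 :* (con 2 :* x)) refl (2 ^ (5 + k)) ⟩
    25 * 2 ^ (6 + k) ∎
    where
    open ≤-Reasoning

  n<2^n : ∀ n → n < 2 ^ n
  n<2^n zero    = s≤s z≤n
  n<2^n (suc n) = ≤-trans (s≤s (n<2^n n)) (≤-trans (+-monoˡ-≤ (2 ^ n) (>-nonZero⁻¹ (2 ^ n) {{m^n≢0 2 n}})) (≤-reflexive (cong (2 ^ n +_) (sym (+-identityʳ (2 ^ n))))))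

  ^-distribʳ-* : ∀ n x y → (x * y) ^ n ≡ x ^ n * y ^ n
  ^-distribʳ-* zero    x y = refl
  ^-distribʳ-* (suc n) x y = trans (cong (x * y *_) (^-distribʳ-* n x y))
    (solve 4 (λ x y u v → x :* y :* (u :* v) := x :* u :* (y :* v)) refl x y (x ^ n) (y ^ n))

  -- Induction on the exponent by halving `K`: with `h = K / 2`, one factor `2^h` dominates `h^s`
  -- and its constant, the other dominates the additional `h`. The witness ensures `1 ≤ h`, hence
  -- `K ≤ 3 h`.
  exponential-dominates : ∀ s c → ∃ λ K₀ → ∀ K → K₀ ≤ K → c * K ^ s < 2 ^ K
  exponential-dominates zero c = c , λ K c≤K → ≤-<-trans (≤-trans (≤-reflexive (*-identityʳ c)) c≤K) (n<2^n K)
  exponential-dominates (suc s) c = suc K₀ * 2 , bound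
    where
    open ≤-Reasoning
    IH = exponential-dominates s (c * 3 ^ suc s)
    K₀ = proj₁ IH
    bound : ∀ K → suc K₀ * 2 ≤ K → c * K ^ suc s < 2 ^ K
    bound K K₀≤K = begin-strict
      c * K ^ suc s ≤⟨ *-monoʳ-≤ c (^-monoˡ-≤ (suc s) K≤3h) ⟩
      c * (3 * h) ^ suc s ≡⟨ cong (c *_) (^-distribʳ-* (suc s) 3 h) ⟩
      c * (3 ^ suc s * h ^ suc s) ≡⟨ solve 4 (λ c t h g → c :* (t :* (h :* g)) := c :* t :* g :* h) refl c (3 ^ suc s) h (h ^ s) ⟩
      c * 3 ^ suc s * h ^ s * h <⟨ *-monoˡ-< h {{>-nonZero (≤-trans (s≤s z≤n) 1+K₀≤h)}} (proj₂ IH h (≤-trans (n≤1+n K₀) 1+K₀≤h)) ⟩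
      2 ^ h * h ≤⟨ *-monoʳ-≤ (2 ^ h) (<⇒≤ (n<2^n h)) ⟩
      2 ^ h * 2 ^ h ≡⟨ ^-distribˡ-+-* 2 h h ⟨
      2 ^ (h + h) ≤⟨ ^-monoʳ-≤ 2 2h≤K ⟩
      2 ^ K ∎
      where
      h = K / 2
      1+K₀≤h : suc K₀ ≤ h
      1+K₀≤h = ≤-trans (≤-reflexive (sym (m*n/n≡m (suc K₀) 2))) (/-monoˡ-≤ 2 K₀≤K)
      K≡ : K ≡ K % 2 + h * 2
      K≡ = m≡m%n+[m/n]*n K 2
      2h≤K : h + h ≤ K
      2h≤K = ≤-trans (≤-reflexive (solve 1 (λ h → h :+ h := h :* con 2) refl h)) (≤-trans (m≤n+m _ (K % 2)) (≤-reflexive (sym K≡)))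
      K≤3h : K ≤ 3 * h
      K≤3h = begin
        K ≡⟨ K≡ ⟩
        K % 2 + h * 2 ≤⟨ +-monoˡ-≤ (h * 2) (≤-trans (s≤s⁻¹ (m%n<n K 2)) (≤-trans (s≤s z≤n) 1+K₀≤h)) ⟩
        h + h * 2 ≡⟨ solve 1 (λ h → h :+ h :* con 2 := con 3 :* h) refl h ⟩
        3 * h ∎

  binary-log : ∀ q → ∃ λ K → suc q ≤ 2 ^ K × 2 ^ K ≤ 2 * suc q
  binary-log zero = 0 , s≤s z≤n , s≤s z≤n
  binary-log (suc q) with binary-log q
  ... | K , lower , upper with suc (suc q) ≤? 2 ^ K
  ... | yes h = K , h , ≤-trans upper (*-monoʳ-≤ 2 (n≤1+n (suc q)))
  ... | no h = suc K , ≤-trans (s≤s lower) (≤-trans (+-monoˡ-≤ (2 ^ K) (>-nonZero⁻¹ (2 ^ K) {{m^n≢0 2 K}})) (≤-reflexive (cong (2 ^ K +_) (sym (+-identityʳ _))))) ,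
                *-monoʳ-≤ 2 (<⇒≤ (≰⇒> h))

  integer-sqrt : ∀ q → ∃ λ r → r * r ≤ q × q < suc r * suc r
  integer-sqrt zero = 0 , z≤n , s≤s z≤n
  integer-sqrt (suc q) with integer-sqrt q
  ... | r , lower , upper with suc q <? suc r * suc r
  ... | yes h = r , m≤n⇒m≤1+n lower , h
  ... | no  h = suc r , ≮⇒≥ h , ≤-<-trans upper (*-mono-< {suc r} {suc (suc r)} ≤-refl ≤-refl)

  module _ (C : ℕ) where
    -- q ≤ C² K⁶ d¹⁰ together with d^(10 b) q^(10 a) ≤ q^b gives q ≤ (C² K⁶)^b, which fails for K ≈ log₂ q large.
    sqrt-dominates : ∀ a b → 0 < a → ∃ λ Q → ∀ q d → Q < q → d ^ (10 * b) * q ^ (10 * a) ≤ q ^ b →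
                     ∃ λ K → ∃ λ r → q ≤ 2 ^ K × 4 ≤ K × r * r ≤ q × q < suc r * suc r × C * (K * K * K * d ^ 5) ≤ r
    sqrt-dominates a b 0<a = 2 ^ K₁ , main
      where
      open ≤-Reasoning
      growth = exponential-dominates (6 * b) (2 * (C * C) ^ b)
      K₀ = proj₁ growth
      -- The 4 yields `4 ≤ K`, which makes room for the products of three linear factors and the
      -- sets of four conditions in the exceptional cases.
      K₁ = 4 + K₀
      main : ∀ q d → 2 ^ K₁ < q → d ^ (10 * b) * q ^ (10 * a) ≤ q ^ b →
             ∃ λ K → ∃ λ r → q ≤ 2 ^ K × 4 ≤ K × r * r ≤ q × q < suc r * suc r × C * (K * K * K * d ^ 5) ≤ r
      main q@(suc q-1) d Q<q small with binary-log q-1 | integer-sqrt q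
      ... | K , q≤2^K , 2^K≤2q | r , r²≤q , q<[r+1]² =
          K , r , q≤2^K , ≤-trans (m≤m+n 4 K₀) K₁≤K , r²≤q , q<[r+1]² , ≮⇒≥ (λ r<Z → <⇒≱ (proj₂ growth K (≤-trans (m≤n+m K₀ 4) K₁≤K)) (begin
            2 ^ K ≤⟨ 2^K≤2q ⟩
            2 * q ≤⟨ *-monoʳ-≤ 2 (q≤ r<Z) ⟩
            2 * (C * C * K ^ 6) ^ b ≡⟨ cong (2 *_) (^-distribʳ-* b (C * C) (K ^ 6)) ⟩
            2 * ((C * C) ^ b * (K ^ 6) ^ b) ≡⟨ cong (λ z → 2 * ((C * C) ^ b * z)) (^-*-assoc K 6 b) ⟩
            2 * ((C * C) ^ b * K ^ (6 * b)) ≡⟨ *-assoc 2 ((C * C) ^ b) (K ^ (6 * b)) ⟨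
            2 * (C * C) ^ b * K ^ (6 * b) ∎))
        where
        K₁≤K : K₁ ≤ K
        K₁≤K = ≮⇒≥ (λ K<K₁ → <⇒≱ Q<q (≤-trans q≤2^K (^-monoʳ-≤ 2 (<⇒≤ K<K₁))))
        Z = C * (K * K * K * d ^ 5)
        q≤ : r < Z → q ≤ (C * C * K ^ 6) ^ b
        q≤ r<Z = ≤-trans (≤-trans (≤-reflexive (sym (^-identityʳ q))) (^-monoʳ-≤ q (*-mono-≤ {1} {10} (s≤s z≤n) 0<a)))
          (*-cancelˡ-≤ (q ^ b) {{m^n≢0 q b}} (begin
            q ^ b * q ^ (10 * a) ≤⟨ *-monoˡ-≤ (q ^ (10 * a)) (^-monoˡ-≤ b (≤-trans (<⇒≤ q<[r+1]²) (*-mono-≤ r<Z r<Z))) ⟩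
            (Z * Z) ^ b * q ^ (10 * a) ≡⟨ cong (λ z → z ^ b * q ^ (10 * a)) Z² ⟩
            (C * C * K ^ 6 * d ^ 10) ^ b * q ^ (10 * a) ≡⟨ cong (_* q ^ (10 * a)) (trans (^-distribʳ-* b (C * C * K ^ 6) (d ^ 10)) (cong ((C * C * K ^ 6) ^ b *_) (^-*-assoc d 10 b))) ⟩
            (C * C * K ^ 6) ^ b * d ^ (10 * b) * q ^ (10 * a) ≡⟨ *-assoc ((C * C * K ^ 6) ^ b) _ _ ⟩
            (C * C * K ^ 6) ^ b * (d ^ (10 * b) * q ^ (10 * a)) ≤⟨ *-monoʳ-≤ ((C * C * K ^ 6) ^ b) small ⟩
            (C * C * K ^ 6) ^ b * q ^ b ≡⟨ *-comm ((C * C * K ^ 6) ^ b) (q ^ b) ⟩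
            q ^ b * (C * C * K ^ 6) ^ b ∎))
          where
          Z² : Z * Z ≡ C * C * K ^ 6 * d ^ 10
          Z² = trans (solve 3 (λ C K e → C :* (K :* K :* K :* e) :* (C :* (K :* K :* K :* e)) := C :* C :* (K :* (K :* (K :* (K :* (K :* (K :* con 1)))))) :* (e :* e)) refl C K (d ^ 5))
                 (cong (C * C * K ^ 6 *_) (sym (^-distribˡ-+-* d 5 5)))

  -- The choice of parameters in Stepanov's method: multiplicity n I and J = I + 5 K powers of X^q, with n J ≈ √q.
  module Parameters (n m K d r κ I : ℕ) {{n≢0 : NonZero n}} {{m≢0 : NonZero m}}
                    (κ<K : κ < K) (n≤d : n ≤ d) (12Kd≤r : 12 * (K * d) ≤ r)
                    (r²≤q : r * r ≤ suc (n * m)) (q<[r+1]² : suc (n * m) < suc r * suc r)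
                    (nJ≤r : n * (I + 5 * K) ≤ r) (r<nJ+n : r < n * (I + 5 * K) + n) where
    open ≤-Reasoning
    q J : ℕ
    q = suc (n * m)
    J = I + 5 * K

    private
      1≤n : 1 ≤ n
      1≤n = >-nonZero⁻¹ n

      1≤m : 1 ≤ m
      1≤m = >-nonZero⁻¹ m

      1≤K : 1 ≤ K
      1≤K = ≤-trans (s≤s z≤n) κ<K

      1≤Kn : 1 ≤ K * n
      1≤Kn = *-mono-≤ 1≤K 1≤n

      12Kn≤r : 12 * (K * n) ≤ r
      12Kn≤r = ≤-trans (*-monoʳ-≤ 12 (*-monoʳ-≤ K n≤d)) 12Kd≤r

      1≤r : 1 ≤ r
      1≤r = ≤-trans (≤-trans (s≤s z≤n) (*-monoʳ-≤ 12 1≤Kn)) 12Kn≤r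

      nonZero-r : NonZero r
      nonZero-r = >-nonZero 1≤r

      m≤q : m ≤ q
      m≤q = ≤-trans (m≤n*m m n) (n≤1+n _)

      nI≤r : n * I ≤ r
      nI≤r = ≤-trans (*-monoʳ-≤ n (m≤m+n I _)) nJ≤r

      r≤q : r ≤ q
      r≤q = ≤-trans (m≤n*m r r {{nonZero-r}}) r²≤q

      -- Twice the inequality `r < n J + n`: replacing `J + 1` by `I` costs `2 n + 10 K n ≤ 12 K n`,
      -- which is the origin of the 12 in `12Kd≤r`.
      r≤2nI : r ≤ 2 * (n * I)
      r≤2nI = +-cancelʳ-≤ (2 * n + 10 * (K * n)) _ _ (begin
        r + (2 * n + 10 * (K * n)) ≤⟨ +-monoʳ-≤ r (≤-trans (+-monoˡ-≤ _ (*-monoʳ-≤ 2 (≤-trans (≤-reflexive (sym (*-identityˡ n))) (*-monoˡ-≤ n 1≤K))))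
            (≤-trans (≤-reflexive (solve 1 (λ x → con 2 :* x :+ con 10 :* x := con 12 :* x) refl (K * n))) 12Kn≤r)) ⟩
        r + r ≡⟨ cong (r +_) (+-identityʳ r) ⟨
        2 * r ≤⟨ *-monoʳ-≤ 2 (<⇒≤ r<nJ+n) ⟩
        2 * (n * (I + 5 * K) + n) ≡⟨ solve 3 (λ n I K → con 2 :* (n :* (I :+ con 5 :* K) :+ n) := con 2 :* (n :* I) :+ (con 2 :* n :+ con 10 :* (K :* n))) refl n I K ⟩
        2 * (n * I) + (2 * n + 10 * (K * n)) ∎)

      q≤8rnI : q ≤ 8 * r * (n * I)
      q≤8rnI = begin
        q ≤⟨ <⇒≤ q<[r+1]² ⟩
        suc r * suc r ≤⟨ *-mono-≤ r+1≤2r r+1≤2r ⟩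
        2 * r * (2 * r) ≤⟨ *-monoʳ-≤ (2 * r) (*-monoʳ-≤ 2 r≤2nI) ⟩
        2 * r * (2 * (2 * (n * I))) ≡⟨ solve 2 (λ r x → con 2 :* r :* (con 2 :* (con 2 :* x)) := con 8 :* r :* x) refl r (n * I) ⟩
        8 * r * (n * I) ∎
        where
        r+1≤2r : suc r ≤ 2 * r
        r+1≤2r = ≤-trans (+-monoˡ-≤ r 1≤r) (≤-reflexive (cong (r +_) (sym (+-identityʳ r))))

    M≤q : n * I ≤ q
    M≤q = ≤-trans nI≤r r≤q

    -- After division by `n`, the unknowns exceed `I m` by `5 K m`. The rest of the equations
    -- amounts to at most `(1 + κ) n J²`, which is at most `K (m + 1) ≤ 2 K m` because
    -- `(n J)² ≤ r² ≤ q`.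
    few-equations : n * I * (m + J + κ * (n * I)) < n * J * m
    few-equations = begin-strict
      n * I * (m + J + κ * (n * I)) ≡⟨ solve 5 (λ n I m J κ → n :* I :* (m :+ J :+ κ :* (n :* I)) := n :* (I :* m :+ I :* (J :+ κ :* (n :* I)))) refl n I m J κ ⟩
      n * (I * m + I * (J + κ * (n * I))) <⟨ *-monoʳ-< n (+-monoʳ-< (I * m) small) ⟩
      n * (I * m + 5 * K * m) ≡⟨ solve 4 (λ n I m K → n :* (I :* m :+ con 5 :* K :* m) := n :* (I :+ con 5 :* K) :* m) refl n I m K ⟩
      n * J * m ∎
      where
      I≤J : I ≤ J
      I≤J = m≤m+n I _
      nJ²≤1+m : n * (J * J) ≤ suc m
      nJ²≤1+m = *-cancelˡ-≤ n (begin
        n * (n * (J * J)) ≡⟨ solve 2 (λ n J → n :* (n :* (J :* J)) := n :* J :* (n :* J)) refl n J ⟩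
        n * J * (n * J) ≤⟨ *-mono-≤ nJ≤r nJ≤r ⟩
        r * r ≤⟨ r²≤q ⟩
        suc (n * m) ≤⟨ +-monoˡ-≤ (n * m) 1≤n ⟩
        n + n * m ≡⟨ *-suc n m ⟨
        n * suc m ∎)
      small : I * (J + κ * (n * I)) < 5 * K * m
      small = begin-strict
        I * (J + κ * (n * I)) ≤⟨ *-mono-≤ I≤J (+-mono-≤ (≤-trans (≤-reflexive (sym (*-identityˡ J))) (*-monoˡ-≤ J 1≤n)) (*-monoʳ-≤ κ (*-monoʳ-≤ n I≤J))) ⟩
        J * (n * J + κ * (n * J)) ≡⟨ solve 3 (λ J n κ → J :* (n :* J :+ κ :* (n :* J)) := (con 1 :+ κ) :* (n :* (J :* J))) refl J n κ ⟩
        suc κ * (n * (J * J)) ≤⟨ *-mono-≤ κ<K nJ²≤1+m ⟩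
        K * suc m ≤⟨ *-monoʳ-≤ K (+-monoˡ-≤ m 1≤m) ⟩
        K * (m + m) ≡⟨ solve 2 (λ K m → K :* (m :+ m) := con 2 :* (K :* m)) refl K m ⟩
        2 * (K * m) <⟨ *-monoˡ-< (K * m) {{>-nonZero (*-mono-≤ 1≤K 1≤m)}} {2} {5} (s≤s (s≤s (s≤s z≤n))) ⟩
        5 * (K * m) ≡⟨ *-assoc 5 K m ⟨
        5 * K * m ∎

    -- The part `q I` of the right side gives the main term `m (n I)`. Everything else is at most
    -- `8 K n q`, and `q ≤ 8 r (n I)`, whence 64.
    conclusion : ∀ {v} → v * (n * I) < m + q * (J + K * n) → v ≤ m + 64 * (K * d * r)
    conclusion {v} h = *-cancelʳ-≤ v _ (n * I) {{nI≢0}} (begin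
      v * (n * I) ≤⟨ <⇒≤ h ⟩
      m + q * (J + K * n) ≡⟨ solve 4 (λ n m I K → m :+ (con 1 :+ n :* m) :* (I :+ con 5 :* K :+ K :* n) := m :* (n :* I) :+ (m :+ I :+ (con 1 :+ n :* m) :* (con 5 :* K :+ K :* n))) refl n m I K ⟩
      m * (n * I) + (m + I + q * (5 * K + K * n)) ≤⟨ +-monoʳ-≤ (m * (n * I)) rest ⟩
      m * (n * I) + 64 * (K * d * r) * (n * I) ≡⟨ *-distribʳ-+ (n * I) m _ ⟨
      (m + 64 * (K * d * r)) * (n * I) ∎)
      where
      nI≢0 : NonZero (n * I)
      nI≢0 = ≢-nonZero (λ eq → <⇒≱ 1≤r (subst (λ z → r ≤ 2 * z) eq r≤2nI))
      I≤q : I ≤ q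
      I≤q = ≤-trans (m≤n*m I n) M≤q
      rest : m + I + q * (5 * K + K * n) ≤ 64 * (K * d * r) * (n * I)
      rest = begin
        m + I + q * (5 * K + K * n) ≤⟨ +-monoˡ-≤ _ (+-mono-≤ m≤q I≤q) ⟩
        q + q + q * (5 * K + K * n) ≡⟨ solve 2 (λ q x → q :+ q :+ q :* x := q :* (con 2 :+ x)) refl q (5 * K + K * n) ⟩
        q * (2 + (5 * K + K * n)) ≤⟨ *-mono-≤ q≤8rnI (+-mono-≤ (*-monoʳ-≤ 2 1≤Kn) (+-monoˡ-≤ (K * n) (*-monoʳ-≤ 5 (≤-trans (≤-reflexive (sym (*-identityʳ K))) (*-monoʳ-≤ K 1≤n))))) ⟩
        8 * r * (n * I) * (2 * (K * n) + (5 * (K * n) + K * n)) ≡⟨ solve 3 (λ r x y → con 8 :* r :* x :* (con 2 :* y :+ (con 5 :* y :+ y)) := con 64 :* (y :* r) :* x) refl r (n * I) (K * n) ⟩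
        64 * (K * n * r) * (n * I) ≤⟨ *-monoˡ-≤ (n * I) (*-monoʳ-≤ 64 (*-monoˡ-≤ r (*-monoʳ-≤ K n≤d))) ⟩
        64 * (K * d * r) * (n * I) ∎

  -- 10000000 only has to exceed 8992364 = 4 · 131³, the constant that arises in E³<m².
  module Constants (K d r m : ℕ) (1≤K : 1 ≤ K) (1≤d : 1 ≤ d) (r²≤q : r * r ≤ suc (d * m))
                   (big : 10000000 * (K * K * K * d ^ 5) ≤ r) where
    open ≤-Reasoning

    P X δ : ℕ
    P = K * d * r
    X = K * K * K * d ^ 5
    δ = 64 * P + K

    private
      1≤d^ : ∀ n → 1 ≤ d ^ n
      1≤d^ n = >-nonZero⁻¹ _ {{m^n≢0 d n {{>-nonZero 1≤d}}}}

      1≤X : 1 ≤ X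
      1≤X = *-mono-≤ (*-mono-≤ (*-mono-≤ 1≤K 1≤K) 1≤K) (1≤d^ 5)

      below-r : ∀ c Y → c < 10000000 → Y ≤ X → c * Y < r
      below-r c Y c< Y≤X = begin-strict
        c * Y ≤⟨ *-monoʳ-≤ c Y≤X ⟩
        c * X <⟨ *-monoˡ-< X {{>-nonZero 1≤X}} c< ⟩
        10000000 * X ≤⟨ big ⟩
        r ∎

      1≤r : 1 ≤ r
      1≤r = ≤-trans (s≤s z≤n) (below-r 0 X (from-yes (0 <? 10000000)) ≤-refl)

      instance
        r≢0 : NonZero r
        r≢0 = >-nonZero 1≤r

      1≤P : 1 ≤ P
      1≤P = *-mono-≤ (*-mono-≤ 1≤K 1≤d) 1≤r

      K≤P : K ≤ P
      K≤P = ≤-trans (≤-reflexive (sym (trans (*-identityʳ _) (*-identityʳ K)))) (*-mono-≤ (*-monoʳ-≤ K 1≤d) 1≤r)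

      δ≤65P : δ ≤ 65 * P
      δ≤65P = ≤-trans (+-monoʳ-≤ (64 * P) K≤P) (≤-reflexive (solve 1 (λ P → con 64 :* P :+ P := con 65 :* P) refl P))

      1≤m : 1 ≤ m
      1≤m = ≮⇒≥ (λ m<1 → <⇒≱ (below-r 1 X (from-yes (1 <? 10000000)) ≤-refl) (begin
        r ≤⟨ m≤m*n r r ⟩
        r * r ≤⟨ r²≤q ⟩
        suc (d * m) ≡⟨ cong (λ z → suc (d * z)) (n<1⇒n≡0 m<1) ⟩
        suc (d * 0) ≡⟨ cong suc (*-zeroʳ d) ⟩
        1 ≤⟨ 1≤X ⟩
        X ≡⟨ *-identityˡ X ⟨
        1 * X ∎))

      r²≤2dm : r * r ≤ 2 * (d * m)
      r²≤2dm = ≤-trans r²≤q (≤-trans (+-monoˡ-≤ (d * m) (*-mono-≤ 1≤d 1≤m)) (≤-reflexive (cong (d * m +_) (sym (+-identityʳ _)))))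

      -- Via `r² ≤ 2 d m`, a lower bound for `r` becomes one for `m`: if `m ≤ c Y r`, then
      -- `r ≤ 2 c d Y`.
      m-large : ∀ c Y → 2 * c < 10000000 → d * Y ≤ X → c * (Y * r) < m
      m-large c Y c< dY≤X = ≰⇒> (λ m≤ → <⇒≱ (below-r (2 * c) (d * Y) c< dY≤X) (*-cancelʳ-≤ r _ r (begin
        r * r ≤⟨ r²≤2dm ⟩
        2 * (d * m) ≤⟨ *-monoʳ-≤ 2 (*-monoʳ-≤ d m≤) ⟩
        2 * (d * (c * (Y * r))) ≡⟨ solve 4 (λ d c Y r → con 2 :* (d :* (c :* (Y :* r))) := con 2 :* c :* (d :* Y) :* r) refl d c Y r ⟩
        2 * c * (d * Y) * r ∎)))

      1≤KK : 1 ≤ K * K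
      1≤KK = *-mono-≤ 1≤K 1≤K

    12Kd≤r : 12 * (K * d) ≤ r
    12Kd≤r = <⇒≤ (below-r 12 (K * d) (from-yes (12 <? 10000000)) (begin
      K * d ≡⟨ solve 2 (λ K d → K :* d := con 1 :* K :* (d :* con 1)) refl K d ⟩
      1 * K * (d * 1) ≤⟨ *-mono-≤ (*-monoˡ-≤ K 1≤KK) (*-monoʳ-≤ d (1≤d^ 4)) ⟩
      X ∎))

    d²r<m : d * (d * suc r) < m
    d²r<m = ≤-<-trans (begin
      d * (d * suc r) ≤⟨ *-monoʳ-≤ d (*-monoʳ-≤ d (+-monoˡ-≤ r 1≤r)) ⟩
      d * (d * (r + r)) ≡⟨ solve 2 (λ d r → d :* (d :* (r :+ r)) := con 2 :* (d :* d :* r)) refl d r ⟩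
      2 * (d * d * r) ∎) (m-large 2 (d * d) (from-yes (4 <? 10000000)) (begin
      d * (d * d) ≡⟨ solve 1 (λ d → d :* (d :* d) := con 1 :* con 1 :* (d :* (d :* (d :* con 1)))) refl d ⟩
      1 * 1 * d ^ 3 ≤⟨ *-mono-≤ (*-mono-≤ 1≤KK 1≤K) (^-monoʳ-≤ d {{>-nonZero 1≤d}} {3} {5} (m≤m+n 3 2)) ⟩
      X ∎))

    Kδ<m : 100 * (K * δ) < m
    Kδ<m = ≤-<-trans (begin
      100 * (K * δ) ≤⟨ *-monoʳ-≤ 100 (*-monoʳ-≤ K δ≤65P) ⟩
      100 * (K * (65 * P)) ≡⟨ solve 3 (λ K d r → con 100 :* (K :* (con 65 :* (K :* d :* r))) := con 6500 :* (K :* K :* d :* r)) refl K d r ⟩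
      6500 * (K * K * d * r) ∎) (m-large 6500 (K * K * d) (from-yes (13000 <? 10000000)) (begin
      d * (K * K * d) ≡⟨ solve 2 (λ K d → d :* (K :* K :* d) := K :* K :* con 1 :* (d :* (d :* con 1))) refl K d ⟩
      K * K * 1 * d ^ 2 ≤⟨ *-mono-≤ (*-monoʳ-≤ (K * K) 1≤K) (^-monoʳ-≤ d {{>-nonZero 1≤d}} {2} {5} (m≤m+n 2 3)) ⟩
      X ∎))

    E³<m² : (1 + 2 * δ) * ((1 + 2 * δ) * (1 + 2 * δ)) < m * m
    E³<m² = ≰⇒> (λ m²≤E³ → <⇒≱ (below-r (4 * (131 * (131 * 131))) X (from-yes (4 * (131 * (131 * 131)) <? 10000000)) ≤-refl)
      (*-cancelʳ-≤ r _ (r * r * r) {{m*n≢0 (r * r) r {{m*n≢0 r r}}}} (begin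
        r * (r * r * r) ≡⟨ solve 1 (λ r → r :* (r :* r :* r) := r :* r :* (r :* r)) refl r ⟩
        r * r * (r * r) ≤⟨ *-mono-≤ r²≤2dm r²≤2dm ⟩
        2 * (d * m) * (2 * (d * m)) ≡⟨ solve 2 (λ d m → con 2 :* (d :* m) :* (con 2 :* (d :* m)) := con 4 :* (d :* d) :* (m :* m)) refl d m ⟩
        4 * (d * d) * (m * m) ≤⟨ *-monoʳ-≤ (4 * (d * d)) (≤-trans m²≤E³ (*-mono-≤ E≤131P (*-mono-≤ E≤131P E≤131P))) ⟩
        4 * (d * d) * (131 * P * (131 * P * (131 * P))) ≡⟨ rearrange 131 ⟩
        4 * (131 * (131 * 131)) * X * (r * r * r) ∎)))
      where
      E≤131P : 1 + 2 * δ ≤ 131 * P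
      E≤131P = ≤-trans (+-mono-≤ 1≤P (*-monoʳ-≤ 2 δ≤65P)) (≤-reflexive (solve 1 (λ P → P :+ con 2 :* (con 65 :* P) := con 131 :* P) refl P))
      rearrange : ∀ c → 4 * (d * d) * (c * P * (c * P * (c * P))) ≡ 4 * (c * (c * c)) * X * (r * r * r)
      rearrange c = solve 4 (λ c K d r → con 4 :* (d :* d) :* (c :* (K :* d :* r) :* (c :* (K :* d :* r) :* (c :* (K :* d :* r))))
        := con 4 :* (c :* (c :* c)) :* (K :* K :* K :* (d :* (d :* (d :* (d :* (d :* con 1)))))) :* (r :* r :* r)) refl c K d r

open NatBounds

-- Finite fields

module Field {q : ℕ} (F : FiniteField q) where
  open FiniteField F public using (Carrier; 0≢1; inverse)

  ring : CommutativeRing 0ℓ 0ℓ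
  ring = record { isCommutativeRing = FiniteField.isCommutativeRing F }

  open CommutativeRing ring public
    using (_+_; _*_; -_; 0#; 1#; _-_; +-comm; +-assoc; +-identityˡ; +-identityʳ; *-comm; *-assoc; *-identityˡ; *-identityʳ;
           distribˡ; distribʳ; zeroˡ; zeroʳ; -‿inverseˡ; -‿inverseʳ; +-commutativeMonoid; *-commutativeMonoid; semiring; commutativeSemiring)
  open Algebra.Properties.Ring (CommutativeRing.ring ring) public
    using (-‿involutive; +-cancelˡ; +-cancelʳ; -0#≈0#; x∙y⁻¹≈ε⇒x≈y; -1*x≈-x)
  open Algebra.Properties.CommutativeSemiring.Exp commutativeSemiring public
    using (_^_; ^-homo-*; ^-assocʳ; ^-distrib-*)
  open Algebra.Properties.Semiring.Mult semiring public using (×1-homo-*) renaming (_×_ to _·_)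

  open ≡-Reasoning

  elem : Fin q → Carrier
  elem = Inverse.to (FiniteField.enumeration F)

  index : Carrier → Fin q
  index = Inverse.from (FiniteField.enumeration F)

  elem-index : ∀ x → elem (index x) ≡ x
  elem-index x = Inverse.inverseˡ (FiniteField.enumeration F) refl

  index-elem : ∀ i → index (elem i) ≡ i
  index-elem i = Inverse.inverseʳ (FiniteField.enumeration F) refl

  elem-injective : ∀ {i j} → elem i ≡ elem j → i ≡ j
  elem-injective {i} {j} eq = trans (sym (index-elem i)) (trans (cong index eq) (index-elem j))

  infix 4 _≟_
  _≟_ : (x y : Carrier) → Dec (x ≡ y)
  x ≟ y = map′ (λ eq → trans (sym (elem-index x)) (trans (cong elem eq) (elem-index y))) (cong index) (index x Fin.≟ index y)

  elems : List Carrier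
  elems = tabulate elem

  ∈elems : ∀ x → x ∈ elems
  ∈elems x = subst (_∈ elems) (elem-index x) (∈-tabulate⁺ (index x))

  elems-unique : Unique elems
  elems-unique = tabulate⁺ elem-injective

  length-elems : length elems ≡ q
  length-elems = length-tabulate elem

  1≢0 : ¬ (1# ≡ 0#)
  1≢0 eq = 0≢1 (sym eq)

  *-cancelˡ : ∀ {x y z} → ¬ (x ≡ 0#) → x * y ≡ x * z → y ≡ z
  *-cancelˡ {x} {y} {z} x≢0 eq = begin
    y ≡⟨ *-identityˡ y ⟨
    1# * y ≡⟨ cong (_* y) i*x ⟨
    i * x * y ≡⟨ *-assoc i x y ⟩
    i * (x * y) ≡⟨ cong (i *_) eq ⟩
    i * (x * z) ≡⟨ *-assoc i x z ⟨
    i * x * z ≡⟨ cong (_* z) i*x ⟩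
    1# * z ≡⟨ *-identityˡ z ⟩
    z ∎
    where
    i = proj₁ (inverse x x≢0)
    i*x : i * x ≡ 1#
    i*x = trans (*-comm i x) (proj₂ (inverse x x≢0))

  *-cancelʳ : ∀ {x y z} → ¬ (x ≡ 0#) → y * x ≡ z * x → y ≡ z
  *-cancelʳ {x} {y} {z} x≢0 eq = *-cancelˡ x≢0 (trans (*-comm x y) (trans eq (*-comm z x)))

  x*y≡0⇒ : ∀ {x y} → x * y ≡ 0# → x ≡ 0# ⊎ y ≡ 0#
  x*y≡0⇒ {x} {y} eq with x ≟ 0#
  ... | yes x≡0 = inj₁ x≡0
  ... | no  x≢0 = inj₂ (*-cancelˡ x≢0 (trans eq (sym (zeroʳ x))))

  x*y≢0 : ∀ {x y} → ¬ (x ≡ 0#) → ¬ (y ≡ 0#) → ¬ (x * y ≡ 0#)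
  x*y≢0 x≢0 y≢0 eq with x*y≡0⇒ eq
  ... | inj₁ h = x≢0 h
  ... | inj₂ h = y≢0 h

  x^n≢0 : ∀ {x} n → ¬ (x ≡ 0#) → ¬ (x ^ n ≡ 0#)
  x^n≢0 zero    x≢0 = 1≢0
  x^n≢0 (suc n) x≢0 = x*y≢0 x≢0 (x^n≢0 n x≢0)

  0^1+n : ∀ n → 0# ^ suc n ≡ 0#
  0^1+n n = zeroˡ (0# ^ n)

  1^n : ∀ n → 1# ^ n ≡ 1#
  1^n zero    = refl
  1^n (suc n) = trans (*-identityˡ _) (1^n n)

  open Algebra.Properties.CommutativeMonoid.Sum *-commutativeMonoid using ()
    renaming (sum to ∏; sum-permute to ∏-permute; ∑-distrib-+ to ∏-distrib-*; sum-cong-≗ to ∏-cong; sum-remove to ∏-remove; sum-replicate to ∏-replicate)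
  open Algebra.Properties.CommutativeMonoid.Sum +-commutativeMonoid using (sum; sum-permute; sum-cong-≗; sum-replicate) renaming (∑-distrib-+ to sum-distrib-+)

  private
    -- Replacing 0 by 1 lets the product of the nonzero elements run over all of `Fin q`; `scaling`
    -- is the matching modification of the constant factor `a`.
    unit-or-1 : Carrier → Carrier
    unit-or-1 x with x ≟ 0#
    ... | yes _ = 1#
    ... | no  _ = x

    unit-or-1≢0 : ∀ x → ¬ (unit-or-1 x ≡ 0#)
    unit-or-1≢0 x with x ≟ 0#
    ... | yes _ = 1≢0
    ... | no  h = h

    scaling : Carrier → Carrier → Carrier
    scaling a x with x ≟ 0#
    ... | yes _ = 1#
    ... | no  _ = a

    scaling-0 : ∀ a x → x ≡ 0# → scaling a x ≡ 1#
    scaling-0 a x eq with x ≟ 0#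
    ... | yes _ = refl
    ... | no  h = contradiction eq h

    scaling-≢0 : ∀ a x → ¬ (x ≡ 0#) → scaling a x ≡ a
    scaling-≢0 a x ne with x ≟ 0#
    ... | yes h = contradiction h ne
    ... | no  _ = refl

    unit-or-1-* : ∀ a x → ¬ (a ≡ 0#) → unit-or-1 (a * x) ≡ scaling a x * unit-or-1 x
    unit-or-1-* a x a≢0 with x ≟ 0# | a * x ≟ 0#
    ... | yes _    | yes _  = sym (*-identityˡ 1#)
    ... | yes x≡0  | no  h  = contradiction (trans (cong (a *_) x≡0) (zeroʳ a)) h
    ... | no  x≢0  | yes h  = contradiction h (x*y≢0 a≢0 x≢0)
    ... | no  _    | no  _  = refl

    ∏≢0 : ∀ {n} (t : Fin n → Carrier) → (∀ i → ¬ (t i ≡ 0#)) → ¬ (∏ t ≡ 0#)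
    ∏≢0 {zero}  t h = 1≢0
    ∏≢0 {suc n} t h = x*y≢0 (h zero) (∏≢0 (t ∘ suc) (h ∘ suc))

    ∏-all-but-one : ∀ {n} (t : Fin (suc n) → Carrier) (i : Fin (suc n)) a →
                    t i ≡ 1# → (∀ j → ¬ (j ≡ i) → t j ≡ a) → ∏ t ≡ a ^ n
    ∏-all-but-one {n} t i a t≡1 t≡a = begin
      ∏ t ≡⟨ ∏-remove {i = i} t ⟩
      t i * ∏ (λ j → t (punchIn i j)) ≡⟨ cong₂ _*_ t≡1 (∏-cong (λ j → t≡a (punchIn i j) (λ eq → Fin.punchInᵢ≢i i j eq))) ⟩
      1# * ∏ {n} (λ _ → a) ≡⟨ *-identityˡ _ ⟩
      ∏ {n} (λ _ → a) ≡⟨ ∏-replicate n ⟩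
      a ^ n ∎

  module _ (a : Carrier) (a≢0 : ¬ (a ≡ 0#)) where
    private
      a⁻¹ = proj₁ (inverse a a≢0)
      a*a⁻¹ = proj₂ (inverse a a≢0)

      cancel : ∀ x → a * (a⁻¹ * x) ≡ x
      cancel x = trans (sym (*-assoc a a⁻¹ x)) (trans (cong (_* x) a*a⁻¹) (*-identityˡ x))

      mult : Permutation q q
      mult = permutation (λ i → index (a * elem i)) (λ i → index (a⁻¹ * elem i))
        (λ i → trans (cong index (trans (cong (a *_) (elem-index _)) (cancel (elem i)))) (index-elem i))
        (λ i → trans (cong index (*-cancelˡ a≢0 (trans (cancel _) (elem-index _)))) (index-elem i))

      ∏-scaling : ∏ (λ i → scaling a (elem i)) ≡ 1#
      ∏-scaling = *-cancelʳ (∏≢0 u (λ i → unit-or-1≢0 (elem i))) (begin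
        ∏ s * ∏ u ≡⟨ ∏-distrib-* s u ⟨
        ∏ (λ i → s i * u i) ≡⟨ ∏-cong (λ i → unit-or-1-* a (elem i) a≢0) ⟨
        ∏ (λ i → unit-or-1 (a * elem i)) ≡⟨ ∏-cong (λ i → cong unit-or-1 (elem-index (a * elem i))) ⟨
        ∏ (λ i → u (index (a * elem i))) ≡⟨ ∏-permute u mult ⟨
        ∏ u ≡⟨ *-identityˡ _ ⟨
        1# * ∏ u ∎)
        where
        s u : Fin q → Carrier
        s i = scaling a (elem i)
        u i = unit-or-1 (elem i)

    -- Multiplication by `a` permutes the field. The product of the nonzero elements is therefore
    -- multiplied by `a^(q-1)` and at the same time unchanged.
    fermat : ∀ N → q ≡ suc N → a ^ N ≡ 1#
    fermat N refl = trans (sym (∏-all-but-one _ (index 0#) a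
        (scaling-0 a _ (elem-index 0#))
        (λ j j≢ → scaling-≢0 a _ (λ eq → j≢ (trans (sym (index-elem j)) (cong index eq))))))
      ∏-scaling

  x^q≡x : ∀ x → x ^ q ≡ x
  x^q≡x x = by-cases (x ≟ 0#) q refl
    where
    by-cases : Dec (x ≡ 0#) → ∀ Q → q ≡ Q → x ^ Q ≡ x
    by-cases _        zero    eq = contradiction (subst Fin eq (index 0#)) λ ()
    by-cases (yes x≡0) (suc N) eq = trans (cong (_* x ^ N) x≡0) (trans (zeroˡ _) (sym x≡0))
    by-cases (no x≢0)  (suc N) eq = trans (cong (x *_) (fermat x x≢0 N eq)) (*-identityʳ x)

  -- Translation by 1 permutes the field, so adding 1 to each of the `q` elements leaves their sum
  -- unchanged.
  q·1≡0 : q · 1# ≡ 0#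
  q·1≡0 = sym (+-cancelˡ (sum elem) _ _ (begin
      sum elem + 0# ≡⟨ +-identityʳ _ ⟩
      sum elem ≡⟨ sum-permute elem shift ⟩
      sum (λ i → elem (index (elem i + 1#))) ≡⟨ sum-cong-≗ {q} (λ i → elem-index (elem i + 1#)) ⟩
      sum (λ i → elem i + 1#) ≡⟨ sum-distrib-+ elem (λ _ → 1#) ⟩
      sum elem + sum {q} (λ _ → 1#) ≡⟨ cong (sum elem +_) (sum-replicate q) ⟩
      sum elem + q · 1# ∎))
    where
    shift : Permutation q q
    shift = permutation (λ i → index (elem i + 1#)) (λ i → index (elem i - 1#))
      (λ i → trans (cong index (trans (cong (_+ 1#) (elem-index _))
        (trans (+-assoc _ _ _) (trans (cong (elem i +_) (-‿inverseˡ 1#)) (+-identityʳ _))))) (index-elem i))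
      (λ i → trans (cong index (trans (cong (_- 1#) (elem-index _))
        (trans (+-assoc _ _ _) (trans (cong (elem i +_) (-‿inverseʳ 1#)) (+-identityʳ _))))) (index-elem i))

  p^k·1≡0⇒p·1≡0 : ∀ p k → (p ℕ.^ k) · 1# ≡ 0# → p · 1# ≡ 0#
  p^k·1≡0⇒p·1≡0 p zero    eq = contradiction (trans (sym (+-identityʳ 1#)) eq) 1≢0
  p^k·1≡0⇒p·1≡0 p (suc k) eq with x*y≡0⇒ (trans (sym (×1-homo-* p (p ℕ.^ k))) eq)
  ... | inj₁ h = h
  ... | inj₂ h = p^k·1≡0⇒p·1≡0 p k h

  char : IsPrimePower q → ∃ λ p → ∃ λ k → Prime p × q ≡ p ℕ.^ k × p · 1# ≡ 0#
  char (p , k , pp , _ , eq) = p , k , pp , eq , p^k·1≡0⇒p·1≡0 p k (subst (λ z → z · 1# ≡ 0#) eq q·1≡0)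

-- Power series and polynomials

module Series {q : ℕ} (F : FiniteField q) where
  open Field F
  open ≡-Reasoning
  private module S = Algebra.Solver.Ring.NaturalCoefficients.Default commutativeSemiring
  open S using (_:+_; _:*_; _:=_)

  Series : Set
  Series = ℕ → Carrier

  infixl 6 _⊕_
  infixl 7 _⊗_ _◂_

  -- The Cauchy product, obtained by unfolding the first factor as `f 0 + w (f ∘ suc)`. All laws
  -- then follow by induction on the index, without finite sums.
  _⊕_ _⊗_ : Series → Series → Series
  (f ⊕ g) n = f n + g n
  (f ⊗ g) zero    = f 0 * g 0
  (f ⊗ g) (suc n) = f 0 * g (suc n) + ((f ∘ suc) ⊗ g) n

  _◂_ : Carrier → Series → Series
  (c ◂ f) n = c * f n

  const : Carrier → Series
  const c zero    = c
  const c (suc n) = 0#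

  w : Series
  w zero    = 0#
  w (suc n) = const 1# n

  neg : Series → Series
  neg f n = - f n

  -- A coefficient of a product sees only the coefficients up to its own index, so congruence modulo
  -- a power of `w` respects products.
  ⊗-cong≤ : ∀ n {f f′ g g′ : Series} → (∀ {i} → i ≤ n → f i ≡ f′ i) → (∀ {i} → i ≤ n → g i ≡ g′ i) → (f ⊗ g) n ≡ (f′ ⊗ g′) n
  ⊗-cong≤ zero    hf hg = cong₂ _*_ (hf z≤n) (hg z≤n)
  ⊗-cong≤ (suc n) hf hg = cong₂ _+_ (cong₂ _*_ (hf z≤n) (hg ℕ.≤-refl)) (⊗-cong≤ n (hf ∘ s≤s) (hg ∘ ℕ.m≤n⇒m≤1+n))

  ⊗-zeroˡ : ∀ {f} g n → (∀ i → f i ≡ 0#) → (f ⊗ g) n ≡ 0#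
  ⊗-zeroˡ g zero    h = trans (cong (_* g 0) (h 0)) (zeroˡ _)
  ⊗-zeroˡ g (suc n) h = trans (cong₂ _+_ (trans (cong (_* g (suc n)) (h 0)) (zeroˡ _)) (⊗-zeroˡ g n (h ∘ suc))) (+-identityˡ 0#)

  const-⊗ : ∀ c g n → (const c ⊗ g) n ≡ c * g n
  const-⊗ c g zero    = refl
  const-⊗ c g (suc n) = trans (cong (c * g (suc n) +_) (⊗-zeroˡ g n (λ _ → refl))) (+-identityʳ _)

  w-⊗-suc : ∀ g n → (w ⊗ g) (suc n) ≡ g n
  w-⊗-suc g n = trans (cong₂ _+_ (zeroˡ _) (trans (⊗-cong≤ n {g = g} (λ _ → refl) (λ _ → refl)) (const-⊗ 1# g n)))
                      (trans (+-identityˡ _) (*-identityˡ _))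

  ⊗-comm : ∀ n f g → (f ⊗ g) n ≡ (g ⊗ f) n
  ⊗-sucʳ : ∀ n f g → (f ⊗ g) (suc n) ≡ g 0 * f (suc n) + (f ⊗ (g ∘ suc)) n

  ⊗-comm zero    f g = *-comm _ _
  ⊗-comm (suc n) f g = trans (⊗-sucʳ n f g) (cong (g 0 * f (suc n) +_) (⊗-comm n f (g ∘ suc)))
  ⊗-sucʳ zero f g = S.solve 4 (λ f₀ f₁ g₀ g₁ → f₀ :* g₁ :+ f₁ :* g₀ := g₀ :* f₁ :+ f₀ :* g₁) refl (f 0) (f 1) (g 0) (g 1)
  ⊗-sucʳ (suc n) f g = trans (cong (f 0 * g (2 ℕ.+ n) +_) (⊗-sucʳ n (f ∘ suc) g))
    (S.solve 3 (λ x y z → x :+ (y :+ z) := y :+ (x :+ z)) refl (f 0 * g (2 ℕ.+ n)) _ _)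

  ⊗-distribˡ : ∀ n f g h → (f ⊗ (g ⊕ h)) n ≡ (f ⊗ g) n + (f ⊗ h) n
  ⊗-distribˡ zero    f g h = distribˡ _ _ _
  ⊗-distribˡ (suc n) f g h = trans (cong₂ _+_ (distribˡ _ _ _) (⊗-distribˡ n (f ∘ suc) g h))
    (S.solve 4 (λ a b c d → a :+ b :+ (c :+ d) := a :+ c :+ (b :+ d)) refl (f 0 * g (suc n)) (f 0 * h (suc n)) _ _)

  ⊗-distribʳ : ∀ n h f g → ((f ⊕ g) ⊗ h) n ≡ (f ⊗ h) n + (g ⊗ h) n
  ⊗-distribʳ n h f g = trans (⊗-comm n (f ⊕ g) h) (trans (⊗-distribˡ n h f g) (cong₂ _+_ (⊗-comm n h f) (⊗-comm n h g)))

  ◂-⊗ : ∀ n c f g → ((c ◂ f) ⊗ g) n ≡ c * (f ⊗ g) n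
  ◂-⊗ zero    c f g = *-assoc _ _ _
  ◂-⊗ (suc n) c f g = trans (cong₂ _+_ (*-assoc _ _ _) (◂-⊗ n c (f ∘ suc) g)) (sym (distribˡ c _ _))

  ⊗-assoc : ∀ n f g h → ((f ⊗ g) ⊗ h) n ≡ (f ⊗ (g ⊗ h)) n
  ⊗-assoc zero    f g h = *-assoc _ _ _
  ⊗-assoc (suc n) f g h = begin
    f 0 * g 0 * h (suc n) + (((f 0 ◂ (g ∘ suc)) ⊕ ((f ∘ suc) ⊗ g)) ⊗ h) n
      ≡⟨ cong (f 0 * g 0 * h (suc n) +_) (⊗-distribʳ n h (f 0 ◂ (g ∘ suc)) ((f ∘ suc) ⊗ g)) ⟩
    f 0 * g 0 * h (suc n) + (((f 0 ◂ (g ∘ suc)) ⊗ h) n + (((f ∘ suc) ⊗ g) ⊗ h) n)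
      ≡⟨ cong (f 0 * g 0 * h (suc n) +_) (cong₂ _+_ (◂-⊗ n (f 0) (g ∘ suc) h) (⊗-assoc n (f ∘ suc) g h)) ⟩
    f 0 * g 0 * h (suc n) + (f 0 * ((g ∘ suc) ⊗ h) n + ((f ∘ suc) ⊗ (g ⊗ h)) n)
      ≡⟨ S.solve 5 (λ a b c d e → a :* b :* c :+ (a :* d :+ e) := a :* (b :* c :+ d) :+ e) refl (f 0) (g 0) (h (suc n)) _ _ ⟩
    f 0 * (g 0 * h (suc n) + ((g ∘ suc) ⊗ h) n) + ((f ∘ suc) ⊗ (g ⊗ h)) n ∎

  ⊗-identityˡ : ∀ n f → (const 1# ⊗ f) n ≡ f n
  ⊗-identityˡ n f = trans (const-⊗ 1# f n) (*-identityˡ _)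

  seriesRing : CommutativeRing 0ℓ 0ℓ
  seriesRing = record
    { Carrier = Series ; _≈_ = _≗_ ; _+_ = _⊕_ ; _*_ = _⊗_ ; -_ = neg ; 0# = λ _ → 0# ; 1# = const 1#
    ; isCommutativeRing = record
      { isRing = record
        { +-isAbelianGroup = record
          { isGroup = record
            { isMonoid = record
              { isSemigroup = record
                { isMagma = record
                  { isEquivalence = record { refl = λ _ → refl ; sym = λ e n → sym (e n) ; trans = λ e e′ n → trans (e n) (e′ n) }
                  ; ∙-cong = λ e e′ n → cong₂ _+_ (e n) (e′ n) }
                ; assoc = λ f g h n → +-assoc (f n) (g n) (h n) }
              ; identity = (λ f n → +-identityˡ (f n)) , (λ f n → +-identityʳ (f n)) }
            ; inverse = (λ f n → -‿inverseˡ (f n)) , (λ f n → -‿inverseʳ (f n))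
            ; ⁻¹-cong = λ e n → cong -_ (e n) }
          ; comm = λ f g n → +-comm (f n) (g n) }
        ; *-cong = λ e e′ n → ⊗-cong≤ n (λ {i} _ → e i) (λ {i} _ → e′ i)
        ; *-assoc = λ f g h n → ⊗-assoc n f g h
        ; *-identity = (λ f n → ⊗-identityˡ n f) , (λ f n → trans (⊗-comm n f (const 1#)) (⊗-identityˡ n f))
        ; distrib = (λ f g h n → ⊗-distribˡ n f g h) , (λ f g h n → ⊗-distribʳ n f g h) }
      ; *-comm = λ f g n → ⊗-comm n f g } }

  const-+ : ∀ a b → const (a + b) ≗ const a ⊕ const b
  const-+ a b zero    = refl
  const-+ a b (suc n) = sym (+-identityˡ 0#)

  const-* : ∀ a b → const (a * b) ≗ const a ⊗ const b
  const-* a b zero    = refl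
  const-* a b (suc n) = sym (trans (const-⊗ a (const b) (suc n)) (zeroʳ a))

  const-0 : const 0# ≗ (λ _ → 0#)
  const-0 zero    = refl
  const-0 (suc n) = refl

-- Polynomials as coefficient lists, and their orders of vanishing

module Polynomial {q : ℕ} (F : FiniteField q) where
  open Field F
  open Series F

  -- Constant term first, trailing zeros allowed. The length only bounds the degree plus one, and no
  -- argument needs the exact degree.
  Poly : Set
  Poly = List Carrier

  infixl 6 _+ₚ_
  infixl 7 _*ₚ_
  infixr 8 _^ₚ_

  _+ₚ_ : Poly → Poly → Poly
  []      +ₚ p       = p
  (a ∷ p) +ₚ []      = a ∷ p
  (a ∷ p) +ₚ (b ∷ r) = a + b ∷ p +ₚ r

  scale : Carrier → Poly → Poly
  scale c = map (c *_)

  _*ₚ_ : Poly → Poly → Poly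
  []      *ₚ r = []
  (a ∷ p) *ₚ r = scale a r +ₚ (0# ∷ p *ₚ r)

  _^ₚ_ : Poly → ℕ → Poly
  p ^ₚ zero  = 1# ∷ []
  p ^ₚ suc n = p *ₚ p ^ₚ n

  linear : Carrier → Poly
  linear c = c ∷ 1# ∷ []

  combination : ∀ N → (Fin N → Carrier) → (Fin N → Poly) → Poly
  combination zero    x b = []
  combination (suc N) x b = scale (x zero) (b zero) +ₚ combination N (x ∘ suc) (b ∘ suc)

  coeff : Poly → ℕ → Carrier
  coeff []      n       = 0#
  coeff (a ∷ p) zero    = a
  coeff (a ∷ p) (suc n) = coeff p n

  length-+ₚ : ∀ {n} p r → length p ≤ n → length r ≤ n → length (p +ₚ r) ≤ n
  length-+ₚ []      r       hp       hr       = hr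
  length-+ₚ (a ∷ p) []      hp       hr       = hp
  length-+ₚ (a ∷ p) (b ∷ r) (s≤s hp) (s≤s hr) = s≤s (length-+ₚ p r hp hr)

  length-scale : ∀ {n} c p → length p ≤ n → length (scale c p) ≤ n
  length-scale c p h = subst (_≤ _) (sym (length-map (c *_) p)) h

  length-*ₚ : ∀ {m n} p r → length p ≤ suc m → length r ≤ suc n → length (p *ₚ r) ≤ suc (m ℕ.+ n)
  length-*ₚ         []          r hp       hr = z≤n
  length-*ₚ {zero} (a ∷ []) r hp hr = length-+ₚ (scale a r) (0# ∷ []) (length-scale a r hr) (s≤s z≤n)
  length-*ₚ {zero}  (a ∷ _ ∷ _) r (s≤s ()) hr
  length-*ₚ {suc m} (a ∷ p)     r (s≤s hp) hr =
    length-+ₚ (scale a r) (0# ∷ p *ₚ r) (length-scale a r (ℕ.≤-trans hr (s≤s (ℕ.m≤n+m _ (suc m))))) (s≤s (length-*ₚ p r hp hr))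

  length-^ₚ : ∀ {m} p n → length p ≤ suc m → length (p ^ₚ n) ≤ suc (n ℕ.* m)
  length-^ₚ p zero    h = s≤s z≤n
  length-^ₚ p (suc n) h = length-*ₚ p (p ^ₚ n) h (length-^ₚ p n h)

  length-combination : ∀ {L} N x b → (∀ i → length (b i) ≤ L) → length (combination N x b) ≤ L
  length-combination zero    x b h = z≤n
  length-combination (suc N) x b h =
    length-+ₚ (scale (x zero) (b zero)) (combination N (x ∘ suc) (b ∘ suc)) (length-scale (x zero) (b zero) (h zero)) (length-combination N (x ∘ suc) (b ∘ suc) (h ∘ suc))

  coeff-+ₚ : ∀ p r n → coeff (p +ₚ r) n ≡ coeff p n + coeff r n
  coeff-+ₚ []      r       n       = sym (+-identityˡ _)
  coeff-+ₚ (a ∷ p) []      n       = sym (+-identityʳ _)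
  coeff-+ₚ (a ∷ p) (b ∷ r) zero    = refl
  coeff-+ₚ (a ∷ p) (b ∷ r) (suc n) = coeff-+ₚ p r n

  coeff-scale : ∀ c p n → coeff (scale c p) n ≡ c * coeff p n
  coeff-scale c []      n       = sym (zeroʳ c)
  coeff-scale c (a ∷ p) zero    = refl
  coeff-scale c (a ∷ p) (suc n) = coeff-scale c p n

  -- One evaluation homomorphism serves twice: with values in the field, and with values in power
  -- series, where it gives expansions at a point.
  module Evaluation (R : CommutativeRing 0ℓ 0ℓ) (ι : Carrier → CommutativeRing.Carrier R)
                    (ι-0 : CommutativeRing._≈_ R (ι 0#) (CommutativeRing.0# R))
                    (ι-1 : CommutativeRing._≈_ R (ι 1#) (CommutativeRing.1# R))
                    (ι-+ : ∀ a b → CommutativeRing._≈_ R (ι (a + b)) (CommutativeRing._+_ R (ι a) (ι b)))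
                    (ι-* : ∀ a b → CommutativeRing._≈_ R (ι (a * b)) (CommutativeRing._*_ R (ι a) (ι b))) where
    private module R = CommutativeRing R
    open Algebra.Properties.CommutativeSemiring.Exp R.commutativeSemiring using () renaming (_^_ to _^ᴿ_)
    private
      module S′ = Algebra.Solver.Ring.NaturalCoefficients.Default R.commutativeSemiring
    open S′ using (_:+_; _:*_; _:=_)
    open Relation.Binary.Reasoning.Setoid R.setoid

    ev : R.Carrier → Poly → R.Carrier
    ev X []      = R.0#
    ev X (a ∷ p) = ι a R.+ X R.* ev X p

    ev-+ₚ : ∀ X p r → ev X (p +ₚ r) R.≈ ev X p R.+ ev X r
    ev-+ₚ X []      r       = R.sym (R.+-identityˡ _)
    ev-+ₚ X (a ∷ p) []      = R.sym (R.+-identityʳ _)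
    ev-+ₚ X (a ∷ p) (b ∷ r) = R.trans (R.+-cong (ι-+ a b) (R.*-congˡ (ev-+ₚ X p r)))
      (S′.solve 5 (λ a b X p r → (a :+ b) :+ X :* (p :+ r) := (a :+ X :* p) :+ (b :+ X :* r)) R.refl (ι a) (ι b) X _ _)

    ev-scale : ∀ X c p → ev X (scale c p) R.≈ ι c R.* ev X p
    ev-scale X c []      = R.sym (R.zeroʳ _)
    ev-scale X c (a ∷ p) = R.trans (R.+-cong (ι-* c a) (R.*-congˡ (ev-scale X c p)))
      (S′.solve 4 (λ c a X p → c :* a :+ X :* (c :* p) := c :* (a :+ X :* p)) R.refl (ι c) (ι a) X _)

    ev-*ₚ : ∀ X p r → ev X (p *ₚ r) R.≈ ev X p R.* ev X r
    ev-*ₚ X []      r = R.sym (R.zeroˡ _)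
    ev-*ₚ X (a ∷ p) r = begin
      ev X (scale a r +ₚ (0# ∷ p *ₚ r)) ≈⟨ ev-+ₚ X (scale a r) (0# ∷ p *ₚ r) ⟩
      ev X (scale a r) R.+ (ι 0# R.+ X R.* ev X (p *ₚ r)) ≈⟨ R.+-cong (ev-scale X a r) (R.+-cong ι-0 (R.*-congˡ (ev-*ₚ X p r))) ⟩
      ι a R.* ev X r R.+ (R.0# R.+ X R.* (ev X p R.* ev X r)) ≈⟨ R.+-congˡ (R.+-identityˡ _) ⟩
      ι a R.* ev X r R.+ X R.* (ev X p R.* ev X r)
        ≈⟨ S′.solve 4 (λ a X p r → a :* r :+ X :* (p :* r) := (a :+ X :* p) :* r) R.refl (ι a) X _ _ ⟩
      (ι a R.+ X R.* ev X p) R.* ev X r ∎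

    ev-constant : ∀ X c → ev X (c ∷ []) R.≈ ι c
    ev-constant X c = R.trans (R.+-congˡ (R.zeroʳ X)) (R.+-identityʳ _)

    ev-linear : ∀ X c → ev X (linear c) R.≈ ι c R.+ X
    ev-linear X c = R.+-congˡ (R.trans (R.*-congˡ (R.trans (ev-constant X 1#) ι-1)) (R.*-identityʳ X))

    ev-^ₚ : ∀ X p n → ev X (p ^ₚ n) R.≈ ev X p ^ᴿ n
    ev-^ₚ X p zero    = R.trans (ev-constant X 1#) ι-1
    ev-^ₚ X p (suc n) = R.trans (ev-*ₚ X p (p ^ₚ n)) (R.*-congˡ (ev-^ₚ X p n))

  open Evaluation ring id refl refl (λ _ _ → refl) (λ _ _ → refl) public
    renaming (ev to eval; ev-+ₚ to eval-+ₚ; ev-scale to eval-scale; ev-*ₚ to eval-*ₚ; ev-constant to eval-constant; ev-linear to eval-linear; ev-^ₚ to eval-^ₚ)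
  open Evaluation seriesRing const const-0 (λ _ → refl) const-+ const-* public
    using ()
    renaming (ev to evalₛ; ev-+ₚ to evalₛ-+ₚ; ev-scale to evalₛ-scale; ev-*ₚ to evalₛ-*ₚ; ev-linear to evalₛ-linear; ev-^ₚ to evalₛ-^ₚ)

  eval-zero : ∀ x p → (∀ n → n < length p → coeff p n ≡ 0#) → eval x p ≡ 0#
  eval-zero x []      h = refl
  eval-zero x (a ∷ p) h = trans (cong₂ _+_ (h 0 (s≤s z≤n)) (trans (cong (x *_) (eval-zero x p (λ n lt → h (suc n) (s<s lt)))) (zeroʳ x))) (+-identityˡ 0#)

  private
    infix 4 _≈_
    _≈_ : Series → Series → Set
    _≈_ = _≗_
    module P = CommutativeRing seriesRing
    module SP = Algebra.Solver.Ring.NaturalCoefficients.Default P.commutativeSemiring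

  -- Horner's scheme for division by `X - a`. Passing the constant term separately makes the
  -- quotient shorter than the dividend by exactly one entry.
  quotient-remainder : Carrier → Carrier → Poly → Poly × Carrier
  quotient-remainder a c []       = [] , c
  quotient-remainder a c (c′ ∷ p) = let (h , r) = quotient-remainder a c′ p in r ∷ h , c + a * r

  quotient : Carrier → Carrier → Poly → Poly
  quotient a c p = proj₁ (quotient-remainder a c p)

  remainder : Carrier → Carrier → Poly → Carrier
  remainder a c p = proj₂ (quotient-remainder a c p)

  length-quotient : ∀ a c p → length (quotient a c p) ≡ length p
  length-quotient a c []       = refl
  length-quotient a c (c′ ∷ p) = cong suc (length-quotient a c′ p)

  -- The identity `f = (X - a) h + r` with its negative term moved to the left, so that it can be
  -- proved by a semiring solver.
  division : ∀ X a c p → evalₛ X (c ∷ p) ⊕ const a ⊗ evalₛ X (quotient a c p)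
                        ≈ X ⊗ evalₛ X (quotient a c p) ⊕ const (remainder a c p)
  division X a c [] = P.trans (P.+-cong (P.trans (P.+-congˡ (P.zeroʳ X)) (P.+-identityʳ (const c))) (P.zeroʳ (const a)))
                              (P.trans (P.+-comm (const c) P.0#) (P.+-congʳ (P.sym (P.zeroʳ X))))
  division X a c (c′ ∷ p) = begin
    const c ⊕ X ⊗ evalₛ X (c′ ∷ p) ⊕ const a ⊗ (const r ⊕ X ⊗ H)
      ≈⟨ SP.solve 6 (λ c X E a r H → c SP.:+ X SP.:* E SP.:+ a SP.:* (r SP.:+ X SP.:* H) SP.:= c SP.:+ a SP.:* r SP.:+ X SP.:* (E SP.:+ a SP.:* H))
           P.refl (const c) X (evalₛ X (c′ ∷ p)) (const a) (const r) H ⟩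
    const c ⊕ const a ⊗ const r ⊕ X ⊗ (evalₛ X (c′ ∷ p) ⊕ const a ⊗ H)
      ≈⟨ P.+-cong (P.trans (P.+-congˡ (P.sym (const-* a r))) (P.sym (const-+ c (a * r)))) (P.*-congˡ {X} (P.trans (division X a c′ p) (P.+-comm (X ⊗ H) (const r)))) ⟩
    const (c + a * r) ⊕ X ⊗ (const r ⊕ X ⊗ H)
      ≈⟨ P.+-comm (const (c + a * r)) (X ⊗ (const r ⊕ X ⊗ H)) ⟩
    X ⊗ (const r ⊕ X ⊗ H) ⊕ const (c + a * r) ∎
    where
    open Relation.Binary.Reasoning.Setoid P.setoid
    r = remainder a c′ p
    H = evalₛ X (quotient a c′ p)

  Order≥ : ℕ → Series → Set
  Order≥ M f = ∀ n → n < M → f n ≡ 0#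

  -- A local parameter at a. Its scale ρ is free; below it is a multiple of every c + a, which clears denominators.
  at : Carrier → Carrier → Series
  at a ρ = const a ⊕ const ρ ⊗ w

  at-⊗-0 : ∀ a ρ f → (at a ρ ⊗ f) 0 ≡ a * f 0
  at-⊗-0 a ρ f = cong (_* f 0) (trans (cong (a +_) (zeroʳ ρ)) (+-identityʳ a))

  at-⊗-suc : ∀ a ρ f n → (at a ρ ⊗ f) (suc n) ≡ a * f (suc n) + ρ * f n
  at-⊗-suc a ρ f n = begin
    (at a ρ ⊗ f) (suc n) ≡⟨ ⊗-distribʳ (suc n) f (const a) (const ρ ⊗ w) ⟩
    (const a ⊗ f) (suc n) + ((const ρ ⊗ w) ⊗ f) (suc n) ≡⟨ cong₂ _+_ (const-⊗ a f (suc n)) (⊗-assoc (suc n) (const ρ) w f) ⟩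
    a * f (suc n) + (const ρ ⊗ (w ⊗ f)) (suc n) ≡⟨ cong (a * f (suc n) +_) (const-⊗ ρ (w ⊗ f) (suc n)) ⟩
    a * f (suc n) + ρ * (w ⊗ f) (suc n) ≡⟨ cong (λ z → a * f (suc n) + ρ * z) (w-⊗-suc f n) ⟩
    a * f (suc n) + ρ * f n ∎
    where open ≡-Reasoning

  module _ (a ρ c : Carrier) (p : Poly) where
    private
      H = quotient a c p
      X = at a ρ

    root⇒remainder≡0 : evalₛ X (c ∷ p) 0 ≡ 0# → remainder a c p ≡ 0#
    root⇒remainder≡0 h = sym (+-cancelˡ (a * evalₛ X H 0) _ _ (begin
      a * evalₛ X H 0 + 0# ≡⟨ +-comm _ _ ⟩
      0# + a * evalₛ X H 0 ≡⟨ cong (_+ a * evalₛ X H 0) h ⟨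
      evalₛ X (c ∷ p) 0 + a * evalₛ X H 0 ≡⟨ division X a c p 0 ⟩
      (X ⊗ evalₛ X H) 0 + remainder a c p ≡⟨ cong (_+ remainder a c p) (at-⊗-0 a ρ (evalₛ X H)) ⟩
      a * evalₛ X H 0 + remainder a c p ∎))
      where open ≡-Reasoning

    -- At the point itself `X - a` is `ρ w`, so coefficient `n + 1` of the polynomial is `ρ` times
    -- coefficient `n` of the quotient.
    order-quotient : ¬ (ρ ≡ 0#) → ∀ {M} → Order≥ (suc M) (evalₛ X (c ∷ p)) → Order≥ M (evalₛ X H)
    order-quotient ρ≢0 h n n<M = *-cancelˡ ρ≢0 (trans (sym (+-cancelˡ (a * E (suc n)) _ _ (begin
      a * E (suc n) + 0# ≡⟨ +-comm _ _ ⟩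
      0# + a * E (suc n) ≡⟨ cong (_+ a * E (suc n)) (h (suc n) (s<s n<M)) ⟨
      evalₛ X (c ∷ p) (suc n) + a * E (suc n) ≡⟨ cong (evalₛ X (c ∷ p) (suc n) +_) (const-⊗ a E (suc n)) ⟨
      evalₛ X (c ∷ p) (suc n) + (const a ⊗ E) (suc n) ≡⟨ division X a c p (suc n) ⟩
      (X ⊗ E) (suc n) + 0# ≡⟨ +-identityʳ _ ⟩
      (X ⊗ E) (suc n) ≡⟨ at-⊗-suc a ρ E n ⟩
      a * E (suc n) + ρ * E n ∎))) (sym (zeroʳ ρ)))
      where
      open ≡-Reasoning
      E = evalₛ X H

  x*y≡z*y⇒y≡0 : ∀ {x z y} → ¬ (x ≡ z) → x * y ≡ z * y → y ≡ 0#
  x*y≡z*y⇒y≡0 {x} {z} {y} x≢z eq with y ≟ 0#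
  ... | yes h = h
  ... | no  h = contradiction (*-cancelʳ h eq) x≢z

  -- At another point `b` the series of `X - a` has constant term `b - a ≠ 0`, so dividing by it
  -- does not lower the order.
  order-quotient-other : ∀ a c p {b ρ} → remainder a c p ≡ 0# → ¬ (a ≡ b) → ∀ {M} →
                         Order≥ M (evalₛ (at b ρ) (c ∷ p)) → Order≥ M (evalₛ (at b ρ) (quotient a c p))
  order-quotient-other a c p {b} {ρ} r≡0 a≢b {M} h = go
    where
    open ≡-Reasoning
    X = at b ρ
    E = evalₛ X (quotient a c p)
    equation : ∀ n → n < M → a * E n ≡ (X ⊗ E) n
    equation n n<M = begin
      a * E n ≡⟨ const-⊗ a E n ⟨
      (const a ⊗ E) n ≡⟨ +-identityˡ _ ⟨
      0# + (const a ⊗ E) n ≡⟨ cong (_+ (const a ⊗ E) n) (h n n<M) ⟨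
      evalₛ X (c ∷ p) n + (const a ⊗ E) n ≡⟨ division X a c p n ⟩
      (X ⊗ E) n + const (remainder a c p) n ≡⟨ cong ((X ⊗ E) n +_) (trans (cong (λ z → const z n) r≡0) (const-0 n)) ⟩
      (X ⊗ E) n + 0# ≡⟨ +-identityʳ _ ⟩
      (X ⊗ E) n ∎
    go : Order≥ M E
    go zero    n<M = x*y≡z*y⇒y≡0 a≢b (trans (equation 0 n<M) (at-⊗-0 b ρ E))
    go (suc n) n<M = x*y≡z*y⇒y≡0 a≢b (begin
      a * E (suc n) ≡⟨ equation (suc n) n<M ⟩
      (X ⊗ E) (suc n) ≡⟨ at-⊗-suc b ρ E n ⟩
      b * E (suc n) + ρ * E n ≡⟨ cong (λ z → b * E (suc n) + ρ * z) (go n (ℕ.<-trans (ℕ.n<1+n n) n<M)) ⟩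
      b * E (suc n) + ρ * 0# ≡⟨ cong (b * E (suc n) +_) (zeroʳ ρ) ⟩
      b * E (suc n) + 0# ≡⟨ +-identityʳ _ ⟩
      b * E (suc n) ∎)

  -- Evaluating at `w` gives the sequence of coefficients, so trailing zeros of the list do not
  -- matter.
  Nonzero : Poly → Set
  Nonzero p = ¬ (∀ n → evalₛ w p n ≡ 0#)

  nonzero-quotient : ∀ a c p → remainder a c p ≡ 0# → Nonzero (c ∷ p) → Nonzero (quotient a c p)
  nonzero-quotient a c p r≡0 nz H≡0 = nz (λ n → begin
    evalₛ w (c ∷ p) n ≡⟨ +-identityʳ _ ⟨
    evalₛ w (c ∷ p) n + 0# ≡⟨ cong (evalₛ w (c ∷ p) n +_) (trans (const-⊗ a H n) (trans (cong (a *_) (H≡0 n)) (zeroʳ a))) ⟨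
    evalₛ w (c ∷ p) n + (const a ⊗ H) n ≡⟨ division w a c p n ⟩
    (w ⊗ H) n + const (remainder a c p) n ≡⟨ cong₂ _+_ (trans (⊗-comm n w H) (⊗-zeroˡ w n H≡0)) (trans (cong (λ z → const z n) r≡0) (const-0 n)) ⟩
    0# + 0# ≡⟨ +-identityˡ 0# ⟩
    0# ∎)
    where
    open ≡-Reasoning
    H = evalₛ w (quotient a c p)

  module _ (ρ : Carrier → Carrier) where
    -- Division by `X - a`, repeated `M` times. Each division removes one entry of the list, and the
    -- orders at all other points survive for later use.
    strip-root : ∀ a → ¬ (ρ a ≡ 0#) → ∀ M p → Nonzero p → Order≥ M (evalₛ (at a (ρ a)) p) →
                 ∃ λ h → Nonzero h × length p ≡ M ℕ.+ length h ×
                   (∀ b N → ¬ (a ≡ b) → Order≥ N (evalₛ (at b (ρ b)) p) → Order≥ N (evalₛ (at b (ρ b)) h))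
    strip-root a ρ≢0 zero    p       nz ord = p , nz , refl , λ _ _ _ o → o
    strip-root a ρ≢0 (suc M) []      nz ord = contradiction (λ _ → refl) nz
    strip-root a ρ≢0 (suc M) (c ∷ p) nz ord =
      let r≡0 = root⇒remainder≡0 a (ρ a) c p (ord 0 (s≤s z≤n))
          (h , nz′ , len , transfer) = strip-root a ρ≢0 M (quotient a c p) (nonzero-quotient a c p r≡0 nz) (order-quotient a (ρ a) c p ρ≢0 ord)
      in h , nz′ , cong suc (trans (sym (length-quotient a c p)) len) ,
         λ b N a≢b o → transfer b N a≢b (order-quotient-other a c p r≡0 a≢b o)

    -- Each point of `V` uses up `M` entries of the list, and a nonzero polynomial must remain at
    -- the end. This is the bound for zeros with multiplicity, valid also when `M` exceeds the
    -- characteristic.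
    count-roots : ∀ M V p → Unique V → (∀ {a} → a ∈ V → ¬ (ρ a ≡ 0#)) → (∀ {a} → a ∈ V → Order≥ M (evalₛ (at a (ρ a)) p)) →
                  Nonzero p → length V ℕ.* M < length p
    count-roots M []      []      u hρ ho nz = contradiction (λ _ → refl) nz
    count-roots M []      (_ ∷ _) u hρ ho nz = s≤s z≤n
    count-roots M (a ∷ V) p (a∉V ∷ u) hρ ho nz =
      let (h , nz′ , len , transfer) = strip-root a (hρ (here refl)) M p nz (ho (here refl))
      in subst (M ℕ.+ length V ℕ.* M <_) (sym len) (ℕ.+-monoʳ-< M
           (count-roots M V h u (hρ ∘ there) (λ {b} b∈ → transfer b M (λ eq → All.lookup a∉V b∈ eq) (ho (there b∈))) nz′))

  -- The first term with a nonzero coefficient has the lowest order, so nothing can cancel its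
  -- leading coefficient.
  combination-nonzero : ∀ N x b (o : Fin N → ℕ) → (∀ i → Order≥ (o i) (evalₛ w (b i))) → (∀ i → ¬ (evalₛ w (b i) (o i) ≡ 0#)) →
                        (∀ i j → i Fin.< j → o i < o j) → (∃ λ i → ¬ (x i ≡ 0#)) → Nonzero (combination N x b)
  combination-nonzero (suc N) x b o ord lead mono (i , xi≢0) eq with x zero ≟ 0#
  ... | no  x₀≢0 = x*y≢0 x₀≢0 (lead zero) (begin
      x zero * evalₛ w (b zero) (o zero) ≡⟨ const-⊗ (x zero) _ (o zero) ⟨
      (const (x zero) ⊗ evalₛ w (b zero)) (o zero) ≡⟨ evalₛ-scale w (x zero) (b zero) (o zero) ⟨
      evalₛ w (scale (x zero) (b zero)) (o zero) ≡⟨ +-identityʳ _ ⟨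
      evalₛ w (scale (x zero) (b zero)) (o zero) + 0# ≡⟨ cong (evalₛ w (scale (x zero) (b zero)) (o zero) +_) (higher N (x ∘ suc) (b ∘ suc) (λ j → ord (suc j) (o zero) (mono zero (suc j) (s≤s z≤n)))) ⟨
      evalₛ w (scale (x zero) (b zero)) (o zero) + evalₛ w (combination N (x ∘ suc) (b ∘ suc)) (o zero)
          ≡⟨ evalₛ-+ₚ w (scale (x zero) (b zero)) (combination N (x ∘ suc) (b ∘ suc)) (o zero) ⟨
      evalₛ w (combination (suc N) x b) (o zero) ≡⟨ eq (o zero) ⟩
      0# ∎)
      where
      open ≡-Reasoning
      higher : ∀ N x b → (∀ j → evalₛ w (b j) (o zero) ≡ 0#) → evalₛ w (combination N x b) (o zero) ≡ 0#
      higher zero    x b h = refl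
      higher (suc N) x b h = trans (evalₛ-+ₚ w (scale (x zero) (b zero)) (combination N (x ∘ suc) (b ∘ suc)) (o zero))
        (trans (cong₂ _+_ (trans (evalₛ-scale w (x zero) (b zero) (o zero)) (trans (const-⊗ (x zero) _ (o zero)) (trans (cong (x zero *_) (h zero)) (zeroʳ _)))) (higher N (x ∘ suc) (b ∘ suc) (h ∘ suc)))
          (+-identityˡ 0#))
  ... | yes x₀≡0 with i
  ... | zero  = contradiction x₀≡0 xi≢0
  ... | suc i = combination-nonzero N (x ∘ suc) (b ∘ suc) (o ∘ suc) (ord ∘ suc) (lead ∘ suc) (λ i j i<j → mono (suc i) (suc j) (s<s i<j)) (i , xi≢0)
    (λ n → begin
      evalₛ w (combination N (x ∘ suc) (b ∘ suc)) n ≡⟨ +-identityˡ _ ⟨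
      0# + evalₛ w (combination N (x ∘ suc) (b ∘ suc)) n ≡⟨ cong (_+ evalₛ w (combination N (x ∘ suc) (b ∘ suc)) n)
          (trans (evalₛ-scale w (x zero) (b zero) n) (trans (const-⊗ (x zero) _ n) (trans (cong (_* evalₛ w (b zero) n) x₀≡0) (zeroˡ _)))) ⟨
      evalₛ w (scale (x zero) (b zero)) n + evalₛ w (combination N (x ∘ suc) (b ∘ suc)) n ≡⟨ evalₛ-+ₚ w (scale (x zero) (b zero)) (combination N (x ∘ suc) (b ∘ suc)) n ⟨
      evalₛ w (combination (suc N) x b) n ≡⟨ eq n ⟩
      0# ∎)
    where open ≡-Reasoning

-- Underdetermined linear systems

module Linear {q : ℕ} (F : FiniteField q) where
  open Field F
  open Series F
  open Polynomial F
  open ≡-Reasoning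
  private module S′ = Algebra.Solver.Ring.NaturalCoefficients.Default commutativeSemiring
  open S′ using (_:+_; _:*_; _:=_)

  dot : ∀ N → (Fin N → Carrier) → (Fin N → Carrier) → Carrier
  dot zero    x l = 0#
  dot (suc N) x l = x zero * l zero + dot N (x ∘ suc) (l ∘ suc)

  dot-+ : ∀ N x y l → dot N (λ i → x i + y i) l ≡ dot N x l + dot N y l
  dot-+ zero    x y l = sym (+-identityˡ 0#)
  dot-+ (suc N) x y l = trans (cong ((x zero + y zero) * l zero +_) (dot-+ N (x ∘ suc) (y ∘ suc) (l ∘ suc)))
    (S′.solve 5 (λ x y l a b → (x :+ y) :* l :+ (a :+ b) := (x :* l :+ a) :+ (y :* l :+ b)) refl (x zero) (y zero) (l zero) _ _)

  dot-cong : ∀ N {x y} l → (∀ i → x i ≡ y i) → dot N x l ≡ dot N y l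
  dot-cong zero    l h = refl
  dot-cong (suc N) l h = cong₂ _+_ (cong (_* l zero) (h zero)) (dot-cong N (l ∘ suc) (h ∘ suc))

  coeff-combination : ∀ N x b n → coeff (combination N x b) n ≡ dot N x (λ i → coeff (b i) n)
  coeff-combination zero    x b n = refl
  coeff-combination (suc N) x b n = trans (coeff-+ₚ (scale (x zero) (b zero)) _ n)
    (cong₂ _+_ (coeff-scale (x zero) (b zero) n) (coeff-combination N (x ∘ suc) (b ∘ suc) n))

  1<q : 1 ℕ.< q
  1<q with q ℕ.≤? 1
  ... | no  q≰1 = ℕ.≰⇒> q≰1
  ... | yes q≤1 = contradiction (trans (sym (elem-index 0#)) (trans (cong elem (all-equal q≤1 (index 0#) (index 1#))) (elem-index 1#))) 0≢1
    where
    all-equal : ∀ {n} → n ℕ.≤ 1 → (i j : Fin n) → i ≡ j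
    all-equal (s≤s z≤n) zero zero = refl

  funToFin-cong : ∀ {m n} {f g : Fin m → Fin n} → (∀ i → f i ≡ g i) → funToFin f ≡ funToFin g
  funToFin-cong {zero}  h = refl
  funToFin-cong {suc m} h = cong₂ Fin.combine (h zero) (funToFin-cong (h ∘ suc))

  -- Pigeonhole instead of elimination: among the `q^N` vectors two have the same tuple of `r`
  -- values, since there are only `q^r` tuples. Their difference is the solution.
  kernel : ∀ {N r} → r ℕ.< N → (L : Fin r → Fin N → Carrier) →
           ∃ λ x → (∃ λ i → ¬ (x i ≡ 0#)) × (∀ t → dot N x (L t) ≡ 0#)
  kernel {N} {r} r<N L = x , nonzero , λ t → +-cancelʳ (dot N (vector j) (L t)) _ _ (begin
      dot N x (L t) + dot N (vector j) (L t) ≡⟨ dot-+ N x (vector j) (L t) ⟨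
      dot N (λ k → x k + vector j k) (L t) ≡⟨ dot-cong N (L t) difference ⟩
      dot N (vector i) (L t) ≡⟨ same-value t ⟩
      dot N (vector j) (L t) ≡⟨ +-identityˡ _ ⟨
      0# + dot N (vector j) (L t) ∎)
    where
    vector : Fin (q ℕ.^ N) → Fin N → Carrier
    vector i = elem ∘ finToFun i
    values : Fin (q ℕ.^ N) → Fin r → Fin q
    values i t = index (dot N (vector i) (L t))
    collision = Fin.pigeonhole (ℕ.^-monoʳ-< q 1<q r<N) (funToFin ∘ values)
    i = proj₁ collision
    j = proj₁ (proj₂ collision)
    i<j = proj₁ (proj₂ (proj₂ collision))
    x : Fin N → Carrier
    x k = vector i k - vector j k
    difference : ∀ k → x k + vector j k ≡ vector i k
    difference k = trans (+-assoc _ _ _) (trans (cong (vector i k +_) (-‿inverseˡ _)) (+-identityʳ _))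
    same-value : ∀ t → dot N (vector i) (L t) ≡ dot N (vector j) (L t)
    same-value t = begin
      dot N (vector i) (L t) ≡⟨ elem-index _ ⟨
      elem (values i t) ≡⟨ cong elem (Fin.finToFun-funToFin (values i) t) ⟨
      elem (finToFun (funToFin (values i)) t) ≡⟨ cong (λ z → elem (finToFun z t)) (proj₂ (proj₂ (proj₂ collision))) ⟩
      elem (finToFun (funToFin (values j)) t) ≡⟨ cong elem (Fin.finToFun-funToFin (values j) t) ⟩
      elem (values j t) ≡⟨ elem-index _ ⟩
      dot N (vector j) (L t) ∎
    nonzero : ∃ λ k → ¬ (x k ≡ 0#)
    nonzero with Fin.any? (λ k → ¬? (x k ≟ 0#))
    ... | yes h = h
    ... | no  h = contradiction i<j (Fin.<-irrefl i≡j)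
      where
      equal : ∀ k → finToFun i k ≡ finToFun j k
      equal k with x k ≟ 0#
      ... | yes xk≡0 = elem-injective (trans (sym (difference k)) (trans (cong (_+ vector j k) xk≡0) (+-identityˡ _)))
      ... | no  xk≢0 = contradiction (k , xk≢0) h
      i≡j : i ≡ j
      i≡j = trans (sym (Fin.funToFin-finToFin {N} {q} i)) (trans (funToFin-cong {N} {q} equal) (Fin.funToFin-finToFin {N} {q} j))

-- Stepanov's method

module StepanovMethod {q : ℕ} (F : FiniteField q) where
  open Field F
  open Series F
  open Polynomial F
  open Linear F
  private
    module P = CommutativeRing seriesRing
    module E = Algebra.Properties.CommutativeSemiring.Exp P.commutativeSemiring
    module SF = Algebra.Solver.Ring.NaturalCoefficients.Default commutativeSemiring
    module SP = Algebra.Solver.Ring.NaturalCoefficients.Default P.commutativeSemiring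
    infix 4 _≈_
    _≈_ : Series → Series → Set
    _≈_ = _≗_
  open E using () renaming (_^_ to _^ₛ_)

  const-^ : ∀ a n → const a ^ₛ n ≈ const (a ^ n)
  const-^ a zero    = P.refl
  const-^ a (suc n) = P.trans (P.*-congˡ {const a} (const-^ a n)) (P.sym (const-* a (a ^ n)))

  ^ₛ-0 : ∀ f n → (f ^ₛ n) 0 ≡ f 0 ^ n
  ^ₛ-0 f zero    = refl
  ^ₛ-0 f (suc n) = cong (f 0 *_) (^ₛ-0 f n)

  w^n⊗-order : ∀ n g → Order≥ n (w ^ₛ n ⊗ g)
  w^n⊗-order (suc n) g zero    i<n = trans (P.*-assoc w (w ^ₛ n) g 0) (zeroˡ ((w ^ₛ n ⊗ g) 0))
  w^n⊗-order (suc n) g (suc i) i<n =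
    trans (P.*-assoc w (w ^ₛ n) g (suc i)) (trans (w-⊗-suc (w ^ₛ n ⊗ g) i) (w^n⊗-order n g i (ℕ.≤-pred i<n)))

  w^n⊗-lead : ∀ n g → (w ^ₛ n ⊗ g) n ≡ g 0
  w^n⊗-lead zero    g = ⊗-identityˡ 0 g
  w^n⊗-lead (suc n) g = trans (P.*-assoc w (w ^ₛ n) g (suc n)) (trans (w-⊗-suc (w ^ₛ n ⊗ g) n) (w^n⊗-lead n g))

  -- A list of pairs (c , e) stands for the product of the (c + X)^e.
  Factors : Set
  Factors = List (Carrier × ℕ)

  degree : Factors → ℕ
  degree []             = 0
  degree ((c , e) ∷ fs) = e ℕ.+ degree fs

  product : Factors → Carrier → Carrier
  product []             a = 1#
  product ((c , e) ∷ fs) a = (c + a) ^ e * product fs a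

  productₚ : Factors → Poly
  productₚ []             = 1# ∷ []
  productₚ ((c , e) ∷ fs) = linear c ^ₚ e *ₚ productₚ fs

  length-productₚ : ∀ fs → length (productₚ fs) ≤ suc (degree fs)
  length-productₚ []             = s≤s z≤n
  length-productₚ ((c , e) ∷ fs) = length-*ₚ (linear c ^ₚ e) (productₚ fs)
    (subst (λ z → length (linear c ^ₚ e) ≤ suc z) (ℕ.*-identityʳ e) (length-^ₚ (linear c) e ℕ.≤-refl)) (length-productₚ fs)

  -- Its value at `a` is the scale of the local parameter: a multiple of every `c + a`, of the least
  -- degree that does not depend on the exponents.
  radical : Factors → Poly
  radical []             = 1# ∷ []
  radical ((c , e) ∷ fs) = linear c *ₚ radical fs

  length-radical : ∀ fs → length (radical fs) ≤ suc (length fs)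
  length-radical []             = s≤s z≤n
  length-radical ((c , e) ∷ fs) = length-*ₚ (linear c) (radical fs) ℕ.≤-refl (length-radical fs)

  evalₛ-w-productₚ-0 : ∀ fs → All (λ ce → ¬ (proj₁ ce ≡ 0#)) fs → ¬ (evalₛ w (productₚ fs) 0 ≡ 0#)
  evalₛ-w-productₚ-0 [] h eq = 1≢0 (trans (sym (trans (cong (1# +_) (zeroˡ _)) (+-identityʳ 1#))) eq)
  evalₛ-w-productₚ-0 ((c , e) ∷ fs) (c≢0 ∷ h) eq =
    x*y≢0 (λ z → x^n≢0 e c≢0 (trans (cong (_^ e) (sym base)) (trans (sym (^ₛ-0 (evalₛ w (linear c)) e)) (trans (sym (evalₛ-^ₚ w (linear c) e 0)) z))))
      (evalₛ-w-productₚ-0 fs h) (trans (sym (evalₛ-*ₚ w (linear c ^ₚ e) (productₚ fs) 0)) eq)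
    where
    base : evalₛ w (linear c) 0 ≡ c
    base = trans (evalₛ-linear w c 0) (+-identityʳ c)

  module Families (κ : ℕ) where
    -- κ is the number of factors minus one: each power of w costs the degree of the scale, which is the
    -- product of all factors, and saves the degree 1 of the point.
    PolynomialFamily : ℕ → (Carrier → Series) → Set
    PolynomialFamily s φ = ∀ l → ∃ λ p → length p ≤ suc (s ℕ.+ κ ℕ.* l) × (∀ a → φ a l ≡ eval a p)

    family-⊗ : ∀ {s t φ ψ} → PolynomialFamily s φ → PolynomialFamily t ψ → PolynomialFamily (s ℕ.+ t) (λ a → φ a ⊗ ψ a)
    family-⊗ {s} {t} {φ} {ψ} hφ hψ zero =
      let (p , lp , ep) = hφ 0 ; (r , lr , er) = hψ 0
      in p *ₚ r , subst (length (p *ₚ r) ≤_) (cong suc (+-*-Solver.solve 3 (λ s t κ → (s :+ κ :* con 0) :+ (t :+ κ :* con 0) := s :+ t :+ κ :* con 0) refl s t κ)) (length-*ₚ p r lp lr) ,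
         λ a → trans (cong₂ _*_ (ep a) (er a)) (sym (eval-*ₚ a p r))
      where open +-*-Solver using (con; _:+_; _:*_; _:=_)
    family-⊗ {s} {t} {φ} {ψ} hφ hψ (suc l) =
      let (p , lp , ep) = hφ 0 ; (r , lr , er) = hψ (suc l)
          (g , lg , eg) = family-⊗ {s ℕ.+ κ} {t} {λ a → φ a ∘ suc} {ψ} shifted hψ l
      in p *ₚ r +ₚ g ,
         length-+ₚ (p *ₚ r) g
           (subst (length (p *ₚ r) ≤_) (cong suc (+-*-Solver.solve 4 (λ s t κ l → (s :+ κ :* con 0) :+ (t :+ κ :* (con 1 :+ l)) := s :+ t :+ κ :* (con 1 :+ l)) refl s t κ l)) (length-*ₚ p r lp lr))
           (subst (length g ≤_) (cong suc (+-*-Solver.solve 4 (λ s t κ l → s :+ κ :+ t :+ κ :* l := s :+ t :+ κ :* (con 1 :+ l)) refl s t κ l)) lg) ,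
         λ a → trans (cong₂ _+_ (trans (cong₂ _*_ (ep a) (er a)) (sym (eval-*ₚ a p r))) (eg a)) (sym (eval-+ₚ a (p *ₚ r) g))
      where
      open +-*-Solver using (con; _:+_; _:*_; _:=_)
      shifted : PolynomialFamily (s ℕ.+ κ) (λ a → φ a ∘ suc)
      shifted l = let (p , lp , ep) = hφ (suc l)
                  in p , subst (length p ≤_) (cong suc (+-*-Solver.solve 3 (λ s κ l → s :+ κ :* (con 1 :+ l) := s :+ κ :+ κ :* l) refl s κ l)) lp , ep

    family-polynomial : ∀ s (p : Poly) → length p ≤ suc s → PolynomialFamily s (λ a → const (eval a p))
    family-polynomial s p h zero    = p , ℕ.≤-trans h (s≤s (ℕ.m≤m+n s _)) , λ a → refl
    family-polynomial s p h (suc l) = [] , z≤n , λ a → refl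

    family-≗ : ∀ {s φ ψ} → PolynomialFamily s φ → (∀ a → ψ a ≈ φ a) → PolynomialFamily s ψ
    family-≗ h e l = let (p , lp , ep) = h l in p , lp , λ a → trans (e a l) (ep a)

    family-1 : PolynomialFamily 0 (λ _ → const 1#)
    family-1 = family-≗ (family-polynomial 0 (1# ∷ []) ℕ.≤-refl) (λ a l → cong (λ z → const z l) (sym (eval-constant a 1#)))

    family-^ : ∀ {s φ} n → PolynomialFamily s φ → PolynomialFamily (n ℕ.* s) (λ a → φ a ^ₛ n)
    family-^ zero    h = family-1
    family-^ (suc n) h = family-⊗ h (family-^ n h)

    family-affine : ∀ s (p r : Poly) → length p ≤ suc s → length r ≤ suc (s ℕ.+ κ) → PolynomialFamily s (λ a → at (eval a p) (eval a r))
    family-affine s p r hp hr zero = p , ℕ.≤-trans hp (s≤s (ℕ.m≤m+n s _)) , λ a → trans (cong (eval a p +_) (zeroʳ (eval a r))) (+-identityʳ _)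
    family-affine s p r hp hr (suc zero) = r , subst (λ z → length r ≤ suc (s ℕ.+ z)) (sym (ℕ.*-identityʳ κ)) hr ,
      λ a → trans (+-identityˡ _) (trans (const-⊗ (eval a r) w 1) (*-identityʳ _))
    family-affine s p r hp hr (suc (suc l)) = [] , z≤n , λ a → trans (+-identityˡ _) (trans (const-⊗ (eval a r) w (2 ℕ.+ l)) (zeroʳ _))

    -- A stands for the product of the factors already treated.
    units : Poly → Factors → Carrier → Series
    units A []             a = const 1#
    units A ((c , e) ∷ fs) a = at (eval a (1# ∷ [])) (eval a (A *ₚ radical fs)) ^ₛ e ⊗ units (A *ₚ linear c) fs a

    family-units : ∀ {α} A fs → length A ≤ suc α → α ℕ.+ length fs ≤ suc κ → PolynomialFamily 0 (units A fs)
    family-units A []             hA h = family-1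
    family-units {α} A ((c , e) ∷ fs) hA h = family-⊗
      (subst (λ z → PolynomialFamily z (λ a → at (eval a (1# ∷ [])) (eval a (A *ₚ radical fs)) ^ₛ e)) (ℕ.*-zeroʳ e)
        (family-^ e (family-affine 0 (1# ∷ []) (A *ₚ radical fs) ℕ.≤-refl
          (ℕ.≤-trans (length-*ₚ A (radical fs) hA (length-radical fs)) (subst (_≤ suc κ) (ℕ.+-suc α (length fs)) h)))))
      (family-units (A *ₚ linear c) fs (length-*ₚ A (linear c) hA ℕ.≤-refl)
        (subst (_≤ suc κ) (trans (ℕ.+-suc α (length fs)) (cong (ℕ._+ length fs) (ℕ.+-comm 1 α))) h))

    -- Each factor is `c + a + ρ w = (c + a)(1 + σ w)`, where `σ` is the product of the other linear
    -- factors at `a`. Hence the powers of `c + a` split off as a scalar and only a series with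
    -- constant term 1 remains.
    evalₛ-productₚ : ∀ A fs a ρ → eval a A * eval a (radical fs) ≡ ρ →
                     evalₛ (at a ρ) (productₚ fs) ≈ const (product fs a) ⊗ units A fs a
    evalₛ-productₚ A []             a ρ eq = P.trans
      (P.trans (P.+-congˡ {const 1#} (P.zeroʳ (at a ρ))) (P.+-identityʳ (const 1#))) (P.sym (P.*-identityˡ (const 1#)))
    evalₛ-productₚ A ((c , e) ∷ fs) a ρ eq = begin
      evalₛ X (linear c ^ₚ e *ₚ productₚ fs) ≈⟨ evalₛ-*ₚ X (linear c ^ₚ e) (productₚ fs) ⟩
      evalₛ X (linear c ^ₚ e) ⊗ evalₛ X (productₚ fs) ≈⟨ P.*-cong (P.trans (evalₛ-^ₚ X (linear c) e) (E.^-congˡ e factor)) (evalₛ-productₚ (A *ₚ linear c) fs a ρ eq′) ⟩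
      (const (c + a) ⊗ U) ^ₛ e ⊗ (const (product fs a) ⊗ T) ≈⟨ P.*-congʳ {const (product fs a) ⊗ T} (P.trans (E.^-distrib-* (const (c + a)) U e) (P.*-congʳ {U ^ₛ e} (const-^ (c + a) e))) ⟩
      const ((c + a) ^ e) ⊗ U ^ₛ e ⊗ (const (product fs a) ⊗ T) ≈⟨ SP.solve 4 (λ x u y t → x SP.:* u SP.:* (y SP.:* t) SP.:= (x SP.:* y) SP.:* (u SP.:* t)) P.refl (const ((c + a) ^ e)) (U ^ₛ e) (const (product fs a)) T ⟩
      const ((c + a) ^ e) ⊗ const (product fs a) ⊗ (U ^ₛ e ⊗ T) ≈⟨ P.*-congʳ {U ^ₛ e ⊗ T} (P.sym (const-* ((c + a) ^ e) (product fs a))) ⟩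
      const ((c + a) ^ e * product fs a) ⊗ (U ^ₛ e ⊗ T) ∎
      where
      open Relation.Binary.Reasoning.Setoid P.setoid
      X = at a ρ
      σ = eval a (A *ₚ radical fs)
      U = at (eval a (1# ∷ [])) σ
      T = units (A *ₚ linear c) fs a
      linear-value : eval a (linear c) ≡ c + a
      linear-value = eval-linear a c
      eq′ : eval a (A *ₚ linear c) * eval a (radical fs) ≡ ρ
      eq′ = trans (cong (_* eval a (radical fs)) (eval-*ₚ a A (linear c)))
              (trans (*-assoc _ _ _) (trans (cong (eval a A *_) (sym (eval-*ₚ a (linear c) (radical fs)))) eq))
      ρ-value : (c + a) * σ ≡ ρ
      ρ-value = trans (cong₂ _*_ (sym linear-value) (eval-*ₚ a A (radical fs)))
        (trans (SF.solve 3 (λ x y z → x SF.:* (y SF.:* z) SF.:= y SF.:* x SF.:* z) refl (eval a (linear c)) (eval a A) (eval a (radical fs)))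
          (trans (cong (_* eval a (radical fs)) (sym (eval-*ₚ a A (linear c)))) eq′))
      factor : evalₛ X (linear c) ≈ const (c + a) ⊗ U
      factor = begin
        evalₛ X (linear c) ≈⟨ evalₛ-linear X c ⟩
        const c ⊕ (const a ⊕ const ρ ⊗ w) ≈⟨ P.+-assoc (const c) (const a) (const ρ ⊗ w) ⟨
        const c ⊕ const a ⊕ const ρ ⊗ w ≈⟨ P.+-cong (P.sym (const-+ c a)) (P.*-congʳ {w} (P.trans (λ n → cong (λ z → const z n) (sym ρ-value)) (const-* (c + a) σ))) ⟩
        const (c + a) ⊕ const (c + a) ⊗ const σ ⊗ w ≈⟨ P.+-cong (P.sym (P.*-identityʳ (const (c + a)))) (P.*-assoc (const (c + a)) (const σ) w) ⟩
        const (c + a) ⊗ const 1# ⊕ const (c + a) ⊗ (const σ ⊗ w) ≈⟨ P.distribˡ (const (c + a)) (const 1#) (const σ ⊗ w) ⟨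
        const (c + a) ⊗ (const 1# ⊕ const σ ⊗ w) ≈⟨ P.*-congˡ {const (c + a)} (P.+-congʳ {const σ ⊗ w} (λ n → cong (λ z → const z n) (sym (eval-constant a 1#)))) ⟩
        const (c + a) ⊗ U ∎

-- The auxiliary polynomial and its zeros

module _ {q : ℕ} (F : FiniteField q) where
  open Field F
  open Series F
  open Polynomial F
  open Linear F
  open StepanovMethod F
  private
    module P = CommutativeRing seriesRing
    module E = Algebra.Properties.CommutativeSemiring.Exp P.commutativeSemiring
    module Mult = Algebra.Properties.Semiring.Mult P.semiring
    module SP = Algebra.Solver.Ring.NaturalCoefficients.Default P.commutativeSemiring
    infix 4 _≈_
    _≈_ : Series → Series → Set
    _≈_ = _≗_
  open E using () renaming (_^_ to _^ₛ_)

  infix 4 _≡[_]_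
  _≡[_]_ : Series → ℕ → Series → Set
  f ≡[ M ] g = ∀ i → i < M → f i ≡ g i

  ≡[]-⊗ : ∀ {M f f′ g g′} → f ≡[ M ] f′ → g ≡[ M ] g′ → f ⊗ g ≡[ M ] f′ ⊗ g′
  ≡[]-⊗ hf hg i i<M = ⊗-cong≤ i (λ {j} j≤i → hf j (ℕ.≤-<-trans j≤i i<M)) (λ {j} j≤i → hg j (ℕ.≤-<-trans j≤i i<M))

  ≡[]-^ : ∀ {M f f′} n → f ≡[ M ] f′ → f ^ₛ n ≡[ M ] f′ ^ₛ n
  ≡[]-^ zero    h i i<M = refl
  ≡[]-^ (suc n) h = ≡[]-⊗ h (≡[]-^ n h)

  ×-series : ∀ n f i → (n Mult.× f) i ≡ n · f i
  ×-series zero    f i = refl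
  ×-series (suc n) f i = cong (f i +_) (×-series n f i)

  n·0≡0 : ∀ n → n · 0# ≡ 0#
  n·0≡0 zero    = refl
  n·0≡0 (suc n) = trans (+-identityˡ _) (n·0≡0 n)

  -- Frobenius gives `a^q + ρ^q w^q`, and `a^q = a`. So a power `X^(q j)` looks like `a^j` in the
  -- equations: it costs degree `j` there, but provides degree `q j` in the auxiliary polynomial.
  at-^q : IsPrimePower q → ∀ a ρ → at a ρ ^ₛ q ≡[ q ] const a
  at-^q pp a ρ i i<q with char pp
  ... | p , k , p-prime , q≡p^k , p·1≡0 = begin
    (at a ρ ^ₛ q) i ≡⟨ cong (λ z → (at a ρ ^ₛ z) i) q≡p^k ⟩
    (at a ρ ^ₛ (p ℕ.^ k)) i ≡⟨ frobenius^ seriesRing p-prime p×1≈0 k (const a) (const ρ ⊗ w) i ⟩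
    (const a ^ₛ (p ℕ.^ k)) i + ((const ρ ⊗ w) ^ₛ (p ℕ.^ k)) i ≡⟨ cong (λ z → (const a ^ₛ z) i + ((const ρ ⊗ w) ^ₛ z) i) q≡p^k ⟨
    (const a ^ₛ q) i + ((const ρ ⊗ w) ^ₛ q) i ≡⟨ cong₂ _+_ (trans (const-^ a q i) (cong (λ z → const z i) (x^q≡x a))) vanishing ⟩
    const a i + 0# ≡⟨ +-identityʳ _ ⟩
    const a i ∎
    where
    open ≡-Reasoning
    p×1≈0 : p Mult.× const 1# ≈ P.0#
    p×1≈0 zero    = trans (×-series p (const 1#) 0) p·1≡0
    p×1≈0 (suc i) = trans (×-series p (const 1#) (suc i)) (n·0≡0 p)
    vanishing : ((const ρ ⊗ w) ^ₛ q) i ≡ 0#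
    vanishing = trans (E.^-distrib-* (const ρ) w q i) (trans (P.*-comm (const ρ ^ₛ q) (w ^ₛ q) i) (w^n⊗-order q (const ρ ^ₛ q) i i<q))

  module Auxiliary (pp : IsPrimePower q) (n m : ℕ) {{n≢0 : NonZero n}} {{m≢0 : NonZero m}} (q≡1+nm : q ≡ suc (n ℕ.* m))
                   (cs : Factors) (cs≢0 : All (λ ce → ¬ (proj₁ ce ≡ 0#)) cs) (ζ : Carrier) where
    κ : ℕ
    κ = length cs

    open Families κ

    fs : Factors
    fs = (0# , 1) ∷ cs

    ρ : Carrier → Carrier
    ρ a = eval a (radical fs)

    -- Mixed radix digits, `i = u + m e + m n j`. Because `q = n m + 1`, a factor `X^(q j)`
    -- contributes one more than `m n` to the order for each unit of `j`, which gives
    -- `decomposition`.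
    u e j : ℕ → ℕ
    u i = i % m
    e i = i / m % n
    j i = i / m / n

    decomposition : ∀ i → u i ℕ.+ q ℕ.* j i ℕ.+ m ℕ.* e i ≡ i ℕ.+ j i
    decomposition i = begin
      u i ℕ.+ q ℕ.* j i ℕ.+ m ℕ.* e i ≡⟨ cong (λ z → u i ℕ.+ z ℕ.* j i ℕ.+ m ℕ.* e i) q≡1+nm ⟩
      u i ℕ.+ suc (n ℕ.* m) ℕ.* j i ℕ.+ m ℕ.* e i ≡⟨ solve 5 (λ u n m j e → u :+ (con 1 :+ n :* m) :* j :+ m :* e := u :+ (e :+ j :* n) :* m :+ j) refl (u i) n m (j i) (e i) ⟩
      u i ℕ.+ (e i ℕ.+ j i ℕ.* n) ℕ.* m ℕ.+ j i ≡⟨ cong (λ z → u i ℕ.+ z ℕ.* m ℕ.+ j i) (m≡m%n+[m/n]*n (i / m) n) ⟨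
      u i ℕ.+ i / m ℕ.* m ℕ.+ j i ≡⟨ cong (ℕ._+ j i) (m≡m%n+[m/n]*n i m) ⟨
      i ℕ.+ j i ∎
      where
      open ≡-Reasoning
      open +-*-Solver using (solve; con; _:+_; _:*_; _:=_)

    -- The order of vanishing at 0 of the i-th basis polynomial is i + j i, which is strictly increasing in i.
    basis : ℕ → Poly
    basis i = linear 0# ^ₚ (u i ℕ.+ q ℕ.* j i) *ₚ productₚ fs ^ₚ (m ℕ.* e i)

    length-basis : ∀ J i → j i < J → length (basis i) ≤ m ℕ.+ q ℕ.* (J ℕ.+ degree fs)
    length-basis J i j<J = begin
      length (basis i) ≤⟨ length-*ₚ (linear 0# ^ₚ a) (productₚ fs ^ₚ b) (length-^ₚ (linear 0#) a ℕ.≤-refl) (length-^ₚ (productₚ fs) b (length-productₚ fs)) ⟩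
      suc (a ℕ.* 1 ℕ.+ b ℕ.* d) ≡⟨ cong (λ z → suc (z ℕ.+ b ℕ.* d)) (ℕ.*-identityʳ a) ⟩
      suc (u i) ℕ.+ q ℕ.* j i ℕ.+ b ℕ.* d ≤⟨ ℕ.+-mono-≤ (ℕ.+-mono-≤ (m%n<n i m) (ℕ.*-monoʳ-≤ q (ℕ.<⇒≤ j<J))) (ℕ.*-monoˡ-≤ d b≤q) ⟩
      m ℕ.+ q ℕ.* J ℕ.+ q ℕ.* d ≡⟨ solve 4 (λ m q J d → m :+ q :* J :+ q :* d := m :+ q :* (J :+ d)) refl m q J d ⟩
      m ℕ.+ q ℕ.* (J ℕ.+ d) ∎
      where
      open ℕ.≤-Reasoning
      open +-*-Solver using (solve; con; _:+_; _:*_; _:=_)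
      a = u i ℕ.+ q ℕ.* j i
      b = m ℕ.* e i
      d = degree fs
      b≤q : b ≤ q
      b≤q = ℕ.≤-trans (ℕ.*-monoʳ-≤ m (ℕ.<⇒≤ (m%n<n (i / m) n))) (ℕ.≤-trans (ℕ.≤-reflexive (ℕ.*-comm m n)) (ℕ.≤-trans (ℕ.n≤1+n _) (ℕ.≤-reflexive (sym q≡1+nm))))

    evalₛ-X : ∀ X → evalₛ X (linear 0#) ≈ X
    evalₛ-X X = P.trans (evalₛ-linear X 0#) (P.trans (P.+-congʳ {X} const-0) (P.+-identityˡ X))

    H : Series
    H = evalₛ w (productₚ cs)

    evalₛ-w-basis : ∀ i → evalₛ w (basis i) ≈ w ^ₛ (i ℕ.+ j i) ⊗ H ^ₛ (m ℕ.* e i)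
    evalₛ-w-basis i = begin
      evalₛ w (basis i) ≈⟨ evalₛ-*ₚ w (linear 0# ^ₚ a) (productₚ fs ^ₚ b) ⟩
      evalₛ w (linear 0# ^ₚ a) ⊗ evalₛ w (productₚ fs ^ₚ b) ≈⟨ P.*-cong (P.trans (evalₛ-^ₚ w (linear 0#) a) (E.^-congˡ a (evalₛ-X w))) (P.trans (evalₛ-^ₚ w (productₚ fs) b) (E.^-congˡ b split)) ⟩
      w ^ₛ a ⊗ (w ⊗ H) ^ₛ b ≈⟨ P.*-congˡ {w ^ₛ a} (E.^-distrib-* w H b) ⟩
      w ^ₛ a ⊗ (w ^ₛ b ⊗ H ^ₛ b) ≈⟨ P.*-assoc (w ^ₛ a) (w ^ₛ b) (H ^ₛ b) ⟨
      w ^ₛ a ⊗ w ^ₛ b ⊗ H ^ₛ b ≈⟨ P.*-congʳ {H ^ₛ b} (P.trans (P.sym (E.^-homo-* w a b)) (E.^-congʳ w (decomposition i))) ⟩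
      w ^ₛ (i ℕ.+ j i) ⊗ H ^ₛ b ∎
      where
      open Relation.Binary.Reasoning.Setoid P.setoid
      a = u i ℕ.+ q ℕ.* j i
      b = m ℕ.* e i
      split : evalₛ w (productₚ fs) ≈ w ⊗ H
      split = P.trans (evalₛ-*ₚ w (linear 0# ^ₚ 1) (productₚ cs)) (P.*-congʳ {H}
        (P.trans (evalₛ-^ₚ w (linear 0#) 1) (P.trans (P.*-identityʳ (evalₛ w (linear 0#))) (evalₛ-X w))))

    basis-order : ∀ i → Order≥ (i ℕ.+ j i) (evalₛ w (basis i))
    basis-order i t t< = trans (evalₛ-w-basis i t) (w^n⊗-order (i ℕ.+ j i) (H ^ₛ (m ℕ.* e i)) t t<)

    basis-lead : ∀ i → ¬ (evalₛ w (basis i) (i ℕ.+ j i) ≡ 0#)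
    basis-lead i eq = x^n≢0 (m ℕ.* e i) (evalₛ-w-productₚ-0 cs cs≢0)
      (trans (sym (^ₛ-0 H (m ℕ.* e i))) (trans (sym (w^n⊗-lead (i ℕ.+ j i) (H ^ₛ (m ℕ.* e i)))) (trans (sym (evalₛ-w-basis i _)) eq)))

    T : Carrier → Series
    T = units (1# ∷ []) fs

    -- The expansion of `basis i` at a point with `f(a)^m = ζ`, modulo `w^q`: `X^(q j)` has become
    -- `a^j` and `f(a)^(m e)` has become `ζ^e`. Of the large degree of the term only `j + u` is left
    -- as a degree in `a`.
    jet : ℕ → Carrier → Series
    jet i a = const (eval a (scale (ζ ^ e i) (linear 0# ^ₚ j i))) ⊗ (at a (ρ a) ^ₛ u i ⊗ T a ^ₛ (m ℕ.* e i))

    jet-family : ∀ i → PolynomialFamily (j i ℕ.+ u i) (jet i)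
    jet-family i = subst (λ z → PolynomialFamily z (jet i))
      (cong (j i ℕ.+_) (trans (cong₂ ℕ._+_ (ℕ.*-identityʳ (u i)) (ℕ.*-zeroʳ (m ℕ.* e i))) (ℕ.+-identityʳ (u i))))
      (family-⊗
        (family-polynomial (j i) (scale (ζ ^ e i) (linear 0# ^ₚ j i))
          (length-scale (ζ ^ e i) (linear 0# ^ₚ j i) (subst (λ z → length (linear 0# ^ₚ j i) ≤ suc z) (ℕ.*-identityʳ (j i)) (length-^ₚ (linear 0#) (j i) ℕ.≤-refl))))
        (family-⊗
          (family-^ (u i) (family-≗ (family-affine 1 (linear 0#) (radical fs) ℕ.≤-refl (length-radical fs))
            (λ a → P.+-congʳ {const (ρ a) ⊗ w} (λ t → cong (λ z → const z t) (sym (trans (eval-linear a 0#) (+-identityˡ a)))))))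
          (family-^ (m ℕ.* e i) (family-units {0} (1# ∷ []) fs ℕ.≤-refl ℕ.≤-refl))))

    evalₛ-at-basis : ∀ {M} → M ≤ q → ∀ {a} → product fs a ^ m ≡ ζ → ∀ i → evalₛ (at a (ρ a)) (basis i) ≡[ M ] jet i a
    evalₛ-at-basis {M} M≤q {a} fa^m≡ζ i t t<M = begin
      evalₛ X (basis i) t ≡⟨ evalₛ-*ₚ X (linear 0# ^ₚ α) (productₚ fs ^ₚ β) t ⟩
      (evalₛ X (linear 0# ^ₚ α) ⊗ evalₛ X (productₚ fs ^ₚ β)) t ≡⟨ P.*-cong (P.trans (evalₛ-^ₚ X (linear 0#) α) (E.^-congˡ α (evalₛ-X X))) (P.trans (evalₛ-^ₚ X (productₚ fs) β) (E.^-congˡ β fs-value)) t ⟩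
      (X ^ₛ α ⊗ (const fa ⊗ T a) ^ₛ β) t ≡⟨ P.*-cong (E.^-homo-* X (u i) (q ℕ.* j i)) (P.trans (E.^-distrib-* (const fa) (T a) β) (P.*-congʳ {T a ^ₛ β} (const-^ fa β))) t ⟩
      (X ^ₛ u i ⊗ X ^ₛ (q ℕ.* j i) ⊗ (const (fa ^ β) ⊗ T a ^ₛ β)) t ≡⟨ ≡[]-⊗ {M} (≡[]-⊗ {M} (λ _ _ → refl) power) (λ _ _ → refl) t t<M ⟩
      (X ^ₛ u i ⊗ const (a ^ j i) ⊗ (const (fa ^ β) ⊗ T a ^ₛ β)) t ≡⟨ SP.solve 4 (λ x y z t → x SP.:* y SP.:* (z SP.:* t) SP.:= z SP.:* y SP.:* (x SP.:* t)) P.refl (X ^ₛ u i) (const (a ^ j i)) (const (fa ^ β)) (T a ^ₛ β) t ⟩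
      (const (fa ^ β) ⊗ const (a ^ j i) ⊗ (X ^ₛ u i ⊗ T a ^ₛ β)) t ≡⟨ P.*-congʳ {X ^ₛ u i ⊗ T a ^ₛ β} (P.trans (P.sym (const-* (fa ^ β) (a ^ j i))) (λ s → cong (λ z → const z s) scalar)) t ⟩
      jet i a t ∎
      where
      open ≡-Reasoning
      X = at a (ρ a)
      α = u i ℕ.+ q ℕ.* j i
      β = m ℕ.* e i
      fa = product fs a
      fs-value : evalₛ X (productₚ fs) ≈ const fa ⊗ T a
      fs-value = evalₛ-productₚ (1# ∷ []) fs a (ρ a) (trans (cong (_* ρ a) (eval-constant a 1#)) (*-identityˡ _))
      power : X ^ₛ (q ℕ.* j i) ≡[ M ] const (a ^ j i)
      power s s<M = trans (sym (E.^-assocʳ X q (j i) s)) (trans (≡[]-^ (j i) (λ r r<M → at-^q pp a (ρ a) r (ℕ.<-≤-trans r<M M≤q)) s s<M) (const-^ a (j i) s))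
      scalar : fa ^ β * a ^ j i ≡ eval a (scale (ζ ^ e i) (linear 0# ^ₚ j i))
      scalar = trans (cong₂ _*_ (trans (sym (^-assocʳ fa m (e i))) (cong (_^ e i) fa^m≡ζ))
                        (sym (trans (eval-^ₚ a (linear 0#) (j i)) (cong (_^ j i) (trans (eval-linear a 0#) (+-identityˡ a))))))
                 (sym (eval-scale a (ζ ^ e i) (linear 0# ^ₚ j i)))

    module _ (J M : ℕ) (M≤q : M ≤ q) (few-equations : M ℕ.* (m ℕ.+ J ℕ.+ κ ℕ.* M) < n ℕ.* J ℕ.* m) where
      private
        N W : ℕ
        N = n ℕ.* J ℕ.* m
        W = m ℕ.+ J ℕ.+ κ ℕ.* M

        j<J : ∀ {i} → i < N → j i < J
        j<J {i} i<N = m<n*o⇒m/o<n {i / m} {J} {n} (subst (i / m <_) (ℕ.*-comm n J) (m<n*o⇒m/o<n {i} {n ℕ.* J} {m} i<N))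

        constraint : ℕ → ℕ → Poly
        constraint i l = proj₁ (jet-family i l)

        length-constraint : ∀ {i l} → i < N → l < M → length (constraint i l) ≤ W
        length-constraint {i} {l} i<N l<M = begin
          length (constraint i l) ≤⟨ proj₁ (proj₂ (jet-family i l)) ⟩
          suc (j i ℕ.+ u i ℕ.+ κ ℕ.* l) ≡⟨ cong (λ z → suc (z ℕ.+ κ ℕ.* l)) (ℕ.+-comm (j i) (u i)) ⟩
          suc (u i) ℕ.+ j i ℕ.+ κ ℕ.* l ≤⟨ ℕ.+-mono-≤ (ℕ.+-mono-≤ (m%n<n i m) (ℕ.<⇒≤ (j<J i<N))) (ℕ.*-monoʳ-≤ κ (ℕ.<⇒≤ l<M)) ⟩
          W ∎
          where open ℕ.≤-Reasoning

        -- The equation with index `(l , v)` kills the v-th coefficient of the polynomial in `a`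
        -- that describes the l-th coefficient of the expansion of `Ψ`.
        equations : Fin (M ℕ.* W) → Fin N → Carrier
        equations t i = let (l , v) = remQuot {M} W t in coeff (constraint (toℕ i) (toℕ l)) (toℕ v)

        solution = kernel few-equations equations

        x : Fin N → Carrier
        x = proj₁ solution

        Ψ : Poly
        Ψ = combination N x (basis ∘ toℕ)

        evalₛ-combination : ∀ X a l N (x : Fin N → Carrier) (b c : Fin N → Poly) → (∀ i → evalₛ X (b i) l ≡ eval a (c i)) →
                            evalₛ X (combination N x b) l ≡ eval a (combination N x c)
        evalₛ-combination X a l zero    x b c h = refl
        evalₛ-combination X a l (suc N) x b c h = begin
          evalₛ X (combination (suc N) x b) l
            ≡⟨ evalₛ-+ₚ X (scale (x zero) (b zero)) (combination N (x ∘ suc) (b ∘ suc)) l ⟩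
          evalₛ X (scale (x zero) (b zero)) l + evalₛ X (combination N (x ∘ suc) (b ∘ suc)) l
            ≡⟨ cong₂ _+_ (trans (evalₛ-scale X (x zero) (b zero) l) (trans (const-⊗ (x zero) _ l) (trans (cong (x zero *_) (h zero)) (sym (eval-scale a (x zero) (c zero))))))
                 (evalₛ-combination X a l N (x ∘ suc) (b ∘ suc) (c ∘ suc) (h ∘ suc)) ⟩
          eval a (scale (x zero) (c zero)) + eval a (combination N (x ∘ suc) (c ∘ suc))
            ≡⟨ eval-+ₚ a (scale (x zero) (c zero)) (combination N (x ∘ suc) (c ∘ suc)) ⟨
          eval a (combination (suc N) x c) ∎
          where open ≡-Reasoning

        -- The l-th coefficient of the expansion is the value at `a` of a polynomial whose
        -- coefficients all vanish by the choice of `x`; the point enters only through this value.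
        vanishes : ∀ {a} → product fs a ^ m ≡ ζ → Order≥ M (evalₛ (at a (ρ a)) Ψ)
        vanishes {a} fa^m≡ζ l l<M = begin
          evalₛ (at a (ρ a)) Ψ l ≡⟨ evalₛ-combination (at a (ρ a)) a l N x (basis ∘ toℕ) C (λ i → trans (evalₛ-at-basis M≤q fa^m≡ζ (toℕ i) l l<M) (proj₂ (proj₂ (jet-family (toℕ i) l)) a)) ⟩
          eval a (combination N x C) ≡⟨ eval-zero a (combination N x C) coefficients ⟩
          0# ∎
          where
          open ≡-Reasoning
          C : Fin N → Poly
          C i = constraint (toℕ i) l
          coefficients : ∀ v → v < length (combination N x C) → coeff (combination N x C) v ≡ 0#
          coefficients v v< = trans (coeff-combination N x C v) (trans (dot-congʳ N (λ i → sym (same i))) (proj₂ (proj₂ solution) t))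
            where
            v<W : v < W
            v<W = ℕ.<-≤-trans v< (length-combination N x C (λ i → length-constraint (Fin.toℕ<n i) l<M))
            t = combine (fromℕ< l<M) (fromℕ< v<W)
            same : ∀ i → equations t i ≡ coeff (C i) v
            same i = trans (cong (λ lv → coeff (constraint (toℕ i) (toℕ (proj₁ lv))) (toℕ (proj₂ lv))) (Fin.remQuot-combine {M} (fromℕ< l<M) (fromℕ< v<W)))
                       (cong₂ (λ l v → coeff (constraint (toℕ i) l) v) (Fin.toℕ-fromℕ< l<M) (Fin.toℕ-fromℕ< v<W))
            dot-congʳ : ∀ N {x : Fin N → Carrier} {f g : Fin N → Carrier} → (∀ i → f i ≡ g i) → dot N x f ≡ dot N x g
            dot-congʳ zero    h = refl
            dot-congʳ (suc N) {x} h = cong₂ _+_ (cong (x zero *_) (h zero)) (dot-congʳ N (h ∘ suc))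

        Ψ-nonzero : Nonzero Ψ
        Ψ-nonzero = combination-nonzero N x (basis ∘ toℕ) (λ i → toℕ i ℕ.+ j (toℕ i)) (λ i → basis-order (toℕ i)) (λ i → basis-lead (toℕ i))
          (λ i i′ i<i′ → ℕ.+-mono-<-≤ i<i′ (/-monoˡ-≤ n (/-monoˡ-≤ m (ℕ.<⇒≤ i<i′)))) (proj₁ (proj₂ solution))

        radical≢0 : ∀ {a} gs → All (λ ce → ¬ (proj₁ ce + a ≡ 0#)) gs → ¬ (eval a (radical gs) ≡ 0#)
        radical≢0 {a} []             h eq = 1≢0 (trans (sym (eval-constant a 1#)) eq)
        radical≢0 {a} ((c , _) ∷ gs) (c≢ ∷ h) eq =
          x*y≢0 (λ z → c≢ (trans (sym (eval-linear a c)) z)) (radical≢0 gs h) (trans (sym (eval-*ₚ a (linear c) (radical gs))) eq)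

      stepanov : ∀ V → Unique V → (∀ {a} → a ∈ V → All (λ ce → ¬ (proj₁ ce + a ≡ 0#)) fs × product fs a ^ m ≡ ζ) →
                 length V ℕ.* M < m ℕ.+ q ℕ.* (J ℕ.+ degree fs)
      stepanov V unique h = ℕ.<-≤-trans
        (count-roots ρ M V Ψ unique (λ a∈ → radical≢0 fs (proj₁ (h a∈))) (λ a∈ → vanishes (proj₂ (h a∈))) Ψ-nonzero)
        (length-combination N x (basis ∘ toℕ) (λ i → length-basis J (toℕ i) (j<J (Fin.toℕ<n i))))

-- Roots of unity

module _ {q : ℕ} (F : FiniteField q) where
  open Field F
  open Series F
  open Polynomial F
  private module SF = Algebra.Solver.Ring.NaturalCoefficients.Default commutativeSemiring

  evalₛ-0 : ∀ X p → evalₛ X p 0 ≡ eval (X 0) p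
  evalₛ-0 X []      = refl
  evalₛ-0 X (c ∷ p) = cong (λ z → c + X 0 * z) (evalₛ-0 X p)

  roots-bound : ∀ p → ¬ (eval 0# p ≡ 0#) → ∀ V → Unique V → (∀ {a} → a ∈ V → eval a p ≡ 0#) → length V < length p
  roots-bound p p0≢0 V u h = subst (_< length p) (ℕ.*-identityʳ (length V))
    (count-roots (λ _ → 1#) 1 V p u (λ _ → 1≢0) ord (λ nz → p0≢0 (trans (sym (evalₛ-0 w p)) (nz 0))))
    where
    ord : ∀ {a} → a ∈ V → Order≥ 1 (evalₛ (at a 1#) p)
    ord {a} a∈ zero _ = trans (evalₛ-0 (at a 1#) p) (trans (cong (λ z → eval z p) (trans (cong (a +_) (zeroʳ 1#)) (+-identityʳ a))) (h a∈))
    ord a∈ (suc n) (s≤s ())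

  monomial : ℕ → Poly
  monomial N = linear 0# ^ₚ N

  eval-monomial : ∀ a N → eval a (monomial N) ≡ a ^ N
  eval-monomial a N = trans (eval-^ₚ a (linear 0#) N) (cong (_^ N) (trans (eval-linear a 0#) (+-identityˡ a)))

  length-monomial : ∀ N → length (monomial N) ≤ suc N
  length-monomial N = subst (λ z → length (monomial N) ≤ suc z) (ℕ.*-identityʳ N) (length-^ₚ (linear 0#) N ℕ.≤-refl)

  power-roots-bound : ∀ N c → .{{NonZero N}} → ¬ (c ≡ 0#) → ∀ V → Unique V → (∀ {a} → a ∈ V → a ^ N ≡ c) → length V ≤ N
  power-roots-bound N@(suc N-1) c c≢0 V u h = ℕ.≤-pred (ℕ.<-≤-trans (roots-bound p p0≢0 V u root)
      (length-+ₚ (monomial N) (- c ∷ []) (length-monomial N) (s≤s z≤n)))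
    where
    p = monomial N +ₚ (- c ∷ [])
    value : ∀ a → eval a p ≡ a ^ N - c
    value a = trans (eval-+ₚ a (monomial N) (- c ∷ [])) (cong₂ _+_ (eval-monomial a N) (eval-constant a (- c)))
    p0≢0 : ¬ (eval 0# p ≡ 0#)
    p0≢0 eq = c≢0 (trans (sym (-‿involutive c)) (trans (cong -_ (trans (trans (sym (+-identityˡ (- c))) (cong (_- c) (sym (0^1+n N-1)))) (trans (sym (value 0#)) eq))) -0#≈0#))
    root : ∀ {a} → a ∈ V → eval a p ≡ 0#
    root {a} a∈ = trans (value a) (trans (cong (_- c) (h a∈)) (-‿inverseʳ c))

  μ : ℕ → List Carrier
  μ N = filter (λ y → y ^ N ≟ 1#) elems

  μ-unique : ∀ N → Unique (μ N)
  μ-unique N = filter⁺ (λ y → y ^ N ≟ 1#) elems-unique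

  ∈μ : ∀ N {y} → y ^ N ≡ 1# → y ∈ μ N
  ∈μ N {y} h = ∈-filter⁺ (λ y → y ^ N ≟ 1#) (∈elems y) h

  ∈μ⁻ : ∀ N {y} → y ∈ μ N → y ^ N ≡ 1#
  ∈μ⁻ N y∈ = proj₂ (∈-filter⁻ (λ y → y ^ N ≟ 1#) {xs = elems} y∈)

  unity≢0 : ∀ N .{{_ : NonZero N}} {x} → x ^ N ≡ 1# → ¬ (x ≡ 0#)
  unity≢0 (suc N) eq refl = 1≢0 (trans (sym eq) (0^1+n N))

  -- This is `1 + X^m + ... + X^(m n)`, the cofactor of `X^m - 1` in `X^(m (n + 1)) - 1`.
  geometric : ℕ → ℕ → Poly
  geometric m zero    = 1# ∷ []
  geometric m (suc n) = (1# ∷ []) +ₚ monomial m *ₚ geometric m n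

  length-geometric : ∀ m n → length (geometric m n) ≤ suc (m ℕ.* n)
  length-geometric m zero    = s≤s z≤n
  length-geometric m (suc n) = length-+ₚ (1# ∷ []) (monomial m *ₚ geometric m n) (s≤s z≤n)
    (subst (λ z → length (monomial m *ₚ geometric m n) ≤ suc z) (sym (ℕ.*-suc m n)) (length-*ₚ (monomial m) (geometric m n) (length-monomial m) (length-geometric m n)))

  eval-geometric-suc : ∀ a m n → eval a (geometric m (suc n)) ≡ 1# + a ^ m * eval a (geometric m n)
  eval-geometric-suc a m n = trans (eval-+ₚ a (1# ∷ []) (monomial m *ₚ geometric m n)) (cong₂ _+_ (eval-constant a 1#)
      (trans (eval-*ₚ a (monomial m) (geometric m n)) (cong (_* eval a (geometric m n)) (eval-monomial a m))))

  eval-geometric-0 : ∀ m .{{_ : NonZero m}} n → eval 0# (geometric m n) ≡ 1#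
  eval-geometric-0 m       zero    = eval-constant 0# 1#
  eval-geometric-0 (suc m) (suc n) = trans (eval-geometric-suc 0# (suc m) n)
    (trans (cong (λ z → 1# + z * eval 0# (geometric (suc m) n)) (0^1+n m)) (trans (cong (1# +_) (zeroˡ _)) (+-identityʳ 1#)))

  eval-geometric : ∀ a m n → a ^ m * eval a (geometric m n) + 1# ≡ eval a (geometric m n) + (a ^ m) ^ suc n
  eval-geometric a m zero = trans (cong (λ g → a ^ m * g + 1#) (eval-constant a 1#)) (trans (+-comm _ 1#) (cong (_+ a ^ m * 1#) (sym (eval-constant a 1#))))
  eval-geometric a m (suc n) = begin
    z * eval a (geometric m (suc n)) + 1# ≡⟨ cong (λ g → z * g + 1#) (eval-geometric-suc a m n) ⟩
    z * (1# + z * g) + 1# ≡⟨ SF.solve 3 (λ z g o → z SF.:* (o SF.:+ z SF.:* g) SF.:+ o SF.:= z SF.:* (z SF.:* g SF.:+ o) SF.:+ o) refl z g 1# ⟩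
    z * (z * g + 1#) + 1# ≡⟨ cong (λ t → z * t + 1#) (eval-geometric a m n) ⟩
    z * (g + z ^ suc n) + 1# ≡⟨ SF.solve 4 (λ z g y o → z SF.:* (g SF.:+ y) SF.:+ o SF.:= o SF.:+ z SF.:* g SF.:+ z SF.:* y) refl z g (z ^ suc n) 1# ⟩
    1# + z * g + z * z ^ suc n ≡⟨ cong (_+ z * z ^ suc n) (eval-geometric-suc a m n) ⟨
    eval a (geometric m (suc n)) + z ^ suc (suc n) ∎
    where
    open ≡-Reasoning
    z = a ^ m
    g = eval a (geometric m n)

  -- A nonzero element that is not an m-th root of unity is a root of the geometric cofactor, of
  -- degree `m (n - 1)`. It has at most that many roots, which leaves at least `m` of the `n m`
  -- nonzero elements.
  length-μ : ∀ n m .{{_ : NonZero n}} .{{_ : NonZero m}} → q ≡ suc (n ℕ.* m) → length (μ m) ≡ m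
  length-μ n@(suc n-1) m@(suc m-1) q≡ = ℕ.≤-antisym
      (power-roots-bound m 1# 1≢0 (μ m) (μ-unique m) (∈μ⁻ m))
      (ℕ.+-cancelʳ-≤ (m ℕ.* n-1) m (length (μ m)) (begin
        m ℕ.+ m ℕ.* n-1 ≡⟨ ℕ.*-suc m n-1 ⟨
        m ℕ.* n ≡⟨ ℕ.*-comm m n ⟩
        n ℕ.* m ≤⟨ ℕ.≤-pred (ℕ.≤-trans (ℕ.≤-reflexive (trans (sym q≡) (sym length-elems))) (length-⊆ elems-unique cover)) ⟩
        length (μ m ++ others) ≡⟨ length-++ (μ m) ⟩
        length (μ m) ℕ.+ length others ≤⟨ ℕ.+-monoʳ-≤ (length (μ m)) others-bound ⟩
        length (μ m) ℕ.+ m ℕ.* n-1 ∎))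
    where
    open ℕ.≤-Reasoning
    others : List Carrier
    others = filter (λ y → eval y (geometric m n-1) ≟ 0#) elems
    others-bound : length others ≤ m ℕ.* n-1
    others-bound = ℕ.≤-pred (ℕ.<-≤-trans
      (roots-bound (geometric m n-1) (λ eq → 1≢0 (trans (sym (eval-geometric-0 m n-1)) eq)) others (filter⁺ _ elems-unique) (λ a∈ → proj₂ (∈-filter⁻ (λ y → eval y (geometric m n-1) ≟ 0#) {xs = elems} a∈)))
      (length-geometric m n-1))
    cover : ∀ {y} → y ∈ elems → y ∈ 0# ∷ μ m ++ others
    cover {y} y∈ with y ≟ 0# | y ^ m ≟ 1#
    ... | yes refl | _       = here refl
    ... | no  _    | yes eq  = there (∈-++⁺ˡ (∈μ m eq))
    ... | no  y≢0  | no  neq = there (∈-++⁺ʳ (μ m) (∈-filter⁺ (λ y → eval y (geometric m n-1) ≟ 0#) y∈ g≡0))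
      where
      g = eval y (geometric m n-1)
      z^n≡1 : (y ^ m) ^ n ≡ 1#
      z^n≡1 = trans (^-assocʳ y m n) (fermat y y≢0 (m ℕ.* n) (trans q≡ (cong suc (ℕ.*-comm n m))))
      fixed : y ^ m * g ≡ 1# * g
      fixed = trans (+-cancelʳ 1# _ _ (trans (eval-geometric y m n-1) (cong (g +_) z^n≡1))) (sym (*-identityˡ g))
      g≡0 : g ≡ 0#
      g≡0 with g ≟ 0#
      ... | yes h = h
      ... | no  h = contradiction (*-cancelʳ h fixed) neq

  nonzero : List Carrier
  nonzero = filter (λ y → ¬? (y ≟ 0#)) elems

  length-nonzero : q ≤ suc (length nonzero)
  length-nonzero = subst (_≤ suc (length nonzero)) length-elems (length-⊆ elems-unique cover)
    where
    cover : ∀ {y} → y ∈ elems → y ∈ 0# ∷ nonzero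
    cover {y} y∈ with y ≟ 0#
    ... | yes refl = here refl
    ... | no  h    = there (∈-filter⁺ (λ y → ¬? (y ≟ 0#)) y∈ h)

  ∈nonzero⁻ : ∀ {y} → y ∈ nonzero → ¬ (y ≡ 0#)
  ∈nonzero⁻ y∈ = proj₂ (∈-filter⁻ (λ y → ¬? (y ≟ 0#)) {xs = elems} y∈)

  -- If `x` were missed, the `d m` nonzero elements would be mapped by `y ↦ y^d` to at most `m - 1`
  -- values, with at most `d` elements over each.
  dth-power : ∀ d m .{{_ : NonZero d}} .{{_ : NonZero m}} → q ≡ suc (d ℕ.* m) → ∀ {x} → x ^ m ≡ 1# → ∃ λ y → ¬ (y ≡ 0#) × x ≡ y ^ d
  dth-power d m q≡ {x} x^m≡1 with any? (λ y → x ≟ y ^ d) nonzero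
  ... | yes found = let (y , y∈ , eq) = find found in y , ∈nonzero⁻ y∈ , eq
  ... | no  none  = contradiction (begin
      d ℕ.* m ≤⟨ ℕ.≤-pred (subst (_≤ suc (length nonzero)) q≡ length-nonzero) ⟩
      length nonzero ≡⟨ ∑-one nonzero ⟨
      ∑ nonzero (λ _ → 1) ≤⟨ ∑-mono nonzero (λ {y} y∈ → ℕ.≤-trans (ℕ.≤-reflexive (sym (⟦⟧-yes (y ^ d ≟ y ^ d) refl))) (term≤∑ (λ z → ⟦ y ^ d ≟ z ⟧) (image y∈))) ⟩
      ∑ nonzero (λ y → ∑ others (λ z → ⟦ y ^ d ≟ z ⟧)) ≡⟨ ∑-comm nonzero others _ ⟩
      ∑ others (λ z → ∑ nonzero (λ y → ⟦ y ^ d ≟ z ⟧)) ≤⟨ ∑-mono others (λ {z} z∈ → fibre (∈others z∈)) ⟩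
      ∑ others (λ _ → d) ≡⟨ ∑-const others d ⟩
      length others ℕ.* d ≡⟨ ℕ.*-comm (length others) d ⟩
      d ℕ.* length others ∎) (ℕ.<⇒≱ (ℕ.*-monoʳ-< d others<m))
    where
    open ℕ.≤-Reasoning
    others : List Carrier
    others = filter (λ z → ¬? (z ≟ x)) (μ m)
    ∈others : ∀ {z} → z ∈ others → z ^ m ≡ 1#
    ∈others z∈ = ∈μ⁻ m (proj₁ (∈-filter⁻ (λ z → ¬? (z ≟ x)) {xs = μ m} z∈))
    others<m : length others < m
    others<m = ℕ.≤-trans (length-⊆ {ys = μ m} (All.tabulate (λ z∈ x≡z → proj₂ (∈-filter⁻ (λ z → ¬? (z ≟ x)) {xs = μ m} z∈) (sym x≡z)) ∷ filter⁺ _ (μ-unique m))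
        (λ { (here refl) → ∈μ m x^m≡1 ; (there z∈) → proj₁ (∈-filter⁻ (λ z → ¬? (z ≟ x)) {xs = μ m} z∈) }))
      (power-roots-bound m 1# 1≢0 (μ m) (μ-unique m) (∈μ⁻ m))
    image : ∀ {y} → y ∈ nonzero → y ^ d ∈ others
    image {y} y∈ = ∈-filter⁺ (λ z → ¬? (z ≟ x)) (∈μ m (trans (^-assocʳ y d m) (fermat y (∈nonzero⁻ y∈) (d ℕ.* m) q≡)))
      (λ eq → none (Any-from y∈ (sym eq)))
      where
      Any-from : ∀ {y xs} → y ∈ xs → x ≡ y ^ d → Any (λ y → x ≡ y ^ d) xs
      Any-from (here refl) eq = here eq
      Any-from (there y∈)  eq = there (Any-from y∈ eq)
    fibre : ∀ {z} → z ^ m ≡ 1# → ∑ nonzero (λ y → ⟦ y ^ d ≟ z ⟧) ≤ d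
    fibre {z} z^m≡1 = subst (_≤ d) (length-filter-∑ (λ y → y ^ d ≟ z) nonzero)
      (power-roots-bound d z (unity≢0 m z^m≡1) _ (filter⁺ _ (filter⁺ _ elems-unique)) (λ y∈ → proj₂ (∈-filter⁻ (λ y → y ^ d ≟ z) {xs = nonzero} y∈)))

  S⇔ : ∀ d m .{{_ : NonZero d}} .{{_ : NonZero m}} → q ≡ suc (d ℕ.* m) → ∀ {x} → FiniteField.S F d x ⇔ x ^ m ≡ 1#
  S⇔ d m q≡ {x} = mk⇔
    (λ { (y , y≢0 , refl) → trans (cong (_^ m) (pow≡^ y d)) (trans (^-assocʳ y d m) (fermat y y≢0 (d ℕ.* m) q≡)) })
    (λ h → let (y , y≢0 , eq) = dth-power d m q≡ h in y , y≢0 , trans eq (sym (pow≡^ y d)))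
    where
    pow≡^ : ∀ y d → FiniteField.pow F y d ≡ y ^ d
    pow≡^ y zero    = refl
    pow≡^ y (suc d) = cong (y *_) (pow≡^ y d)

-- Averaging over exponents

module PrimeOrder {q : ℕ} (F : FiniteField q) (ℓ : ℕ) (ℓ-prime : Prime ℓ) where
  open Field F
  private instance
    ℓ≢0 : NonZero ℓ
    ℓ≢0 = prime⇒nonZero ℓ-prime

  trivial-power : ∀ {η} k → 0 < k → k < ℓ → η ^ k ≡ 1# → η ^ ℓ ≡ 1# → η ≡ 1#
  trivial-power {η} (suc k) _ k<ℓ ηk≡1 ηℓ≡1 = by-Bézout (coprime-Bézout (prime⇒coprime ℓ-prime k<ℓ))
    where
    open ≡-Reasoning
    power : ∀ {N} y → η ^ N ≡ 1# → η ^ (y ℕ.* N) ≡ 1#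
    power {N} y eq = trans (cong (η ^_) (ℕ.*-comm y N)) (trans (sym (^-assocʳ η N y)) (trans (cong (_^ y) eq) (1^n y)))
    by-Bézout : Bézout.Identity 1 ℓ (suc k) → η ≡ 1#
    by-Bézout (Bézout.+- x y eq) = begin
      η ≡⟨ *-identityʳ η ⟨
      η * 1# ≡⟨ cong (η *_) (power y ηk≡1) ⟨
      η ^ (1 ℕ.+ y ℕ.* suc k) ≡⟨ cong (η ^_) eq ⟩
      η ^ (x ℕ.* ℓ) ≡⟨ power x ηℓ≡1 ⟩
      1# ∎
    by-Bézout (Bézout.-+ x y eq) = begin
      η ≡⟨ *-identityʳ η ⟨
      η * 1# ≡⟨ cong (η *_) (power x ηℓ≡1) ⟨
      η ^ (1 ℕ.+ x ℕ.* ℓ) ≡⟨ cong (η ^_) eq ⟩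
      η ^ (y ℕ.* suc k) ≡⟨ power y ηk≡1 ⟩
      1# ∎

  module _ {η : Carrier} (η≢1 : ¬ (η ≡ 1#)) (ηℓ≡1 : η ^ ℓ ≡ 1#) where
    private
      equal-powers⇒ : ∀ {e e′} → e < e′ → e′ < ℓ → η ^ e ≡ η ^ e′ → η ≡ 1#
      equal-powers⇒ {e} {e′} e<e′ e′<ℓ eq = trivial-power (e′ ℕ.∸ e) (ℕ.m<n⇒0<n∸m e<e′) (ℕ.≤-<-trans (ℕ.m∸n≤m e′ e) e′<ℓ)
        (sym (*-cancelˡ (x^n≢0 e (unity≢0 F ℓ ηℓ≡1)) (trans (*-identityʳ _) (trans eq
          (trans (cong (η ^_) (sym (ℕ.m+[n∸m]≡n (ℕ.<⇒≤ e<e′)))) (^-homo-* η e (e′ ℕ.∸ e)))))))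
        ηℓ≡1

      powers-distinct : ∀ {e e′} → e ∈ upTo ℓ → e′ ∈ upTo ℓ → η ^ e ≡ η ^ e′ → e ≡ e′
      powers-distinct {e} {e′} e∈ e′∈ eq with ℕ.<-cmp e e′
      ... | tri< e<e′ _ _ = contradiction (equal-powers⇒ e<e′ (∈-upTo⁻ e′∈) eq) η≢1
      ... | tri≈ _ e≡e′ _ = e≡e′
      ... | tri> _ _ e>e′ = contradiction (equal-powers⇒ e>e′ (∈-upTo⁻ e∈) (sym eq)) η≢1

      powers = map (η ^_) (upTo ℓ)

    -- Otherwise the inverse of `τ` and the `ℓ` distinct powers of `η` would be `ℓ + 1` roots of
    -- `X^ℓ - 1`.
    solvable : ∀ {τ} → τ ^ ℓ ≡ 1# → ∃ λ e → e ∈ upTo ℓ × τ * η ^ e ≡ 1#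
    solvable {τ} τℓ≡1 with any? (λ y → τ * y ≟ 1#) powers
    ... | yes found = let (y , y∈ , eq) = find found ; (e , e∈ , y≡) = ∈-map⁻ (η ^_) y∈
                      in e , e∈ , trans (cong (τ *_) (sym y≡)) eq
    ... | no  none  = contradiction
        (power-roots-bound F ℓ 1# 1≢0 (τ⁻¹ ∷ powers) (All.tabulate (λ {y} y∈ eq → none (lose y∈ (trans (cong (τ *_) (sym eq)) τ*τ⁻¹))) ∷ unique-map powers-distinct (upTo⁺ ℓ)) root)
        (ℕ.<⇒≱ (s≤s (ℕ.≤-reflexive (sym (trans (length-map (η ^_) (upTo ℓ)) (length-upTo ℓ))))))
      where
      τ⁻¹ = proj₁ (inverse τ (unity≢0 F ℓ τℓ≡1))
      τ*τ⁻¹ = proj₂ (inverse τ (unity≢0 F ℓ τℓ≡1))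
      root : ∀ {y} → y ∈ τ⁻¹ ∷ powers → y ^ ℓ ≡ 1#
      root (here refl) = trans (sym (*-identityˡ _)) (trans (cong (_* τ⁻¹ ^ ℓ) (sym τℓ≡1))
        (trans (sym (^-distrib-* τ τ⁻¹ ℓ)) (trans (cong (_^ ℓ) τ*τ⁻¹) (1^n ℓ))))
      root (there y∈) with ∈-map⁻ (η ^_) y∈
      ... | e , _ , refl = trans (^-assocʳ η e ℓ) (trans (cong (η ^_) (ℕ.*-comm e ℓ)) (trans (sym (^-assocʳ η ℓ e)) (trans (cong (_^ e) ηℓ≡1) (1^n e))))

  module Exponents (n′ : ℕ) where
    open StepanovMethod F using (Factors; product)

    -- The exponents are `n′ e` with `0 ≤ e < ℓ`. In the application `q - 1 = n′ m ℓ`, so the m-th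
    -- power of `(c + x)^(n′ e)` is `η^e` with an ℓ-th root of unity `η` whenever `c + x ≠ 0`.
    -- Summing over `e` then does the work of orthogonality of characters.
    ∑exponents : List Carrier → (Factors → ℕ) → ℕ
    ∑exponents []       φ = φ []
    ∑exponents (c ∷ cs) φ = ∑ (upTo ℓ) (λ e → ∑exponents cs (λ fs → φ ((c , n′ ℕ.* e) ∷ fs)))

    Admissible : List Carrier → Factors → Set
    Admissible cs fs = map proj₁ fs ≡ cs × All (λ ce → proj₂ ce ≤ n′ ℕ.* ℓ) fs

    admissible-∷ : ∀ {c e cs fs} → e ∈ upTo ℓ → Admissible cs fs → Admissible (c ∷ cs) ((c , n′ ℕ.* e) ∷ fs)
    admissible-∷ {c} e∈ (eq , bounds) = cong (c ∷_) eq , ℕ.*-monoʳ-≤ n′ (ℕ.<⇒≤ (∈-upTo⁻ e∈)) ∷ bounds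

    ∑exponents-≤ : ∀ cs {φ U} → (∀ {fs} → Admissible cs fs → φ fs ≤ U) → ∑exponents cs φ ≤ ℓ ℕ.^ length cs ℕ.* U
    ∑exponents-≤ []       {U = U} h = ℕ.≤-trans (h (refl , [])) (ℕ.≤-reflexive (sym (ℕ.*-identityˡ U)))
    ∑exponents-≤ (c ∷ cs) {φ} {U} h = begin
      ∑ (upTo ℓ) (λ e → ∑exponents cs (λ fs → φ ((c , n′ ℕ.* e) ∷ fs))) ≤⟨ ∑-mono (upTo ℓ) (λ e∈ → ∑exponents-≤ cs (λ adm → h (admissible-∷ e∈ adm))) ⟩
      ∑ (upTo ℓ) (λ _ → ℓ ℕ.^ length cs ℕ.* U) ≡⟨ ∑-const (upTo ℓ) _ ⟩
      length (upTo ℓ) ℕ.* (ℓ ℕ.^ length cs ℕ.* U) ≡⟨ cong (ℕ._* (ℓ ℕ.^ length cs ℕ.* U)) (length-upTo ℓ) ⟩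
      ℓ ℕ.* (ℓ ℕ.^ length cs ℕ.* U) ≡⟨ ℕ.*-assoc ℓ (ℓ ℕ.^ length cs) U ⟨
      ℓ ℕ.^ suc (length cs) ℕ.* U ∎
      where open ℕ.≤-Reasoning

    ∑exponents-cong : ∀ cs {φ ψ} → (∀ {fs} → Admissible cs fs → φ fs ≡ ψ fs) → ∑exponents cs φ ≡ ∑exponents cs ψ
    ∑exponents-cong []       h = h (refl , [])
    ∑exponents-cong (c ∷ cs) h = ∑-cong (upTo ℓ) (λ e∈ → ∑exponents-cong cs (λ adm → h (admissible-∷ e∈ adm)))

    ∑exponents-comm : ∀ cs (xs : List Carrier) (f : Factors → Carrier → ℕ) →
                      ∑exponents cs (λ fs → ∑ xs (f fs)) ≡ ∑ xs (λ x → ∑exponents cs (λ fs → f fs x))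
    ∑exponents-comm []       xs f = refl
    ∑exponents-comm (c ∷ cs) xs f = trans (∑-cong (upTo ℓ) (λ {e} _ → ∑exponents-comm cs xs (λ fs → f ((c , n′ ℕ.* e) ∷ fs)))) (∑-comm (upTo ℓ) xs _)

    module Pointwise (m : ℕ) (x : Carrier) where
      η : Carrier → Carrier
      η c = (c + x) ^ (n′ ℕ.* m)

      solutions : List Carrier → Carrier → ℕ
      solutions cs τ = ∑exponents cs (λ fs → ⟦ τ * product fs x ^ m ≟ 1# ⟧)

      solutions-∷ : ∀ c cs τ → solutions (c ∷ cs) τ ≡ ∑ (upTo ℓ) (λ e → solutions cs (τ * η c ^ e))
      solutions-∷ c cs τ = ∑-cong (upTo ℓ) (λ {e} _ → ∑exponents-cong cs (λ {fs} _ → cong (λ z → ⟦ z ≟ 1# ⟧) (begin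
        τ * ((c + x) ^ (n′ ℕ.* e) * product fs x) ^ m ≡⟨ cong (τ *_) (^-distrib-* _ _ m) ⟩
        τ * (((c + x) ^ (n′ ℕ.* e)) ^ m * product fs x ^ m) ≡⟨ *-assoc τ _ _ ⟨
        τ * ((c + x) ^ (n′ ℕ.* e)) ^ m * product fs x ^ m ≡⟨ cong (λ z → τ * z * product fs x ^ m) (trans (^-assocʳ (c + x) (n′ ℕ.* e) m)
            (trans (cong ((c + x) ^_) (exchange e)) (sym (^-assocʳ (c + x) (n′ ℕ.* m) e)))) ⟩
        τ * η c ^ e * product fs x ^ m ∎)))
        where
        open ≡-Reasoning
        exchange : ∀ e → n′ ℕ.* e ℕ.* m ≡ n′ ℕ.* m ℕ.* e
        exchange e = +-*-Solver.solve 3 (λ n e m → n :* e :* m := n :* m :* e) refl n′ e m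
          where open +-*-Solver using (_:*_; _:=_)

      solutions-trivial : ∀ cs → All (λ c → η c ≡ 1#) cs → ∀ {τ} → τ ≡ 1# → ℓ ℕ.^ length cs ≤ solutions cs τ
      solutions-trivial [] [] {τ} τ≡1 = ℕ.≤-reflexive (sym (⟦⟧-yes (τ * 1# ^ m ≟ 1#) (trans (cong₂ _*_ τ≡1 (1^n m)) (*-identityˡ 1#))))
      solutions-trivial (c ∷ cs) (η≡1 ∷ h) {τ} τ≡1 = begin
        ℓ ℕ.* ℓ ℕ.^ length cs ≡⟨ cong (ℕ._* ℓ ℕ.^ length cs) (length-upTo ℓ) ⟨
        length (upTo ℓ) ℕ.* ℓ ℕ.^ length cs ≡⟨ ∑-const (upTo ℓ) _ ⟨
        ∑ (upTo ℓ) (λ _ → ℓ ℕ.^ length cs) ≤⟨ ∑-mono (upTo ℓ) (λ {e} _ → solutions-trivial cs h (trans (cong₂ _*_ τ≡1 (trans (cong (_^ e) η≡1) (1^n e))) (*-identityˡ 1#))) ⟩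
        ∑ (upTo ℓ) (λ e → solutions cs (τ * η c ^ e)) ≡⟨ solutions-∷ c cs τ ⟨
        solutions (c ∷ cs) τ ∎
        where open ℕ.≤-Reasoning

      *^-unity : ∀ {τ η} e → τ ^ ℓ ≡ 1# → η ^ ℓ ≡ 1# → (τ * η ^ e) ^ ℓ ≡ 1#
      *^-unity {τ} {η} e τℓ ηℓ = trans (^-distrib-* τ (η ^ e) ℓ) (trans (cong₂ _*_ τℓ
        (trans (^-assocʳ η e ℓ) (trans (cong (η ^_) (ℕ.*-comm e ℓ)) (trans (sym (^-assocʳ η ℓ e)) (trans (cong (_^ e) ηℓ) (1^n e)))))) (*-identityˡ 1#))

      -- θ generates the ℓ-th roots of unity, so for every choice of exponents one multiple τ θ^e is a solution.
      solutions-orbit : ∀ cs → All (λ c → η c ^ ℓ ≡ 1#) cs → ∀ {θ τ} → ¬ (θ ≡ 1#) → θ ^ ℓ ≡ 1# → τ ^ ℓ ≡ 1# →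
                        ℓ ℕ.^ length cs ≤ ∑ (upTo ℓ) (λ e → solutions cs (τ * θ ^ e))
      solutions-orbit []       []       {θ} {τ} θ≢1 θℓ τℓ =
        let (e , e∈ , eq) = solvable θ≢1 θℓ τℓ
        in ℕ.≤-trans (ℕ.≤-reflexive (sym (⟦⟧-yes (τ * θ ^ e * 1# ^ m ≟ 1#) (trans (cong₂ _*_ eq (1^n m)) (*-identityˡ 1#)))))
             (term≤∑ (λ e → ⟦ τ * θ ^ e * 1# ^ m ≟ 1# ⟧) e∈)
      solutions-orbit (c ∷ cs) (ηℓ ∷ h) {θ} {τ} θ≢1 θℓ τℓ = begin
        ℓ ℕ.* ℓ ℕ.^ length cs ≡⟨ cong (ℕ._* ℓ ℕ.^ length cs) (length-upTo ℓ) ⟨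
        length (upTo ℓ) ℕ.* ℓ ℕ.^ length cs ≡⟨ ∑-const (upTo ℓ) _ ⟨
        ∑ (upTo ℓ) (λ _ → ℓ ℕ.^ length cs) ≤⟨ ∑-mono (upTo ℓ) (λ {e′} _ → solutions-orbit cs h θ≢1 θℓ (*^-unity e′ τℓ ηℓ)) ⟩
        ∑ (upTo ℓ) (λ e′ → ∑ (upTo ℓ) (λ e → solutions cs (τ * η c ^ e′ * θ ^ e))) ≡⟨ ∑-comm (upTo ℓ) (upTo ℓ) _ ⟩
        ∑ (upTo ℓ) (λ e → ∑ (upTo ℓ) (λ e′ → solutions cs (τ * η c ^ e′ * θ ^ e))) ≡⟨ ∑-cong (upTo ℓ) (λ {e} _ → trans
             (∑-cong (upTo ℓ) (λ {e′} _ → cong (solutions cs) (trans (*-assoc _ _ _) (trans (cong (τ *_) (*-comm _ _)) (sym (*-assoc _ _ _))))))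
             (sym (solutions-∷ c cs (τ * θ ^ e)))) ⟩
        ∑ (upTo ℓ) (λ e → solutions (c ∷ cs) (τ * θ ^ e)) ∎
        where open ℕ.≤-Reasoning

      -- One `c` with `η c ≠ 1` is enough: its exponent can be adjusted to solve the equation
      -- whatever the other exponents are. So at least a share `1/ℓ` of all choices are solutions.
      solutions-nontrivial : ∀ cs → All (λ c → η c ^ ℓ ≡ 1#) cs → ¬ All (λ c → η c ≡ 1#) cs → ∀ {τ} → τ ^ ℓ ≡ 1# →
                             ℓ ℕ.^ length cs ≤ ℓ ℕ.* solutions cs τ
      solutions-nontrivial []       []       nontrivial τℓ = contradiction [] nontrivial
      solutions-nontrivial (c ∷ cs) (ηℓ ∷ h) nontrivial {τ} τℓ with η c ≟ 1#
      ... | no η≢1 = ℕ.*-monoʳ-≤ ℓ (ℕ.≤-trans (solutions-orbit cs h η≢1 ηℓ τℓ) (ℕ.≤-reflexive (sym (solutions-∷ c cs τ))))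
      ... | yes η≡1 = ℕ.*-monoʳ-≤ ℓ (begin
        ℓ ℕ.^ length cs ≤⟨ solutions-nontrivial cs h (λ t → nontrivial (η≡1 ∷ t)) τℓ ⟩
        ℓ ℕ.* solutions cs τ ≡⟨ cong (ℕ._* solutions cs τ) (length-upTo ℓ) ⟨
        length (upTo ℓ) ℕ.* solutions cs τ ≡⟨ ∑-const (upTo ℓ) _ ⟨
        ∑ (upTo ℓ) (λ _ → solutions cs τ) ≡⟨ ∑-cong (upTo ℓ) (λ {e} _ → cong (solutions cs) (sym (trans (cong (τ *_) (trans (cong (_^ e) η≡1) (1^n e))) (*-identityʳ τ)))) ⟩
        ∑ (upTo ℓ) (λ e → solutions cs (τ * η c ^ e)) ≡⟨ solutions-∷ c cs τ ⟨
        solutions (c ∷ cs) τ ∎)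
        where open ℕ.≤-Reasoning

-- Simultaneous power conditions

module Conditions {q : ℕ} (F : FiniteField q) where
  open Field F
  open StepanovMethod F using (Factors; product)

  -- A pair (c , M) stands for the condition (c + x)^M = 1.
  Satisfies : List (Carrier × ℕ) → Carrier → Set
  Satisfies conds x = All (λ cM → (proj₁ cM + x) ^ proj₂ cM ≡ 1#) conds

  satisfies? : ∀ conds x → Dec (Satisfies conds x)
  satisfies? conds x = all? (λ cM → (proj₁ cM + x) ^ proj₂ cM ≟ 1#) conds

  count : List (Carrier × ℕ) → ℕ
  count conds = ∑ elems (λ x → ⟦ satisfies? conds x ⟧)

  -- The first component does not follow from the second: a factor with exponent 0 hides its root,
  -- and at a root the scale of the local parameter vanishes.
  HasValue : Factors → ℕ → Carrier → Carrier → Set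
  HasValue fs m ζ x = All (λ ce → ¬ (proj₁ ce + x ≡ 0#)) fs × product fs x ^ m ≡ ζ

  hasValue? : ∀ fs m ζ x → Dec (HasValue fs m ζ x)
  hasValue? fs m ζ x = all? (λ ce → ¬? (proj₁ ce + x ≟ 0#)) fs ×-dec (product fs x ^ m ≟ ζ)

  shift-cancel : ∀ c y → c + (y - c) ≡ y
  shift-cancel c y = trans (+-comm c (y - c)) (trans (+-assoc y (- c) c) (trans (cong (y +_) (-‿inverseˡ c)) (+-identityʳ y)))

  count-shifted-unity : ∀ n M .{{_ : NonZero n}} .{{_ : NonZero M}} → q ≡ suc (n ℕ.* M) → ∀ c → M ≤ ∑ elems (λ x → ⟦ (c + x) ^ M ≟ 1# ⟧)
  count-shifted-unity n M q≡ c = subst₂ _≤_ (length-μ F n M q≡) (length-filter-∑ (λ x → (c + x) ^ M ≟ 1#) elems)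
    (length-injection (_- c) (λ _ _ eq → +-cancelʳ (- c) _ _ eq) (μ-unique F M)
      (λ {y} y∈ → ∈-filter⁺ (λ x → (c + x) ^ M ≟ 1#) (∈elems (y - c)) (trans (cong (_^ M) (shift-cancel c y)) (∈μ⁻ F M y∈))))

  count-zeros : ∀ c → ∑ elems (λ x → ⟦ c + x ≟ 0# ⟧) ≤ 1
  count-zeros c = subst (_≤ 1) (length-filter-∑ (λ x → c + x ≟ 0#) elems)
    (length-⊆ {ys = (0# - c) ∷ []} (filter⁺ (λ x → c + x ≟ 0#) elems-unique)
      (λ {x} x∈ → here (+-cancelˡ c _ _ (trans (proj₂ (∈-filter⁻ (λ x → c + x ≟ 0#) {xs = elems} x∈)) (sym (shift-cancel c 0#))))))

  module _ (ℓ : ℕ) (ℓ-prime : Prime ℓ) (n′ m : ℕ) .{{_ : NonZero n′}} .{{_ : NonZero m}} (q≡ : q ≡ suc (n′ ℕ.* (m ℕ.* ℓ))) where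
    private instance
      ℓ≢0 : NonZero ℓ
      ℓ≢0 = prime⇒nonZero ℓ-prime
      n′m≢0 : NonZero (n′ ℕ.* m)
      n′m≢0 = ℕ.m*n≢0 n′ m
      mℓ≢0 : NonZero (m ℕ.* ℓ)
      mℓ≢0 = ℕ.m*n≢0 m ℓ
    open PrimeOrder F ℓ ℓ-prime
    open Exponents n′

    conditions : List Carrier → List (Carrier × ℕ)
    conditions = map (_, n′ ℕ.* m)

    module _ (c₀ : Carrier) (cs : List Carrier) where
      private
        L = ℓ ℕ.^ length cs
        A C : List (Carrier × ℕ)
        A = (c₀ , m) ∷ conditions cs
        C = (c₀ , m ℕ.* ℓ) ∷ conditions cs

        zeros : Carrier → ℕ
        zeros x = ∑ cs (λ c → ⟦ c + x ≟ 0# ⟧)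

        values : Carrier → ℕ
        values x = ∑exponents cs (λ fs → ⟦ hasValue? ((c₀ , 1) ∷ fs) m 1# x ⟧)

        module _ (x : Carrier) where
          open Pointwise m x
          τ = (c₀ + x) ^ m

          B : Set
          B = (c₀ + x) ^ (m ℕ.* ℓ) ≡ 1#

          B? : Dec B
          B? = (c₀ + x) ^ (m ℕ.* ℓ) ≟ 1#

          A⇒B : Satisfies A x → B
          A⇒B (τ≡1 ∷ _) = trans (sym (^-assocʳ (c₀ + x) m ℓ)) (trans (cong (_^ ℓ) τ≡1) (1^n ℓ))

          A⇒η≡1 : Satisfies A x → All (λ c → η c ≡ 1#) cs
          A⇒η≡1 (_ ∷ h) = All.map⁻ {f = _, n′ ℕ.* m} h

          A⇒τ≡1 : Satisfies A x → τ ≡ 1#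
          A⇒τ≡1 (τ≡1 ∷ _) = τ≡1

          C-intro : B → All (λ c → η c ≡ 1#) cs → Satisfies C x
          C-intro b h = b ∷ All.map⁺ {f = _, n′ ℕ.* m} h

          A⇒nonzero : Satisfies A x → All (λ c → ¬ (c + x ≡ 0#)) cs
          A⇒nonzero h = All.map (λ {c} → unity≢0 F (n′ ℕ.* m) {c + x}) (A⇒η≡1 h)

          values-solutions : All (λ c → ¬ (c + x ≡ 0#)) cs → B → values x ≡ solutions cs τ
          values-solutions nz b = ∑exponents-cong cs (λ {fs} adm → ⟦⟧-cong (hasValue? ((c₀ , 1) ∷ fs) m 1# x) (τ * product fs x ^ m ≟ 1#)
            (λ { (_ , eq) → trans (sym (expand fs)) eq })
            (λ eq → unity≢0 F (m ℕ.* ℓ) b ∷ All.map⁻ {f = proj₁} (subst (All (λ c → ¬ (c + x ≡ 0#))) (sym (proj₁ adm)) nz) , trans (expand fs) eq))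
            where
            expand : ∀ fs → ((c₀ + x) ^ 1 * product fs x) ^ m ≡ τ * product fs x ^ m
            expand fs = trans (^-distrib-* _ (product fs x) m) (cong (λ z → z ^ m * product fs x ^ m) (*-identityʳ (c₀ + x)))

          ηℓ≡1 : All (λ c → ¬ (c + x ≡ 0#)) cs → All (λ c → η c ^ ℓ ≡ 1#) cs
          ηℓ≡1 = All.map (λ {c} c≢ → trans (^-assocʳ (c + x) (n′ ℕ.* m) ℓ) (fermat (c + x) c≢ (n′ ℕ.* m ℕ.* ℓ) (trans q≡ (cong suc (sym (ℕ.*-assoc n′ m ℓ))))))

          some-zero : ∀ cs → ¬ All (λ c → ¬ (c + x ≡ 0#)) cs → 1 ≤ ∑ cs (λ c → ⟦ c + x ≟ 0# ⟧)
          some-zero []       h = contradiction [] h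
          some-zero (c ∷ cs) h with c + x ≟ 0#
          ... | yes _ = s≤s z≤n
          ... | no c≢ = some-zero cs (λ t → h (c≢ ∷ t))

          -- Suppose `B` holds and no factor vanishes. The share of exponent choices with product
          -- value 1 is 1 if `A` holds, may be 0 if `C` holds without `A`, and is at least `1/ℓ`
          -- otherwise. Multiplied by `ℓ L` this is the inequality; `zeros` pays for the vanishing
          -- factors.
          pointwise : L ℕ.* (ℓ ℕ.* ⟦ satisfies? A x ⟧ ℕ.+ ⟦ B? ⟧) ≤ ℓ ℕ.* values x ℕ.+ L ℕ.* (⟦ satisfies? C x ⟧ ℕ.+ zeros x)
          pointwise = by-cases B? (all? (λ c → ¬? (c + x ≟ 0#)) cs) (all? (λ c → η c ≟ 1#) cs) (τ ≟ 1#)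
            where
            open ℕ.≤-Reasoning
            open +-*-Solver using (solve; con; _:+_; _:*_; _:=_)
            a = ⟦ satisfies? A x ⟧
            c = ⟦ satisfies? C x ⟧
            z = zeros x
            v = values x

            no-A : ¬ Satisfies A x → L ℕ.* (ℓ ℕ.* a ℕ.+ ⟦ B? ⟧) ≤ L ℕ.* 1
            no-A ¬a = ℕ.*-monoʳ-≤ L (begin
              ℓ ℕ.* a ℕ.+ ⟦ B? ⟧ ≡⟨ cong (λ t → ℓ ℕ.* t ℕ.+ ⟦ B? ⟧) (⟦⟧-no (satisfies? A x) ¬a) ⟩
              ℓ ℕ.* 0 ℕ.+ ⟦ B? ⟧ ≡⟨ cong (ℕ._+ ⟦ B? ⟧) (ℕ.*-zeroʳ ℓ) ⟩
              ⟦ B? ⟧ ≤⟨ ⟦⟧≤1 B? ⟩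
              1 ∎)

            use-zero : 1 ≤ c ℕ.+ z → L ℕ.* 1 ≤ ℓ ℕ.* v ℕ.+ L ℕ.* (c ℕ.+ z)
            use-zero h = ℕ.≤-trans (ℕ.*-monoʳ-≤ L h) (ℕ.m≤n+m _ (ℓ ℕ.* v))

            use-values : L ≤ ℓ ℕ.* v → L ℕ.* 1 ≤ ℓ ℕ.* v ℕ.+ L ℕ.* (c ℕ.+ z)
            use-values h = ℕ.≤-trans (ℕ.≤-reflexive (ℕ.*-identityʳ L)) (ℕ.≤-trans h (ℕ.m≤m+n _ _))

            by-cases : Dec B → Dec (All (λ c → ¬ (c + x ≡ 0#)) cs) → Dec (All (λ c → η c ≡ 1#) cs) → Dec (τ ≡ 1#) →
                       L ℕ.* (ℓ ℕ.* a ℕ.+ ⟦ B? ⟧) ≤ ℓ ℕ.* v ℕ.+ L ℕ.* (c ℕ.+ z)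
            by-cases (no ¬b) _ _ _ = begin
              L ℕ.* (ℓ ℕ.* a ℕ.+ ⟦ B? ⟧) ≡⟨ cong₂ (λ s t → L ℕ.* (ℓ ℕ.* s ℕ.+ t)) (⟦⟧-no (satisfies? A x) (¬b ∘ A⇒B)) (⟦⟧-no B? ¬b) ⟩
              L ℕ.* (ℓ ℕ.* 0 ℕ.+ 0) ≡⟨ solve 2 (λ L ℓ → L :* (ℓ :* con 0 :+ con 0) := con 0) refl L ℓ ⟩
              0 ≤⟨ z≤n ⟩
              ℓ ℕ.* v ℕ.+ L ℕ.* (c ℕ.+ z) ∎
            by-cases (yes b) (no ¬nz) _ _ = ℕ.≤-trans (no-A (¬nz ∘ A⇒nonzero)) (use-zero (ℕ.≤-trans (some-zero cs ¬nz) (ℕ.m≤n+m z c)))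
            by-cases (yes b) (yes nz) (no nontrivial) _ = ℕ.≤-trans (no-A (nontrivial ∘ A⇒η≡1))
              (use-values (ℕ.≤-trans (solutions-nontrivial cs (ηℓ≡1 nz) nontrivial (trans (^-assocʳ (c₀ + x) m ℓ) b))
                (ℕ.≤-reflexive (cong (ℓ ℕ.*_) (sym (values-solutions nz b))))))
            by-cases (yes b) (yes nz) (yes trivial) (no τ≢1) = ℕ.≤-trans (no-A (τ≢1 ∘ A⇒τ≡1)) (use-zero (ℕ.≤-trans 1≤c (ℕ.m≤m+n c z)))
              where
              1≤c : 1 ≤ c
              1≤c = ℕ.≤-reflexive (sym (⟦⟧-yes (satisfies? C x) (C-intro b trivial)))
            by-cases (yes b) (yes nz) (yes trivial) (yes τ≡1) = begin
              L ℕ.* (ℓ ℕ.* a ℕ.+ ⟦ B? ⟧) ≤⟨ ℕ.*-monoʳ-≤ L (ℕ.+-mono-≤ (ℕ.*-monoʳ-≤ ℓ (⟦⟧≤1 (satisfies? A x))) (⟦⟧≤1 B?)) ⟩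
              L ℕ.* (ℓ ℕ.* 1 ℕ.+ 1) ≡⟨ solve 2 (λ L ℓ → L :* (ℓ :* con 1 :+ con 1) := ℓ :* L :+ L :* con 1) refl L ℓ ⟩
              ℓ ℕ.* L ℕ.+ L ℕ.* 1 ≤⟨ ℕ.+-mono-≤ (ℕ.*-monoʳ-≤ ℓ (ℕ.≤-trans (solutions-trivial cs trivial τ≡1) (ℕ.≤-reflexive (sym (values-solutions nz b)))))
                  (ℕ.*-monoʳ-≤ L (ℕ.≤-trans (ℕ.≤-reflexive (sym (⟦⟧-yes (satisfies? C x) (C-intro b trivial)))) (ℕ.m≤m+n c z))) ⟩
              ℓ ℕ.* v ℕ.+ L ℕ.* (c ℕ.+ z) ∎

      -- The sum of `pointwise` over all `x`. For `U` close to `m` the terms `m ℓ` on the left and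
      -- `ℓ U` on the right nearly cancel, and what remains says that `A` holds for at most about
      -- `1/ℓ` of the solutions of `C`.
      averaging : ∀ {U} → (∀ {fs} → Admissible cs fs → ∑ elems (λ x → ⟦ hasValue? ((c₀ , 1) ∷ fs) m 1# x ⟧) ≤ U) →
                  ℓ ℕ.* count A ℕ.+ m ℕ.* ℓ ≤ ℓ ℕ.* U ℕ.+ (count C ℕ.+ length cs)
      averaging {U} bound = ℕ.*-cancelˡ-≤ L {{ℕ.m^n≢0 ℓ (length cs)}} (begin
        L ℕ.* (ℓ ℕ.* count A ℕ.+ m ℕ.* ℓ)
          ≤⟨ ℕ.*-monoʳ-≤ L (ℕ.+-monoʳ-≤ (ℓ ℕ.* count A) (count-shifted-unity n′ (m ℕ.* ℓ) q≡ c₀)) ⟩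
        L ℕ.* (ℓ ℕ.* count A ℕ.+ ∑ elems (λ x → ⟦ B? x ⟧))
          ≡⟨ cong (L ℕ.*_) (cong (ℕ._+ ∑ elems (λ x → ⟦ B? x ⟧)) (∑-*ˡ elems ℓ _)) ⟨
        L ℕ.* (∑ elems (λ x → ℓ ℕ.* ⟦ satisfies? A x ⟧) ℕ.+ ∑ elems (λ x → ⟦ B? x ⟧))
          ≡⟨ trans (cong (L ℕ.*_) (sym (∑-distrib-+ elems _ _))) (sym (∑-*ˡ elems L _)) ⟩
        ∑ elems (λ x → L ℕ.* (ℓ ℕ.* ⟦ satisfies? A x ⟧ ℕ.+ ⟦ B? x ⟧))
          ≤⟨ ∑-mono elems (λ {x} _ → pointwise x) ⟩
        ∑ elems (λ x → ℓ ℕ.* values x ℕ.+ L ℕ.* (⟦ satisfies? C x ⟧ ℕ.+ zeros x))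
          ≡⟨ trans (∑-distrib-+ elems _ _) (cong₂ ℕ._+_ (∑-*ˡ elems ℓ values) (trans (∑-*ˡ elems L _) (cong (L ℕ.*_) (∑-distrib-+ elems _ zeros)))) ⟩
        ℓ ℕ.* ∑ elems values ℕ.+ L ℕ.* (count C ℕ.+ ∑ elems zeros)
          ≤⟨ ℕ.+-mono-≤ (ℕ.*-monoʳ-≤ ℓ (ℕ.≤-trans (ℕ.≤-reflexive (sym (∑exponents-comm cs elems _))) (∑exponents-≤ cs bound)))
               (ℕ.*-monoʳ-≤ L (ℕ.+-monoʳ-≤ (count C) zeros-bound)) ⟩
        ℓ ℕ.* (L ℕ.* U) ℕ.+ L ℕ.* (count C ℕ.+ length cs)
          ≡⟨ solve 4 (λ ℓ L U x → ℓ :* (L :* U) :+ L :* x := L :* (ℓ :* U :+ x)) refl ℓ L U (count C ℕ.+ length cs) ⟩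
        L ℕ.* (ℓ ℕ.* U ℕ.+ (count C ℕ.+ length cs)) ∎)
        where
        open ℕ.≤-Reasoning
        open +-*-Solver using (solve; con; _:+_; _:*_; _:=_)
        zeros-bound : ∑ elems zeros ≤ length cs
        zeros-bound = begin
          ∑ elems zeros ≡⟨ ∑-comm elems cs (λ x c → ⟦ c + x ≟ 0# ⟧) ⟩
          ∑ cs (λ c → ∑ elems (λ x → ⟦ c + x ≟ 0# ⟧)) ≤⟨ ∑-mono cs (λ {c} _ → count-zeros c) ⟩
          ∑ cs (λ _ → 1) ≡⟨ ∑-one cs ⟩
          length cs ∎

-- Intersections of two translates

module Pairs {q : ℕ} (F : FiniteField q) (d m : ℕ) .{{d≢0 : NonZero d}} .{{m≢0 : NonZero m}} (q≡ : q ≡ suc (d ℕ.* m)) where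
  open Field F
  open Conditions F
  private module SF = Algebra.Solver.Ring.NaturalCoefficients.Default commutativeSemiring

  G : List Carrier
  G = μ F m

  length-G : length G ≡ m
  length-G = length-μ F d m q≡

  pairs : Carrier → ℕ
  pairs t = ∑ G (λ x → ⟦ (t + x) ^ m ≟ 1# ⟧)

  ∈G-^m : ∀ {x} → x ∈ G → x ^ m ≡ 1#
  ∈G-^m = ∈μ⁻ F m

  count-equal : ∀ b → ∑ G (λ b′ → ⟦ b′ ≟ b ⟧) ≤ 1
  count-equal b = subst (_≤ 1) (length-filter-∑ (_≟ b) G)
    (length-⊆ {ys = b ∷ []} (filter⁺ (_≟ b) (μ-unique F m)) (λ {x} x∈ → here (proj₂ (∈-filter⁻ (_≟ b) {xs = G} x∈))))

  count-distinct : ∀ {b} → b ∈ G → suc (∑ G (λ b′ → ⟦ ¬? (b′ ≟ b) ⟧)) ≤ m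
  count-distinct {b} b∈ = subst₂ _≤_ (cong suc (length-filter-∑ P? G)) length-G
    (length-⊆ {ys = G} (All.tabulate (λ x∈ b≡x → proj₂ (∈-filter⁻ P? {xs = G} x∈) (sym b≡x)) ∷ filter⁺ P? (μ-unique F m))
      (λ { (here refl) → b∈ ; (there x∈) → proj₁ (∈-filter⁻ P? {xs = G} x∈) }))
    where P? = λ b′ → ¬? (b′ ≟ b)

  -- The variance of N x ζ, the number of b in G with (x + t b)^m = ζ, over all x and all d-th roots of unity ζ;
  -- the rows with x in G all contain the value pairs t.
  module _ (t : Carrier) (t≢0 : ¬ (t ≡ 0#)) where
    private
      Z : List Carrier
      Z = μ F d

      length-Z : length Z ≡ d
      length-Z = length-μ F m d (trans q≡ (cong suc (ℕ.*-comm d m)))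

      value : Carrier → Carrier → Carrier
      value b x = (x + t * b) ^ m

      N : Carrier → Carrier → ℕ
      N x ζ = ∑ G (λ b → ⟦ value b x ≟ ζ ⟧)

      value∈Z : ∀ b x → ¬ (t * b + x ≡ 0#) → value b x ∈ Z
      value∈Z b x h = ∈μ F d (trans (^-assocʳ (x + t * b) m d) (trans (cong ((x + t * b) ^_) (ℕ.*-comm m d))
        (fermat (x + t * b) (λ eq → h (trans (+-comm _ _) eq)) (d ℕ.* m) q≡)))

      first-moment : m ℕ.* (d ℕ.* m) ≤ ∑ elems (λ x → ∑ Z (N x))
      first-moment = begin
        m ℕ.* (d ℕ.* m) ≡⟨ trans (cong (ℕ._* (d ℕ.* m)) (sym length-G)) (sym (∑-const G _)) ⟩
        ∑ G (λ _ → d ℕ.* m) ≤⟨ ∑-mono G (λ {b} _ → ℕ.≤-pred (ℕ.≤-trans (ℕ.≤-reflexive (sym q≡)) (shifts b))) ⟩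
        ∑ G (λ b → ∑ elems (λ x → ∑ Z (λ ζ → ⟦ value b x ≟ ζ ⟧))) ≡⟨ ∑-comm G elems _ ⟩
        ∑ elems (λ x → ∑ G (λ b → ∑ Z (λ ζ → ⟦ value b x ≟ ζ ⟧))) ≡⟨ ∑-cong elems (λ _ → ∑-comm G Z _) ⟩
        ∑ elems (λ x → ∑ Z (N x)) ∎
        where
        open ℕ.≤-Reasoning
        shifts : ∀ b → q ≤ suc (∑ elems (λ x → ∑ Z (λ ζ → ⟦ value b x ≟ ζ ⟧)))
        shifts b = begin
          q ≡⟨ trans (sym length-elems) (sym (∑-one elems)) ⟩
          ∑ elems (λ _ → 1) ≤⟨ ∑-mono elems (λ {x} _ → covered x) ⟩
          ∑ elems (λ x → ⟦ t * b + x ≟ 0# ⟧ ℕ.+ ∑ Z (λ ζ → ⟦ value b x ≟ ζ ⟧)) ≡⟨ ∑-distrib-+ elems _ _ ⟩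
          ∑ elems (λ x → ⟦ t * b + x ≟ 0# ⟧) ℕ.+ ∑ elems (λ x → ∑ Z (λ ζ → ⟦ value b x ≟ ζ ⟧)) ≤⟨ ℕ.+-monoˡ-≤ _ (count-zeros (t * b)) ⟩
          suc (∑ elems (λ x → ∑ Z (λ ζ → ⟦ value b x ≟ ζ ⟧))) ∎
          where
          covered : ∀ x → 1 ≤ ⟦ t * b + x ≟ 0# ⟧ ℕ.+ ∑ Z (λ ζ → ⟦ value b x ≟ ζ ⟧)
          covered x with t * b + x ≟ 0#
          ... | yes _ = s≤s z≤n
          ... | no h = ℕ.≤-trans (ℕ.≤-reflexive (sym (⟦⟧-yes (value b x ≟ value b x) refl))) (term≤∑ (λ ζ → ⟦ value b x ≟ ζ ⟧) (value∈Z b x h))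

      Coincide? : ∀ b b′ x → Dec (value b x ≡ value b′ x × ¬ (value b x ≡ 0#))
      Coincide? b b′ x = (value b x ≟ value b′ x) ×-dec ¬? (value b x ≟ 0#)

      correlation : Carrier → Carrier → ℕ
      correlation b b′ = ∑ elems (λ x → ⟦ Coincide? b b′ x ⟧)

      second-moment-expand : ∑ elems (λ x → ∑ Z (λ ζ → N x ζ ℕ.* N x ζ)) ≤ ∑ G (λ b → ∑ G (correlation b))
      second-moment-expand = begin
        ∑ elems (λ x → ∑ Z (λ ζ → N x ζ ℕ.* N x ζ))
          ≡⟨ ∑-cong elems (λ {x} _ → ∑-cong Z (λ {ζ} _ → ∑-* G G (λ b → ⟦ value b x ≟ ζ ⟧) (λ b → ⟦ value b x ≟ ζ ⟧))) ⟩
        ∑ elems (λ x → ∑ Z (λ ζ → ∑ G (λ b → ∑ G (λ b′ → ⟦ value b x ≟ ζ ⟧ ℕ.* ⟦ value b′ x ≟ ζ ⟧))))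
          ≡⟨ ∑-cong elems (λ {x} _ → trans (∑-comm Z G _) (∑-cong G (λ {b} _ → ∑-comm Z G _))) ⟩
        ∑ elems (λ x → ∑ G (λ b → ∑ G (λ b′ → ∑ Z (λ ζ → ⟦ value b x ≟ ζ ⟧ ℕ.* ⟦ value b′ x ≟ ζ ⟧))))
          ≤⟨ ∑-mono elems (λ {x} _ → ∑-mono G (λ {b} _ → ∑-mono G (λ {b′} _ → common x b b′))) ⟩
        ∑ elems (λ x → ∑ G (λ b → ∑ G (λ b′ → ⟦ Coincide? b b′ x ⟧)))
          ≡⟨ trans (∑-comm elems G _) (∑-cong G (λ {b} _ → ∑-comm elems G _)) ⟩
        ∑ G (λ b → ∑ G (correlation b)) ∎
        where
        open ℕ.≤-Reasoning
        common : ∀ x b b′ → ∑ Z (λ ζ → ⟦ value b x ≟ ζ ⟧ ℕ.* ⟦ value b′ x ≟ ζ ⟧) ≤ ⟦ Coincide? b b′ x ⟧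
        common x b b′ = begin
          ∑ Z (λ ζ → ⟦ value b x ≟ ζ ⟧ ℕ.* ⟦ value b′ x ≟ ζ ⟧) ≤⟨ ∑-mono Z (λ {ζ} ζ∈ → both ζ ζ∈) ⟩
          ∑ Z (λ ζ → ⟦ Coincide? b b′ x ⟧ ℕ.* ⟦ ζ ≟ value b x ⟧) ≡⟨ ∑-*ˡ Z ⟦ Coincide? b b′ x ⟧ _ ⟩
          ⟦ Coincide? b b′ x ⟧ ℕ.* ∑ Z (λ ζ → ⟦ ζ ≟ value b x ⟧) ≤⟨ ℕ.*-monoʳ-≤ ⟦ Coincide? b b′ x ⟧ single ⟩
          ⟦ Coincide? b b′ x ⟧ ℕ.* 1 ≡⟨ ℕ.*-identityʳ _ ⟩
          ⟦ Coincide? b b′ x ⟧ ∎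
          where
          single : ∑ Z (λ ζ → ⟦ ζ ≟ value b x ⟧) ≤ 1
          single = subst (_≤ 1) (length-filter-∑ (_≟ value b x) Z)
            (length-⊆ {ys = value b x ∷ []} (filter⁺ (_≟ value b x) (μ-unique F d)) (λ {z} z∈ → here (proj₂ (∈-filter⁻ (_≟ value b x) {xs = Z} z∈))))
          both : ∀ ζ → ζ ∈ Z → ⟦ value b x ≟ ζ ⟧ ℕ.* ⟦ value b′ x ≟ ζ ⟧ ≤ ⟦ Coincide? b b′ x ⟧ ℕ.* ⟦ ζ ≟ value b x ⟧
          both ζ ζ∈ with value b x ≟ ζ | value b′ x ≟ ζ
          ... | no _   | _      = z≤n
          ... | yes _  | no _   = z≤n
          ... | yes eq | yes eq′ = ℕ.≤-reflexive (sym (cong₂ ℕ._*_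
                (⟦⟧-yes (Coincide? b b′ x) (trans eq (sym eq′) , λ v≡0 → unity≢0 F d (∈μ⁻ F d ζ∈) (trans (sym eq) v≡0)))
                (⟦⟧-yes (ζ ≟ value b x) (sym eq))))

      0^m≡0 : ∀ M .{{_ : NonZero M}} → 0# ^ M ≡ 0#
      0^m≡0 (suc M) = 0^1+n M

      correlation-diagonal : ∀ b → correlation b b ≤ d ℕ.* m
      correlation-diagonal b = ℕ.≤-pred (ℕ.≤-trans (ℕ.≤-reflexive (trans (cong suc (sym (length-filter-∑ (Coincide? b b) elems))) refl))
        (ℕ.≤-trans (length-⊆ {ys = elems} (All.tabulate (λ {x} x∈ eq → excluded x x∈ eq) ∷ filter⁺ (Coincide? b b) elems-unique) (λ {x} _ → ∈elems x))
          (ℕ.≤-reflexive (trans length-elems q≡))))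
        where
        excluded : ∀ x → x ∈ filter (Coincide? b b) elems → ¬ (0# - t * b ≡ x)
        excluded x x∈ refl = proj₂ (proj₂ (∈-filter⁻ (Coincide? b b) {xs = elems} x∈))
          (trans (cong (_^ m) (trans (+-comm _ _) (shift-cancel (t * b) 0#))) (0^m≡0 m))

      -- The map `x ↦ (x + t b)/(x + t b′)` is an injective Möbius transformation. It sends
      -- coincidences into `G`, and it never takes the value 1, which accounts for the `suc`.
      correlation-off-diagonal : ∀ {b b′} → ¬ (b′ ≡ b) → suc (correlation b b′) ≤ m
      correlation-off-diagonal {b} {b′} b≢b′ = ℕ.≤-trans
          (s≤s (ℕ.≤-trans (ℕ.≤-reflexive (sym (length-filter-∑ (Coincide? b b′) elems)))
            (ℕ.≤-trans (length-injection ratio injective (filter⁺ (Coincide? b b′) elems-unique) (λ {x} x∈ → into x∈))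
              (ℕ.≤-reflexive (length-filter-∑ (λ y → ¬? (y ≟ 1#)) G)))))
          (count-distinct (∈μ F m (1^n m)))
        where
        nonzero′ : ∀ {x} → x ∈ filter (Coincide? b b′) elems → ¬ (x + t * b′ ≡ 0#)
        nonzero′ {x} x∈ eq = let (eqv , v≢0) = proj₂ (∈-filter⁻ (Coincide? b b′) {xs = elems} x∈)
                             in v≢0 (trans eqv (trans (cong (_^ m) eq) (0^m≡0 m)))
        ratio : Carrier → Carrier
        ratio x with x + t * b′ ≟ 0#
        ... | yes _ = 0#
        ... | no  h = (x + t * b) * proj₁ (inverse _ h)
        ratio-eq : ∀ {x} → ¬ (x + t * b′ ≡ 0#) → ratio x * (x + t * b′) ≡ x + t * b
        ratio-eq {x} h with x + t * b′ ≟ 0#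
        ... | yes eq = contradiction eq h
        ... | no h′ = trans (*-assoc _ _ _) (trans (cong ((x + t * b) *_) (trans (*-comm _ _) (proj₂ (inverse _ h′)))) (*-identityʳ _))
        ratio≢1 : ∀ {x} → ¬ (x + t * b′ ≡ 0#) → ¬ (ratio x ≡ 1#)
        ratio≢1 {x} h eq = b≢b′ (*-cancelˡ t≢0 (+-cancelˡ x _ _
          (trans (sym (*-identityˡ _)) (trans (cong (_* (x + t * b′)) (sym eq)) (ratio-eq h)))))
        into : ∀ {x} → x ∈ filter (Coincide? b b′) elems → ratio x ∈ filter (λ y → ¬? (y ≟ 1#)) G
        into {x} x∈ = ∈-filter⁺ (λ y → ¬? (y ≟ 1#)) (∈μ F m ratio^m) (ratio≢1 (nonzero′ x∈))
          where
          eqv = proj₁ (proj₂ (∈-filter⁻ (Coincide? b b′) {xs = elems} x∈))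
          ratio^m : ratio x ^ m ≡ 1#
          ratio^m = *-cancelʳ (x^n≢0 m (nonzero′ x∈)) (trans (sym (^-distrib-* (ratio x) (x + t * b′) m))
            (trans (cong (_^ m) (ratio-eq (nonzero′ x∈))) (trans eqv (sym (*-identityˡ _)))))
        injective : ∀ {x z} → x ∈ filter (Coincide? b b′) elems → z ∈ filter (Coincide? b b′) elems → ratio x ≡ ratio z → x ≡ z
        injective {x} {z} x∈ z∈ eq with x - z ≟ 0#
        ... | yes h = x∙y⁻¹≈ε⇒x≈y x z h
        ... | no δ≢0 = contradiction (*-cancelʳ δ≢0 (trans (sym fixed) (sym (*-identityˡ δ)))) (ratio≢1 (nonzero′ x∈))
          where
          open ≡-Reasoning
          δ = x - z
          y = ratio x
          x≡ : x ≡ z + δ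
          x≡ = sym (shift-cancel z x)
          cross : (z + δ + t * b) + y * (z + t * b′) ≡ (z + t * b) + y * (z + δ + t * b′)
          cross = begin
            (z + δ + t * b) + y * (z + t * b′) ≡⟨ cong₂ (λ u v → (u + t * b) + v * (z + t * b′)) (sym x≡) eq ⟩
            (x + t * b) + ratio z * (z + t * b′) ≡⟨ cong₂ _+_ (sym (ratio-eq (nonzero′ x∈))) (ratio-eq (nonzero′ z∈)) ⟩
            y * (x + t * b′) + (z + t * b) ≡⟨ +-comm _ _ ⟩
            (z + t * b) + y * (x + t * b′) ≡⟨ cong (λ u → (z + t * b) + y * (u + t * b′)) x≡ ⟩
            (z + t * b) + y * (z + δ + t * b′) ∎
          fixed : δ ≡ y * δ
          fixed = +-cancelˡ (z + t * b + y * (z + t * b′)) _ _ (begin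
            z + t * b + y * (z + t * b′) + δ ≡⟨ SF.solve 4 (λ z s u δ → z SF.:+ s SF.:+ u SF.:+ δ SF.:= z SF.:+ δ SF.:+ s SF.:+ u) refl z (t * b) (y * (z + t * b′)) δ ⟩
            (z + δ + t * b) + y * (z + t * b′) ≡⟨ cross ⟩
            (z + t * b) + y * (z + δ + t * b′) ≡⟨ SF.solve 5 (λ z s y δ s′ → z SF.:+ s SF.:+ y SF.:* (z SF.:+ δ SF.:+ s′) SF.:= z SF.:+ s SF.:+ y SF.:* (z SF.:+ s′) SF.:+ y SF.:* δ) refl z (t * b) y δ (t * b′) ⟩
            z + t * b + y * (z + t * b′) + y * δ ∎)

      -- For `b` in `G` one has `x + t b = b (t + x/b)`, and `b ↦ x/b` is an involution of `G`. The
      -- quotient is written `x b^(m-1)`, since `b^m = 1`.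
      N-1 : ∀ {x} → x ∈ G → N x 1# ≡ pairs t
      N-1 {x} x∈ = trans (∑-cong G (λ {b} b∈ → cong (λ z → ⟦ z ≟ 1# ⟧) (swap-value b∈)))
          (ℕ.≤-antisym (∑-injection φ f φ-injective (μ-unique F m) φ∈)
            (ℕ.≤-trans (ℕ.≤-reflexive (∑-cong G (λ {z} z∈ → cong f (sym (φ-involutive z∈)))))
              (∑-injection φ (f ∘ φ) φ-injective (μ-unique F m) φ∈)))
        where
        open ≡-Reasoning
        f : Carrier → ℕ
        f z = ⟦ (t + z) ^ m ≟ 1# ⟧
        φ : Carrier → Carrier
        φ b = x * b ^ ℕ.pred m
        b*φb : ∀ {b} → b ∈ G → b * φ b ≡ x
        b*φb {b} b∈ = begin
          b * (x * b ^ ℕ.pred m) ≡⟨ SF.solve 3 (λ b x p → b SF.:* (x SF.:* p) SF.:= x SF.:* (b SF.:* p)) refl b x (b ^ ℕ.pred m) ⟩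
          x * b ^ suc (ℕ.pred m) ≡⟨ cong (λ z → x * b ^ z) (ℕ.suc-pred m) ⟩
          x * b ^ m ≡⟨ cong (x *_) (∈G-^m b∈) ⟩
          x * 1# ≡⟨ *-identityʳ x ⟩
          x ∎
        b≢0 : ∀ {b} → b ∈ G → ¬ (b ≡ 0#)
        b≢0 b∈ = unity≢0 F m (∈G-^m b∈)
        φ∈ : ∀ {b} → b ∈ G → φ b ∈ G
        φ∈ {b} b∈ = ∈μ F m (begin
          φ b ^ m ≡⟨ *-identityˡ _ ⟨
          1# * φ b ^ m ≡⟨ cong (_* φ b ^ m) (∈G-^m b∈) ⟨
          b ^ m * φ b ^ m ≡⟨ ^-distrib-* b (φ b) m ⟨
          (b * φ b) ^ m ≡⟨ cong (_^ m) (b*φb b∈) ⟩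
          x ^ m ≡⟨ ∈G-^m x∈ ⟩
          1# ∎)
        φ-involutive : ∀ {b} → b ∈ G → φ (φ b) ≡ b
        φ-involutive {b} b∈ = *-cancelˡ (b≢0 (φ∈ b∈)) (trans (b*φb (φ∈ b∈)) (trans (sym (b*φb b∈)) (*-comm b (φ b))))
        φ-injective : ∀ {b b′} → b ∈ G → b′ ∈ G → φ b ≡ φ b′ → b ≡ b′
        φ-injective b∈ b′∈ eq = trans (sym (φ-involutive b∈)) (trans (cong φ eq) (φ-involutive b′∈))
        swap-value : ∀ {b} → b ∈ G → value b x ≡ (t + φ b) ^ m
        swap-value {b} b∈ = begin
          (x + t * b) ^ m ≡⟨ cong (λ z → (z + t * b) ^ m) (b*φb b∈) ⟨
          (b * φ b + t * b) ^ m ≡⟨ cong (_^ m) (SF.solve 3 (λ b p t → b SF.:* p SF.:+ t SF.:* b SF.:= b SF.:* (t SF.:+ p)) refl b (φ b) t) ⟩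
          (b * (t + φ b)) ^ m ≡⟨ ^-distrib-* b (t + φ b) m ⟩
          b ^ m * (t + φ b) ^ m ≡⟨ cong (_* (t + φ b) ^ m) (∈G-^m b∈) ⟩
          1# * (t + φ b) ^ m ≡⟨ *-identityˡ _ ⟩
          (t + φ b) ^ m ∎

      off : ℕ
      off = ℕ.pred m

      second-moment : ∑ elems (λ x → ∑ Z (λ ζ → N x ζ ℕ.* N x ζ)) ≤ m ℕ.* (d ℕ.* m ℕ.+ off ℕ.* off)
      second-moment = ℕ.≤-trans second-moment-expand (begin
        ∑ G (λ b → ∑ G (correlation b)) ≤⟨ ∑-mono G (λ {b} b∈ → row b∈) ⟩
        ∑ G (λ _ → d ℕ.* m ℕ.+ off ℕ.* off) ≡⟨ trans (∑-const G _) (cong (ℕ._* (d ℕ.* m ℕ.+ off ℕ.* off)) length-G) ⟩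
        m ℕ.* (d ℕ.* m ℕ.+ off ℕ.* off) ∎)
        where
        open ℕ.≤-Reasoning
        entry : ∀ b b′ → correlation b b′ ≤ ⟦ b′ ≟ b ⟧ ℕ.* (d ℕ.* m) ℕ.+ ⟦ ¬? (b′ ≟ b) ⟧ ℕ.* off
        entry b b′ with b′ ≟ b
        ... | yes refl = ℕ.≤-trans (correlation-diagonal b) (ℕ.≤-reflexive (sym (trans (ℕ.+-identityʳ _) (ℕ.+-identityʳ _))))
        ... | no b≢b′ = ℕ.≤-trans (ℕ.≤-pred (ℕ.≤-trans (correlation-off-diagonal b≢b′) (ℕ.≤-reflexive (sym (ℕ.suc-pred m))))) (ℕ.≤-reflexive (sym (ℕ.+-identityʳ off)))
        row : ∀ {b} → b ∈ G → ∑ G (correlation b) ≤ d ℕ.* m ℕ.+ off ℕ.* off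
        row {b} b∈ = begin
          ∑ G (correlation b) ≤⟨ ∑-mono G (λ {b′} _ → entry b b′) ⟩
          ∑ G (λ b′ → ⟦ b′ ≟ b ⟧ ℕ.* (d ℕ.* m) ℕ.+ ⟦ ¬? (b′ ≟ b) ⟧ ℕ.* off) ≡⟨ trans (∑-distrib-+ G _ _) (cong₂ ℕ._+_ (∑-*ʳ G _ _) (∑-*ʳ G _ _)) ⟩
          ∑ G (λ b′ → ⟦ b′ ≟ b ⟧) ℕ.* (d ℕ.* m) ℕ.+ ∑ G (λ b′ → ⟦ ¬? (b′ ≟ b) ⟧) ℕ.* off ≤⟨ ℕ.+-mono-≤ (ℕ.*-monoˡ-≤ (d ℕ.* m) (count-equal b))
              (ℕ.*-monoˡ-≤ off (ℕ.≤-pred (ℕ.≤-trans (count-distinct b∈) (ℕ.≤-reflexive (sym (ℕ.suc-pred m)))))) ⟩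
          1 ℕ.* (d ℕ.* m) ℕ.+ off ℕ.* off ≡⟨ cong (ℕ._+ off ℕ.* off) (ℕ.*-identityˡ (d ℕ.* m)) ⟩
          d ℕ.* m ℕ.+ off ℕ.* off ∎

      deviation : Carrier → Carrier → ℕ
      deviation x ζ = ∣ d ℕ.* N x ζ - m ∣ ℕ.* ∣ d ℕ.* N x ζ - m ∣

      -- The expansion of the sum of `(d N - m)²`, with the mixed term kept on the left to avoid
      -- subtraction. Up to a small error `m/d` is the mean of `N`.
      total-deviation : ∑ elems (λ x → ∑ Z (deviation x)) ℕ.+ 2 ℕ.* (d ℕ.* m) ℕ.* ∑ elems (λ x → ∑ Z (N x))
                        ≡ d ℕ.* d ℕ.* ∑ elems (λ x → ∑ Z (λ ζ → N x ζ ℕ.* N x ζ)) ℕ.+ q ℕ.* (d ℕ.* (m ℕ.* m))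
      total-deviation = begin
        ∑ elems (λ x → ∑ Z (deviation x)) ℕ.+ 2 ℕ.* (d ℕ.* m) ℕ.* ∑ elems (λ x → ∑ Z (N x))
          ≡⟨ cong (∑ elems (λ x → ∑ Z (deviation x)) ℕ.+_) (trans (sym (∑-*ˡ elems (2 ℕ.* (d ℕ.* m)) (λ x → ∑ Z (N x)))) (∑-cong elems (λ {x} _ → sym (∑-*ˡ Z (2 ℕ.* (d ℕ.* m)) (N x))))) ⟩
        ∑ elems (λ x → ∑ Z (deviation x)) ℕ.+ ∑ elems (λ x → ∑ Z (λ ζ → 2 ℕ.* (d ℕ.* m) ℕ.* N x ζ))
          ≡⟨ trans (sym (∑-distrib-+ elems _ _)) (∑-cong elems (λ {x} _ → sym (∑-distrib-+ Z _ _))) ⟩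
        ∑ elems (λ x → ∑ Z (λ ζ → deviation x ζ ℕ.+ 2 ℕ.* (d ℕ.* m) ℕ.* N x ζ))
          ≡⟨ ∑-cong elems (λ {x} _ → ∑-cong Z (λ {ζ} _ → square (N x ζ))) ⟩
        ∑ elems (λ x → ∑ Z (λ ζ → d ℕ.* d ℕ.* (N x ζ ℕ.* N x ζ) ℕ.+ m ℕ.* m))
          ≡⟨ trans (∑-cong elems (λ {x} _ → trans (∑-distrib-+ Z _ _) (cong₂ ℕ._+_ (∑-*ˡ Z (d ℕ.* d) (λ ζ → N x ζ ℕ.* N x ζ)) (trans (∑-const Z _) (cong (ℕ._* (m ℕ.* m)) length-Z)))))
               (trans (∑-distrib-+ elems _ _) (cong₂ ℕ._+_ (∑-*ˡ elems (d ℕ.* d) (λ x → ∑ Z (λ ζ → N x ζ ℕ.* N x ζ))) (trans (∑-const elems _) (cong (ℕ._* (d ℕ.* (m ℕ.* m))) length-elems)))) ⟩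
        d ℕ.* d ℕ.* ∑ elems (λ x → ∑ Z (λ ζ → N x ζ ℕ.* N x ζ)) ℕ.+ q ℕ.* (d ℕ.* (m ℕ.* m)) ∎
        where
        open ≡-Reasoning
        open +-*-Solver using (solve; con; _:+_; _:*_; _:=_)
        square : ∀ n → ∣ d ℕ.* n - m ∣ ℕ.* ∣ d ℕ.* n - m ∣ ℕ.+ 2 ℕ.* (d ℕ.* m) ℕ.* n ≡ d ℕ.* d ℕ.* (n ℕ.* n) ℕ.+ m ℕ.* m
        square n = trans (cong (∣ d ℕ.* n - m ∣ ℕ.* ∣ d ℕ.* n - m ∣ ℕ.+_) (solve 3 (λ d m n → con 2 :* (d :* m) :* n := con 2 :* (d :* n :* m)) refl d m n))
          (trans (∣-∣-square (d ℕ.* n) m) (cong (ℕ._+ m ℕ.* m) (solve 2 (λ d n → d :* n :* (d :* n) := d :* d :* (n :* n)) refl d n)))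

      D : ℕ
      D = ∣ d ℕ.* pairs t - m ∣

      D-bound : m ℕ.* (D ℕ.* D) ≤ ∑ elems (λ x → ∑ Z (deviation x))
      D-bound = begin
        m ℕ.* (D ℕ.* D) ≡⟨ trans (cong (ℕ._* (D ℕ.* D)) (sym length-G)) (sym (∑-const G _)) ⟩
        ∑ G (λ _ → D ℕ.* D) ≡⟨ ∑-cong G (λ x∈ → cong (λ z → ∣ d ℕ.* z - m ∣ ℕ.* ∣ d ℕ.* z - m ∣) (sym (N-1 x∈))) ⟩
        ∑ G (λ x → deviation x 1#) ≤⟨ ∑-mono G (λ {x} _ → term≤∑ (deviation x) (∈μ F d (1^n d))) ⟩
        ∑ G (λ x → ∑ Z (deviation x)) ≤⟨ ∑-⊆ _ (μ-unique F m) (λ {x} _ → ∈elems x) ⟩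
        ∑ elems (λ x → ∑ Z (deviation x)) ∎
        where open ℕ.≤-Reasoning

    -- The square `D²` occurs `m` times in the total deviation. With both moments inserted the terms
    -- of size `d² m³` cancel and at most `d³ m²` is left.
    pair-bound : ∣ d ℕ.* pairs t - m ∣ ℕ.* ∣ d ℕ.* pairs t - m ∣ ≤ d ℕ.* d ℕ.* d ℕ.* m
    pair-bound = ℕ.*-cancelˡ-≤ m (ℕ.+-cancelʳ-≤ (2 ℕ.* (d ℕ.* m) ℕ.* (m ℕ.* (d ℕ.* m))) _ _ (begin
      m ℕ.* (D ℕ.* D) ℕ.+ 2 ℕ.* (d ℕ.* m) ℕ.* (m ℕ.* (d ℕ.* m))
        ≤⟨ ℕ.+-mono-≤ D-bound (ℕ.*-monoʳ-≤ (2 ℕ.* (d ℕ.* m)) first-moment) ⟩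
      ∑ elems (λ x → ∑ Z (deviation x)) ℕ.+ 2 ℕ.* (d ℕ.* m) ℕ.* ∑ elems (λ x → ∑ Z (N x))
        ≡⟨ total-deviation ⟩
      d ℕ.* d ℕ.* ∑ elems (λ x → ∑ Z (λ ζ → N x ζ ℕ.* N x ζ)) ℕ.+ q ℕ.* (d ℕ.* (m ℕ.* m))
        ≤⟨ ℕ.+-mono-≤ (ℕ.*-monoʳ-≤ (d ℕ.* d) second-moment) (ℕ.≤-reflexive (cong (ℕ._* (d ℕ.* (m ℕ.* m))) q≡)) ⟩
      d ℕ.* d ℕ.* (m ℕ.* (d ℕ.* m ℕ.+ off ℕ.* off)) ℕ.+ suc (d ℕ.* m) ℕ.* (d ℕ.* (m ℕ.* m))
        ≤⟨ arithmetic d m ⟩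
      m ℕ.* (d ℕ.* d ℕ.* d ℕ.* m) ℕ.+ 2 ℕ.* (d ℕ.* m) ℕ.* (m ℕ.* (d ℕ.* m)) ∎))
      where
      open ℕ.≤-Reasoning
      arithmetic : ∀ d m .{{_ : NonZero d}} .{{_ : NonZero m}} →
                   d ℕ.* d ℕ.* (m ℕ.* (d ℕ.* m ℕ.+ ℕ.pred m ℕ.* ℕ.pred m)) ℕ.+ suc (d ℕ.* m) ℕ.* (d ℕ.* (m ℕ.* m))
                   ≤ m ℕ.* (d ℕ.* d ℕ.* d ℕ.* m) ℕ.+ 2 ℕ.* (d ℕ.* m) ℕ.* (m ℕ.* (d ℕ.* m))
      arithmetic (suc d) (suc m) = subst (lhs ≤_) (solve 2 (λ d m →
            ((con 1 :+ d) :* (con 1 :+ d) :* ((con 1 :+ m) :* ((con 1 :+ d) :* (con 1 :+ m) :+ m :* m)) :+ (con 1 :+ (con 1 :+ d) :* (con 1 :+ m)) :* ((con 1 :+ d) :* ((con 1 :+ m) :* (con 1 :+ m))))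
            :+ (con 1 :+ d) :* (con 1 :+ m) :* (m :* (con 1 :+ d) :+ d :* (con 1 :+ m))
            := (con 1 :+ m) :* ((con 1 :+ d) :* (con 1 :+ d) :* (con 1 :+ d) :* (con 1 :+ m)) :+ con 2 :* ((con 1 :+ d) :* (con 1 :+ m)) :* ((con 1 :+ m) :* ((con 1 :+ d) :* (con 1 :+ m)))) refl d m)
          (ℕ.m≤m+n lhs _)
        where
        open +-*-Solver using (solve; con; _:+_; _:*_; _:=_)
        lhs = suc d ℕ.* suc d ℕ.* (suc m ℕ.* (suc d ℕ.* suc m ℕ.+ m ℕ.* m)) ℕ.+ suc (suc d ℕ.* suc m) ℕ.* (suc d ℕ.* (suc m ℕ.* suc m))

-- Intersections of several translates

module _ {q : ℕ} (F : FiniteField q) (pp : IsPrimePower q) (K d r : ℕ)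
         (12Kd≤r : 12 ℕ.* (K ℕ.* d) ≤ r) (r²≤q : r ℕ.* r ≤ q) (q<[r+1]² : q < suc r ℕ.* suc r) where
  open Field F
  open StepanovMethod F
  open Conditions F

  private
    -- The auxiliary polynomial is built at the root 0, so the distinguished root is moved there
    -- first.
    translate : Carrier → Factors → Factors
    translate c₀ = map (λ ce → proj₁ ce - c₀ , proj₂ ce)

    translated-root : ∀ c₀ c x → (c - c₀) + (c₀ + x) ≡ c + x
    translated-root c₀ c x = trans (sym (+-assoc (c - c₀) c₀ x)) (cong (_+ x) (trans (+-comm _ c₀) (shift-cancel c₀ c)))

    product-translate : ∀ c₀ fs x → product (translate c₀ fs) (c₀ + x) ≡ product fs x
    product-translate c₀ []             x = refl
    product-translate c₀ ((c , e) ∷ fs) x = cong₂ _*_ (cong (_^ e) (translated-root c₀ c x)) (product-translate c₀ fs x)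

    degree-bound : ∀ c₀ n fs → All (λ ce → proj₂ ce ≤ n) fs → degree (translate c₀ fs) ≤ length fs ℕ.* n
    degree-bound c₀ n []       []      = z≤n
    degree-bound c₀ n (_ ∷ fs) (h ∷ t) = ℕ.+-mono-≤ h (degree-bound c₀ n fs t)

  value-bound : ∀ n m {{_ : NonZero n}} {{_ : NonZero m}} → q ≡ suc (n ℕ.* m) → n ≤ d → ∀ c₀ fs →
                All (λ ce → ¬ (proj₁ ce ≡ c₀)) fs → All (λ ce → proj₂ ce ≤ n) fs → length fs < K → ∀ ζ →
                ∑ elems (λ x → ⟦ hasValue? ((c₀ , 1) ∷ fs) m ζ x ⟧) ≤ m ℕ.+ 64 ℕ.* (K ℕ.* d ℕ.* r)
  value-bound n m refl n≤d c₀ fs distinct exponents fs<K ζ = begin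
      ∑ elems (λ x → ⟦ hasValue? fs₀ m ζ x ⟧) ≡⟨ length-filter-∑ (hasValue? fs₀ m ζ) elems ⟨
      length V ≡⟨ length-map (c₀ +_) V ⟨
      length (map (c₀ +_) V) ≤⟨ Pa.conclusion (ℕ.<-≤-trans
          (A.stepanov Pa.J (n ℕ.* I) Pa.M≤q (subst (λ κ → n ℕ.* I ℕ.* (m ℕ.+ Pa.J ℕ.+ κ ℕ.* (n ℕ.* I)) < n ℕ.* Pa.J ℕ.* m) (sym (length-map _ fs)) Pa.few-equations)
          (map (c₀ +_) V) (unique-map (λ _ _ → +-cancelˡ c₀ _ _) (filter⁺ (hasValue? fs₀ m ζ) elems-unique)) valid)
          (ℕ.+-monoʳ-≤ m (ℕ.*-monoʳ-≤ (suc (n ℕ.* m)) (ℕ.+-monoʳ-≤ Pa.J degree≤)))) ⟩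
      m ℕ.+ 64 ℕ.* (K ℕ.* d ℕ.* r) ∎
    where
    open ℕ.≤-Reasoning
    fs₀ = (c₀ , 1) ∷ fs
    V = filter (hasValue? fs₀ m ζ) elems
    f = r / n
    5K≤f : 5 ℕ.* K ≤ f
    5K≤f = ℕ.≮⇒≥ (λ f<5K → ℕ.<⇒≱ (begin-strict
      r ≡⟨ m≡m%n+[m/n]*n r n ⟩
      r % n ℕ.+ f ℕ.* n <⟨ ℕ.+-monoˡ-< (f ℕ.* n) (m%n<n r n) ⟩
      suc f ℕ.* n ≤⟨ ℕ.*-monoˡ-≤ n f<5K ⟩
      5 ℕ.* K ℕ.* n ≤⟨ ℕ.*-monoˡ-≤ n (ℕ.*-monoˡ-≤ K {5} {12} (ℕ.m≤m+n 5 7)) ⟩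
      12 ℕ.* K ℕ.* n ≡⟨ ℕ.*-assoc 12 K n ⟩
      12 ℕ.* (K ℕ.* n) ∎) (ℕ.≤-trans (ℕ.*-monoʳ-≤ 12 (ℕ.*-monoʳ-≤ K n≤d)) 12Kd≤r))
    -- The largest `J` with `n J ≤ r` is `f`, and `5K≤f` makes this truncated subtraction exact.
    I = f ∸ 5 ℕ.* K
    J≡f : I ℕ.+ 5 ℕ.* K ≡ f
    J≡f = ℕ.m∸n+n≡m 5K≤f
    nJ≤r : n ℕ.* (I ℕ.+ 5 ℕ.* K) ≤ r
    nJ≤r = subst (λ z → n ℕ.* z ≤ r) (sym J≡f) (ℕ.≤-trans (ℕ.≤-reflexive (ℕ.*-comm n f)) (m/n*n≤m r n))
    r<nJ+n : r < n ℕ.* (I ℕ.+ 5 ℕ.* K) ℕ.+ n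
    r<nJ+n = subst (λ z → r < n ℕ.* z ℕ.+ n) (sym J≡f) (begin-strict
      r ≡⟨ m≡m%n+[m/n]*n r n ⟩
      r % n ℕ.+ f ℕ.* n <⟨ ℕ.+-monoˡ-< (f ℕ.* n) (m%n<n r n) ⟩
      n ℕ.+ f ℕ.* n ≡⟨ trans (ℕ.+-comm n _) (cong (ℕ._+ n) (ℕ.*-comm f n)) ⟩
      n ℕ.* f ℕ.+ n ∎)
    module Pa = Parameters n m K d r (length fs) I fs<K n≤d 12Kd≤r r²≤q q<[r+1]² nJ≤r r<nJ+n
    translated≢0 : All (λ ce → ¬ (proj₁ ce ≡ 0#)) (translate c₀ fs)
    translated≢0 = All.map⁺ (All.map (λ {ce} ne eq → ne (x∙y⁻¹≈ε⇒x≈y (proj₁ ce) c₀ eq)) distinct)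
    module A = Auxiliary F pp n m refl (translate c₀ fs) translated≢0 ζ
    degree≤ : degree A.fs ≤ K ℕ.* n
    degree≤ = begin
      1 ℕ.+ degree (translate c₀ fs) ≤⟨ ℕ.+-mono-≤ (ℕ.>-nonZero⁻¹ n) (degree-bound c₀ n fs exponents) ⟩
      n ℕ.+ length fs ℕ.* n ≤⟨ ℕ.*-monoˡ-≤ n fs<K ⟩
      K ℕ.* n ∎
    valid : ∀ {a} → a ∈ map (c₀ +_) V → All (λ ce → ¬ (proj₁ ce + a ≡ 0#)) A.fs × product A.fs a ^ m ≡ ζ
    valid a∈ with ∈-map⁻ (c₀ +_) a∈
    ... | x , x∈ , refl with proj₂ (∈-filter⁻ (hasValue? fs₀ m ζ) {xs = elems} x∈)
    ... | c₀+x≢0 ∷ nz , eq =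
      (λ z → c₀+x≢0 (trans (sym (+-identityˡ _)) z)) ∷ All.map⁺ (All.map (λ {ce} ne z → ne (trans (sym (translated-root c₀ (proj₁ ce) x)) z)) nz) ,
      trans (cong (_^ m) (cong₂ _*_ (cong (_^ 1) (+-identityˡ (c₀ + x))) (product-translate c₀ fs x))) eq

module MultifoldIntersections {q : ℕ} (F : FiniteField q) (pp : IsPrimePower q) (K d r : ℕ)
         (12Kd≤r : 12 ℕ.* (K ℕ.* d) ≤ r) (r²≤q : r ℕ.* r ≤ q) (q<[r+1]² : q < suc r ℕ.* suc r) where
  open Field F
  open Conditions F

  Err δ : ℕ
  Err = 64 ℕ.* (K ℕ.* d ℕ.* r)
  δ = Err ℕ.+ K

  -- Sharpening the condition at `c₀` from exponent `m ℓ` to `m` divides the count by `ℓ`, up to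
  -- `δ`. The case `n′ = 1` treats all conditions alike; `n′ = 2` is the mixture of fourth powers
  -- and squares.
  count-step : ∀ ℓ → Prime ℓ → ∀ n′ m {{_ : NonZero n′}} {{_ : NonZero m}} → q ≡ suc (n′ ℕ.* (m ℕ.* ℓ)) → n′ ℕ.* ℓ ≤ d →
               ∀ c₀ cs → All (λ c → ¬ (c₀ ≡ c)) cs → length cs < K →
               ℓ ℕ.* count ((c₀ , m) ∷ map (_, n′ ℕ.* m) cs) ≤ count ((c₀ , m ℕ.* ℓ) ∷ map (_, n′ ℕ.* m) cs) ℕ.+ ℓ ℕ.* δ
  count-step ℓ ℓ-prime n′ m q≡ n′ℓ≤d c₀ cs distinct cs<K = ℕ.+-cancelʳ-≤ (m ℕ.* ℓ) _ _ (begin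
    ℓ ℕ.* cA ℕ.+ m ℕ.* ℓ ≤⟨ averaging ℓ ℓ-prime n′ m q≡ c₀ cs bound ⟩
    ℓ ℕ.* (m ℕ.+ Err) ℕ.+ (cC ℕ.+ length cs) ≤⟨ ℕ.+-monoʳ-≤ (ℓ ℕ.* (m ℕ.+ Err)) (ℕ.+-monoʳ-≤ cC (ℕ.≤-trans (ℕ.<⇒≤ cs<K) (ℕ.m≤n*m K ℓ {{prime⇒nonZero ℓ-prime}}))) ⟩
    ℓ ℕ.* (m ℕ.+ Err) ℕ.+ (cC ℕ.+ ℓ ℕ.* K) ≡⟨ solve 5 (λ ℓ m e c k → ℓ :* (m :+ e) :+ (c :+ ℓ :* k) := c :+ ℓ :* (e :+ k) :+ m :* ℓ) refl ℓ m Err cC K ⟩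
    cC ℕ.+ ℓ ℕ.* δ ℕ.+ m ℕ.* ℓ ∎)
    where
    open ℕ.≤-Reasoning
    open +-*-Solver using (solve; _:+_; _:*_; _:=_)
    cA = count ((c₀ , m) ∷ map (_, n′ ℕ.* m) cs)
    cC = count ((c₀ , m ℕ.* ℓ) ∷ map (_, n′ ℕ.* m) cs)
    instance
      ℓ≢0 : NonZero ℓ
      ℓ≢0 = prime⇒nonZero ℓ-prime
      n≢0 : NonZero (n′ ℕ.* ℓ)
      n≢0 = ℕ.m*n≢0 n′ ℓ
    bound : ∀ {fs} → PrimeOrder.Exponents.Admissible F ℓ ℓ-prime n′ cs fs → ∑ elems (λ x → ⟦ hasValue? ((c₀ , 1) ∷ fs) m 1# x ⟧) ≤ m ℕ.+ Err
    bound {fs} (shifts , exponents) = value-bound F pp K d r 12Kd≤r r²≤q q<[r+1]² (n′ ℕ.* ℓ) m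
      (trans q≡ (cong suc (solve 3 (λ n m ℓ → n :* (m :* ℓ) := n :* ℓ :* m) refl n′ m ℓ))) n′ℓ≤d c₀ fs
      (All.map⁻ {f = proj₁} (subst (All (λ c → ¬ (c ≡ c₀))) (sym shifts) (All.map (λ ne eq → ne (sym eq)) distinct)))
      exponents (subst (_< K) (trans (cong length (sym shifts)) (length-map proj₁ fs)) cs<K) 1#

  count-weaken : ∀ cM conds → count (cM ∷ conds) ≤ count conds
  count-weaken cM conds = ∑-mono elems (λ {x} _ → ⟦⟧-mono (satisfies? (cM ∷ conds) x) (satisfies? conds x) (λ { (_ ∷ h) → h }))

  -- Each `count-step` sharpens a void condition at one new element. The errors form the series
  -- `δ + δ/ℓ + ...`, whose sum is at most `2 δ` because `2 ≤ ℓ`.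
  multifold-bound : ∀ ℓ → Prime ℓ → ∀ m {{_ : NonZero m}} → q ≡ suc (ℓ ℕ.* m) → ℓ ≤ d → ∀ cs → Unique cs → length cs ≤ K →
                    ℓ ℕ.^ length cs ℕ.* count (map (_, m) cs) ≤ q ℕ.+ 2 ℕ.* (ℓ ℕ.^ length cs ℕ.* δ)
  multifold-bound ℓ ℓ-prime m q≡ ℓ≤d [] _ _ = ℕ.≤-trans (ℕ.≤-reflexive (trans (ℕ.*-identityˡ _) (trans (∑-one elems) length-elems))) (ℕ.m≤m+n q _)
  multifold-bound ℓ ℓ-prime m q≡ ℓ≤d (c ∷ cs) (c∉ ∷ u) c∷cs≤K = begin
    ℓ ℕ.* L ℕ.* count (map (_, m) (c ∷ cs)) ≡⟨ solve 3 (λ ℓ L x → ℓ :* L :* x := L :* (ℓ :* x)) refl ℓ L _ ⟩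
    L ℕ.* (ℓ ℕ.* count ((c , m) ∷ map (_, m) cs)) ≤⟨ ℕ.*-monoʳ-≤ L (subst (λ M → ℓ ℕ.* count ((c , m) ∷ map (_, M) cs) ≤ count ((c , m ℕ.* ℓ) ∷ map (_, M) cs) ℕ.+ ℓ ℕ.* δ) (ℕ.*-identityˡ m)
        (count-step ℓ ℓ-prime 1 m (trans q≡ (cong suc (trans (ℕ.*-comm ℓ m) (sym (ℕ.*-identityˡ _))))) (ℕ.≤-trans (ℕ.≤-reflexive (ℕ.*-identityˡ ℓ)) ℓ≤d) c cs c∉ c∷cs≤K)) ⟩
    L ℕ.* (count ((c , m ℕ.* ℓ) ∷ map (_, m) cs) ℕ.+ ℓ ℕ.* δ) ≤⟨ ℕ.*-monoʳ-≤ L (ℕ.+-monoˡ-≤ (ℓ ℕ.* δ) (count-weaken (c , m ℕ.* ℓ) (map (_, m) cs))) ⟩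
    L ℕ.* (count (map (_, m) cs) ℕ.+ ℓ ℕ.* δ) ≡⟨ ℕ.*-distribˡ-+ L _ _ ⟩
    L ℕ.* count (map (_, m) cs) ℕ.+ L ℕ.* (ℓ ℕ.* δ) ≤⟨ ℕ.+-monoˡ-≤ _ (multifold-bound ℓ ℓ-prime m q≡ ℓ≤d cs u (ℕ.≤-trans (ℕ.n≤1+n _) c∷cs≤K)) ⟩
    q ℕ.+ 2 ℕ.* (L ℕ.* δ) ℕ.+ L ℕ.* (ℓ ℕ.* δ) ≤⟨ ℕ.+-monoˡ-≤ (L ℕ.* (ℓ ℕ.* δ)) (ℕ.+-monoʳ-≤ q (ℕ.*-monoˡ-≤ (L ℕ.* δ) 2≤ℓ)) ⟩
    q ℕ.+ ℓ ℕ.* (L ℕ.* δ) ℕ.+ L ℕ.* (ℓ ℕ.* δ) ≡⟨ solve 4 (λ q ℓ L δ → q :+ ℓ :* (L :* δ) :+ L :* (ℓ :* δ) := q :+ con 2 :* (ℓ :* L :* δ)) refl q ℓ L δ ⟩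
    q ℕ.+ 2 ℕ.* (ℓ ℕ.* L ℕ.* δ) ∎
    where
    open ℕ.≤-Reasoning
    open +-*-Solver using (solve; con; _:+_; _:*_; _:=_)
    L = ℓ ℕ.^ length cs
    2≤ℓ : 2 ≤ ℓ
    2≤ℓ = ℕ.nonTrivial⇒n>1 ℓ {{prime⇒nonTrivial ℓ-prime}}

-- Sumsets

length-split : ∀ {a p} {A : Set a} {P : Pred A p} (P? : Decidable P) (xs : List A) →
               length (filter P? xs) ℕ.+ length (filter (¬? ∘ P?) xs) ≡ length xs
length-split P? []       = refl
length-split P? (x ∷ xs) with P? x
... | yes _ = cong suc (length-split P? xs)
... | no  _ = trans (ℕ.+-suc _ _) (cong suc (length-split P? xs))

module _ {q : ℕ} (F : FiniteField q) where
  open Field F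
  open Data.List.Membership.DecPropositional _≟_ using (_∈?_)
  private module SF = Algebra.Solver.Ring.NaturalCoefficients.Default commutativeSemiring

  module _ (B C BC : List Carrier)
           (BC⊆ : ∀ {y} → y ∈ BC → ∃ λ b → ∃ λ c → b ∈ B × c ∈ C × y ≡ b + c)
           (⊆BC : ∀ {b c} → b ∈ B → c ∈ C → b + c ∈ BC) where

    x-y+y : ∀ x y → x - y + y ≡ x
    x-y+y x y = trans (+-assoc x (- y) y) (trans (cong (x +_) (-‿inverseˡ y)) (+-identityʳ x))

    a+b-a : ∀ a b → a + b - a ≡ b
    a+b-a a b = trans (cong (_- a) (+-comm a b)) (trans (+-assoc b a (- a)) (trans (cong (b +_) (-‿inverseʳ a)) (+-identityʳ b)))

    -- The inequality of Gyarmati, Matolcsi and Ruzsa. The induction on A splits off from A + B + C, A + B and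
    -- A + C whatever involves the first element of A; the rest of A has all its sums in the remaining parts.
    sumset-inequality : ∀ A G U V → Unique G →
      (∀ {s} → s ∈ G → ∃ λ a → ∃ λ b → ∃ λ c → a ∈ A × b ∈ B × c ∈ C × s ≡ a + b + c) →
      (∀ {a b c} → a ∈ A → b ∈ B → c ∈ C → a + b + c ∈ G → a + b ∈ U × a + c ∈ V) →
      length G ℕ.* length G ≤ length BC ℕ.* (length U ℕ.* length V)
    sumset-inequality [] []      U V u cover closed = z≤n
    sumset-inequality [] (s ∷ G) U V u cover closed with cover (here refl)
    ... | _ , _ , _ , () , _
    sumset-inequality (a ∷ A) G U V u cover closed =
      subst₂ (λ g uv → g ℕ.* g ≤ length BC ℕ.* uv) (length-split inG? G) (cong₂ ℕ._*_ (length-split inU? U) (length-split inV? V))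
        (cauchy-schwarz-step (length BC) {x = length G₁} {y = length G₂} {u = length U₁} {v = length V₁} {s = length U₂} {t = length V₂}
          (ℕ.*-mono-≤ G₁≤BC G₁≤UV)
          (sumset-inequality A G₂ U₂ V₂ (filter⁺ (¬? ∘ inG?) u) cover₂ closed₂))
      where
      inG? = λ s → (s - a) ∈? BC
      inU? = λ s → (s - a) ∈? B
      inV? = λ s → (s - a) ∈? C
      G₁ = filter inG? G
      G₂ = filter (¬? ∘ inG?) G
      U₁ = filter inU? U
      U₂ = filter (¬? ∘ inU?) U
      V₁ = filter inV? V
      V₂ = filter (¬? ∘ inV?) V

      G₁≤BC : length G₁ ≤ length BC
      G₁≤BC = length-injection (_- a) (λ _ _ eq → +-cancelʳ (- a) _ _ eq) (filter⁺ inG? u) (λ {s} s∈ → proj₂ (∈-filter⁻ inG? {xs = G} s∈))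

      -- Since `a + b + c = (a + b) + (a + c) - a`, an element of `G₁` is determined by one element
      -- of `U₁` and one of `V₁`. Multiplying the resulting bound by `G₁≤BC` gives the bound for the
      -- square.
      G₁⊆ : ∀ {s} → s ∈ G₁ → s ∈ cartesianProductWith (λ u v → u + v - a) U₁ V₁
      G₁⊆ {s} s∈ with ∈-filter⁻ inG? {xs = G} s∈
      ... | s∈G , s-a∈ with BC⊆ s-a∈
      ... | b , c , b∈ , c∈ , eq = subst (_∈ cartesianProductWith (λ u v → u + v - a) U₁ V₁) (sym s≡uv)
            (∈-cartesianProductWith⁺ (λ u v → u + v - a)
              (∈-filter⁺ inU? (proj₁ partial) (subst (_∈ B) (sym (a+b-a a b)) b∈))
              (∈-filter⁺ inV? (proj₂ partial) (subst (_∈ C) (sym (a+b-a a c)) c∈)))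
        where
        s≡ : s ≡ a + b + c
        s≡ = trans (sym (x-y+y s a)) (trans (cong (_+ a) eq) (trans (+-comm _ a) (sym (+-assoc a b c))))
        partial = closed (here refl) b∈ c∈ (subst (_∈ G) s≡ s∈G)
        s≡uv : s ≡ a + b + (a + c) - a
        s≡uv = trans s≡ (trans (sym (a+b-a a (a + b + c))) (cong (_- a) (SF.solve 3 (λ a b c → a SF.:+ (a SF.:+ b SF.:+ c) SF.:= a SF.:+ b SF.:+ (a SF.:+ c)) refl a b c)))

      G₁≤UV : length G₁ ≤ length U₁ ℕ.* length V₁
      G₁≤UV = ℕ.≤-trans (length-⊆ (filter⁺ inG? u) G₁⊆) (ℕ.≤-reflexive (length-cartesianProductWith (λ u v → u + v - a) U₁ V₁))

      cover₂ : ∀ {s} → s ∈ G₂ → ∃ λ a → ∃ λ b → ∃ λ c → a ∈ A × b ∈ B × c ∈ C × s ≡ a + b + c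
      cover₂ {s} s∈ with ∈-filter⁻ (¬? ∘ inG?) {xs = G} s∈
      ... | s∈G , s-a∉ with cover s∈G
      ... | a′ , b , c , there a′∈ , b∈ , c∈ , eq = a′ , b , c , a′∈ , b∈ , c∈ , eq
      ... | .a , b , c , here refl , b∈ , c∈ , eq = contradiction
              (subst (_∈ BC) (sym (trans (cong (_- a) (trans eq (+-assoc a b c))) (a+b-a a (b + c)))) (⊆BC b∈ c∈)) s-a∉

      -- If `a′ + b` were `a + b₁` with `b₁` in `B`, the triple sum would be `a + b₁ + c`, which
      -- belongs to `G₁`. The same holds for `a′ + c`.
      closed₂ : ∀ {a′ b c} → a′ ∈ A → b ∈ B → c ∈ C → a′ + b + c ∈ G₂ → a′ + b ∈ U₂ × a′ + c ∈ V₂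
      closed₂ {a′} {b} {c} a′∈ b∈ c∈ s∈ with ∈-filter⁻ (¬? ∘ inG?) {xs = G} s∈
      ... | s∈G , s-a∉ with closed (there a′∈) b∈ c∈ s∈G
      ... | u∈ , v∈ = ∈-filter⁺ (¬? ∘ inU?) u∈ (λ h → s-a∉ (subst (_∈ BC) (move (a′ + b) c) (⊆BC h c∈))) ,
                      ∈-filter⁺ (¬? ∘ inV?) v∈ (λ h → s-a∉ (subst (_∈ BC) (trans (+-comm b _) (trans (move (a′ + c) b) (cong (_- a) (SF.solve 3 (λ a b c → a SF.:+ c SF.:+ b SF.:= a SF.:+ b SF.:+ c) refl a′ b c)))) (⊆BC b∈ h)))
        where
        move : ∀ x y → x - a + y ≡ x + y - a
        move x y = trans (+-assoc x (- a) y) (trans (cong (x +_) (+-comm (- a) y)) (sym (+-assoc x y (- a))))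

-- Decompositions into two summands

-- Inclusion and exclusion: where `P` holds, the sum of the other two indicators is 1 plus their
-- product.
indicators-cover : ∀ {p} {P Q R : Set p} (P? : Dec P) (Q? : Dec Q) (R? : Dec R) → (P → Q ⊎ R) →
                   ⟦ P? ⟧ ℕ.+ ⟦ P? ⟧ ℕ.* (⟦ Q? ⟧ ℕ.* ⟦ R? ⟧) ≤ ⟦ P? ⟧ ℕ.* ⟦ Q? ⟧ ℕ.+ ⟦ P? ⟧ ℕ.* ⟦ R? ⟧
indicators-cover P? Q? R? P⇒Q⊎R with P? | Q? | R?
... | no _  | _      | _      = z≤n
... | yes _ | yes _  | yes _  = ℕ.≤-refl
... | yes _ | yes _  | no _   = ℕ.≤-refl
... | yes _ | no _   | yes _  = ℕ.≤-refl
... | yes p | no ¬q  | no ¬r with P⇒Q⊎R p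
... | inj₁ q = contradiction q ¬q
... | inj₂ r = contradiction r ¬r

-- Either term on the left requires at least two of `P`, `Q`, `R`, because `P` brings `Q` or `R`
-- with it. If exactly two hold, the left side is 1 and one non-square makes the product a
-- non-square, which is `N`. If all three hold, the left side is 2. The number `z` covers vanishing
-- factors.
indicators-parity : ∀ {p} {P Q R N : Set p} (P? : Dec P) (Q? : Dec Q) (R? : Dec R) → (P → Q ⊎ R) → (N? : Dec N) (z : ℕ) →
  (1 ≤ z × (¬ P ⊎ ¬ Q ⊎ ¬ R)) ⊎ ((P → Q → ¬ R → N) × (P → ¬ Q → R → N) × (¬ P → Q → R → N)) →
  ⟦ P? ⟧ ℕ.+ ⟦ Q? ⟧ ℕ.* ⟦ R? ⟧ ≤ ⟦ N? ⟧ ℕ.+ z ℕ.+ 2 ℕ.* (⟦ P? ⟧ ℕ.* (⟦ Q? ⟧ ℕ.* ⟦ R? ⟧))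
indicators-parity P? Q? R? P⇒Q⊎R N? z (inj₁ (1≤z , some)) with P? | Q? | R?
... | no _  | no _  | _     = z≤n
... | no _  | yes _ | no _  = z≤n
... | no _  | yes _ | yes _ = ℕ.≤-trans 1≤z (ℕ.≤-trans (ℕ.m≤n+m z ⟦ N? ⟧) (ℕ.m≤m+n _ _))
... | yes _ | no _  | _     = ℕ.≤-trans 1≤z (ℕ.≤-trans (ℕ.m≤n+m z ⟦ N? ⟧) (ℕ.m≤m+n _ _))
... | yes _ | yes _ | no _  = ℕ.≤-trans 1≤z (ℕ.≤-trans (ℕ.m≤n+m z ⟦ N? ⟧) (ℕ.m≤m+n _ _))
... | yes _ | yes _ | yes _ = ℕ.m≤n+m 2 (⟦ N? ⟧ ℕ.+ z)
indicators-parity P? Q? R? P⇒Q⊎R N? z (inj₂ (h₁ , h₂ , h₃)) with P? | Q? | R?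
... | no _  | no _  | _     = z≤n
... | no _  | yes _ | no _  = z≤n
... | no ¬p | yes q | yes r = ℕ.≤-trans (ℕ.≤-reflexive (sym (⟦⟧-yes N? (h₃ ¬p q r)))) (ℕ.≤-trans (ℕ.m≤m+n ⟦ N? ⟧ z) (ℕ.m≤m+n _ _))
... | yes p | no ¬q | yes r = ℕ.≤-trans (ℕ.≤-reflexive (sym (⟦⟧-yes N? (h₂ p ¬q r)))) (ℕ.≤-trans (ℕ.m≤m+n ⟦ N? ⟧ z) (ℕ.m≤m+n _ _))
... | yes p | yes q | no ¬r = ℕ.≤-trans (ℕ.≤-reflexive (sym (⟦⟧-yes N? (h₁ p q ¬r)))) (ℕ.≤-trans (ℕ.m≤m+n ⟦ N? ⟧ z) (ℕ.m≤m+n _ _))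
... | yes _ | yes _ | yes _ = ℕ.m≤n+m 2 (⟦ N? ⟧ ℕ.+ z)
... | yes p | no ¬q | no ¬r with P⇒Q⊎R p
... | inj₁ q = contradiction q ¬q
... | inj₂ r = contradiction r ¬r

module Decomposition {q : ℕ} (F : FiniteField q) (pp : IsPrimePower q) (K d r m : ℕ) {{d≢0 : NonZero d}} {{m≢0 : NonZero m}}
         (12Kd≤r : 12 ℕ.* (K ℕ.* d) ≤ r) (r²≤q : r ℕ.* r ≤ q) (q<[r+1]² : q < suc r ℕ.* suc r)
         (q≡ : q ≡ suc (d ℕ.* m)) (2≤d : 2 ≤ d) (q≤2^K : q ≤ 2 ℕ.^ K) (4≤K : 4 ≤ K)
         (d²r<m : d ℕ.* (d ℕ.* suc r) < m) where
  open Field F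
  open Conditions F
  open MultifoldIntersections F pp K d r 12Kd≤r r²≤q q<[r+1]²
  open Pairs F d m q≡
  open +-*-Solver using (solve; con; _:+_; _:*_; _:=_)

  deviation-bound : ∀ t → ¬ (t ≡ 0#) → ∣ d ℕ.* pairs t - m ∣ ≤ d ℕ.* suc r
  deviation-bound t t≢0 = square-cancel-≤ (begin
    ∣ d ℕ.* pairs t - m ∣ ℕ.* ∣ d ℕ.* pairs t - m ∣ ≤⟨ pair-bound t t≢0 ⟩
    d ℕ.* d ℕ.* d ℕ.* m ≡⟨ ℕ.*-assoc (d ℕ.* d) d m ⟩
    d ℕ.* d ℕ.* (d ℕ.* m) ≤⟨ ℕ.*-monoʳ-≤ (d ℕ.* d) (ℕ.≤-trans (ℕ.n≤1+n _) (ℕ.≤-trans (ℕ.≤-reflexive (sym q≡)) (ℕ.<⇒≤ q<[r+1]²))) ⟩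
    d ℕ.* d ℕ.* (suc r ℕ.* suc r) ≡⟨ solve 2 (λ d s → d :* d :* (s :* s) := d :* s :* (d :* s)) refl d (suc r) ⟩
    d ℕ.* suc r ℕ.* (d ℕ.* suc r) ∎)
    where open ℕ.≤-Reasoning

  pairs-upper : ∀ t → ¬ (t ≡ 0#) → d ℕ.* pairs t ≤ m ℕ.+ d ℕ.* suc r
  pairs-upper t t≢0 = ℕ.≤-trans (ℕ.m≤n+∣m-n∣ (d ℕ.* pairs t) m) (ℕ.+-monoʳ-≤ m (deviation-bound t t≢0))

  pairs-lower : ∀ t → ¬ (t ≡ 0#) → m ≤ d ℕ.* pairs t ℕ.+ d ℕ.* suc r
  pairs-lower t t≢0 = ℕ.≤-trans (ℕ.m≤n+∣n-m∣ m (d ℕ.* pairs t)) (ℕ.+-monoʳ-≤ (d ℕ.* pairs t) (deviation-bound t t≢0))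

  z*z≡1⇒ : ∀ {z} → z * z ≡ 1# → ¬ (z ≡ 1#) → z ≡ - 1#
  z*z≡1⇒ {z} zz≡1 z≢1 with x*y≡0⇒ {z - 1#} {z + 1#} (begin
      (z - 1#) * (z + 1#) ≡⟨ distribʳ (z + 1#) z (- 1#) ⟩
      z * (z + 1#) + - 1# * (z + 1#) ≡⟨ cong₂ _+_ (trans (distribˡ z z 1#) (cong₂ _+_ zz≡1 (*-identityʳ z))) (-1*x≈-x (z + 1#)) ⟩
      1# + z - (z + 1#) ≡⟨ cong (_- (z + 1#)) (+-comm 1# z) ⟩
      z + 1# - (z + 1#) ≡⟨ -‿inverseʳ (z + 1#) ⟩
      0# ∎)
    where open ≡-Reasoning
  ... | inj₁ h = contradiction (x∙y⁻¹≈ε⇒x≈y z 1# h) z≢1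
  ... | inj₂ h = +-cancelʳ 1# _ _ (trans h (sym (-‿inverseˡ 1#)))

  -- If d = 2 and no square x has both x + t and x - t among the non-squares, then x (x + t) (x - t) is a
  -- non-square for about three quarters of all x.
  no-isolated-squares : 100 ℕ.* (K ℕ.* δ) < m → d ≡ 2 → ∀ t → ¬ (t ≡ 0#) →
                        (∀ {x} → x ^ m ≡ 1# → (t + x) ^ m ≡ 1# ⊎ (- t + x) ^ m ≡ 1#) → ⊥
  no-isolated-squares Kδ<m refl t t≢0 neighbour = ℕ.<⇒≱ Kδ<m (begin
      m ≤⟨ r₂-lower ⟩
      2 ℕ.* r₂ ℕ.+ e ≤⟨ ℕ.+-monoˡ-≤ e r₂-upper ⟩
      2 ℕ.* Err ℕ.+ 6 ℕ.+ 4 ℕ.* e ℕ.+ e ≡⟨ solve 2 (λ E r → con 2 :* E :+ con 6 :+ con 4 :* (con 2 :* (con 1 :+ r)) :+ con 2 :* (con 1 :+ r) := con 2 :* E :+ (con 10 :* r :+ con 16)) refl Err r ⟩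
      2 ℕ.* Err ℕ.+ (10 ℕ.* r ℕ.+ 16) ≤⟨ ℕ.+-monoʳ-≤ (2 ℕ.* Err) (ℕ.+-mono-≤ 10r≤Err (ℕ.*-monoʳ-≤ 4 4≤K)) ⟩
      2 ℕ.* Err ℕ.+ (Err ℕ.+ 4 ℕ.* K) ≤⟨ ℕ.m≤m+n _ Err ⟩
      2 ℕ.* Err ℕ.+ (Err ℕ.+ 4 ℕ.* K) ℕ.+ Err ≡⟨ solve 2 (λ E K → con 2 :* E :+ (E :+ con 4 :* K) :+ E := con 4 :* (E :+ K)) refl Err K ⟩
      4 ℕ.* δ ≤⟨ ℕ.*-mono-≤ {4} {100} (ℕ.m≤m+n 4 96) (ℕ.m≤n*m δ K {{ℕ.>-nonZero 1≤K}}) ⟩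
      100 ℕ.* (K ℕ.* δ) ∎)
    where
    open ℕ.≤-Reasoning
    1≤K : 1 ≤ K
    1≤K = ℕ.≤-trans (s≤s z≤n) 4≤K
    e = 2 ℕ.* suc r
    10r≤Err : 10 ℕ.* r ≤ Err
    10r≤Err = ℕ.*-mono-≤ {10} {64} (ℕ.m≤m+n 10 54) (ℕ.m≤n*m r (K ℕ.* 2) {{ℕ.>-nonZero (ℕ.*-mono-≤ 1≤K (s≤s {n = 1} z≤n))}})

    G? : ∀ y → Dec (y ^ m ≡ 1#)
    G? y = y ^ m ≟ 1#
    fs = (0# , 1) ∷ (t , 1) ∷ (- t , 1) ∷ []
    u v v′ nv z : Carrier → ℕ
    u x = ⟦ G? x ⟧
    v x = ⟦ G? (t + x) ⟧
    v′ x = ⟦ G? (- t + x) ⟧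
    nv x = ⟦ hasValue? fs m (- 1#) x ⟧
    z x = ⟦ 0# + x ≟ 0# ⟧ ℕ.+ (⟦ t + x ≟ 0# ⟧ ℕ.+ ⟦ - t + x ≟ 0# ⟧)
    T r₂ : ℕ
    T = ∑ elems (λ x → u x ℕ.* (v x ℕ.* v′ x))
    r₂ = ∑ elems (λ x → v x ℕ.* v′ x)

    not-in-G : ∀ {y} → y ≡ 0# → ¬ (y ^ m ≡ 1#)
    not-in-G y≡0 eq = unity≢0 F m eq y≡0

    χ-value : ∀ {y} → ¬ (y ≡ 0#) → ¬ (y ^ m ≡ 1#) → y ^ m ≡ - 1#
    χ-value {y} y≢0 = z*z≡1⇒ (trans (sym (^-homo-* y m m)) (fermat y y≢0 (m ℕ.+ m) (trans q≡ (cong suc (cong (m ℕ.+_) (ℕ.+-identityʳ m))))))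

    product-value : ∀ x → StepanovMethod.product F fs x ^ m ≡ x ^ m * ((t + x) ^ m * (- t + x) ^ m)
    product-value x = trans (cong (_^ m) (cong₂ _*_ (trans (*-identityʳ _) (+-identityˡ x)) (cong₂ _*_ (*-identityʳ _) (trans (*-identityʳ _) (*-identityʳ _)))))
      (trans (^-distrib-* x _ m) (cong (x ^ m *_) (^-distrib-* (t + x) (- t + x) m)))

    parity : ∀ x → u x ℕ.+ v x ℕ.* v′ x ≤ nv x ℕ.+ z x ℕ.+ 2 ℕ.* (u x ℕ.* (v x ℕ.* v′ x))
    parity x = indicators-parity (G? x) (G? (t + x)) (G? (- t + x)) neighbour (hasValue? fs m (- 1#) x) (z x)
        (by-cases (0# + x ≟ 0#) (t + x ≟ 0#) (- t + x ≟ 0#))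
      where
      P = x ^ m ≡ 1#
      Q = (t + x) ^ m ≡ 1#
      R = (- t + x) ^ m ≡ 1#
      N = HasValue fs m (- 1#) x
      by-cases : Dec (0# + x ≡ 0#) → Dec (t + x ≡ 0#) → Dec (- t + x ≡ 0#) →
                 (1 ≤ z x × (¬ P ⊎ ¬ Q ⊎ ¬ R)) ⊎ ((P → Q → ¬ R → N) × (P → ¬ Q → R → N) × (¬ P → Q → R → N))
      by-cases (yes h) _ _ = inj₁ (ℕ.≤-trans (ℕ.≤-reflexive (sym (⟦⟧-yes (0# + x ≟ 0#) h))) (ℕ.m≤m+n _ _) , inj₁ (not-in-G (trans (sym (+-identityˡ x)) h)))
      by-cases _ (yes h) _ = inj₁ (ℕ.≤-trans (ℕ.≤-reflexive (sym (⟦⟧-yes (t + x ≟ 0#) h))) (ℕ.≤-trans (ℕ.m≤m+n _ _) (ℕ.m≤n+m _ ⟦ 0# + x ≟ 0# ⟧)) , inj₂ (inj₁ (not-in-G h)))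
      by-cases _ _ (yes h) = inj₁ (ℕ.≤-trans (ℕ.≤-reflexive (sym (⟦⟧-yes (- t + x ≟ 0#) h))) (ℕ.≤-trans (ℕ.m≤n+m _ ⟦ t + x ≟ 0# ⟧) (ℕ.m≤n+m _ ⟦ 0# + x ≟ 0# ⟧)) , inj₂ (inj₂ (not-in-G h)))
      by-cases (no h₁) (no h₂) (no h₃) = inj₂
        ( (λ p q ¬r → value (trans (cong₂ _*_ p (cong₂ _*_ q (χ-value h₃ ¬r))) (trans (*-identityˡ _) (*-identityˡ _))))
        , (λ p ¬q r → value (trans (cong₂ _*_ p (cong₂ _*_ (χ-value h₂ ¬q) r)) (trans (*-identityˡ _) (*-identityʳ _))))
        , (λ ¬p q r → value (trans (cong₂ _*_ (χ-value (λ eq → h₁ (trans (+-identityˡ x) eq)) ¬p) (cong₂ _*_ q r)) (trans (cong (- 1# *_) (*-identityˡ 1#)) (*-identityʳ _)))) )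
        where
        value : x ^ m * ((t + x) ^ m * (- t + x) ^ m) ≡ - 1# → N
        value eq = (h₁ ∷ h₂ ∷ h₃ ∷ []) , trans (product-value x) eq

    ∑u : ∑ elems u ≡ m
    ∑u = trans (sym (length-filter-∑ G? elems)) length-G

    -t≢0 : ¬ (- t ≡ 0#)
    -t≢0 eq = t≢0 (trans (sym (-‿involutive t)) (trans (cong -_ eq) -0#≈0#))

    -- Every square has a neighbouring square, and `T` counts those with two. As `pairs t` and
    -- `pairs (- t)` are each close to `m/2`, this leaves almost nothing for `T`.
    T-bound : m ℕ.+ T ≤ pairs t ℕ.+ pairs (- t)
    T-bound = begin
      m ℕ.+ T ≡⟨ cong (ℕ._+ T) ∑u ⟨
      ∑ elems u ℕ.+ T ≡⟨ ∑-distrib-+ elems u _ ⟨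
      ∑ elems (λ x → u x ℕ.+ u x ℕ.* (v x ℕ.* v′ x)) ≤⟨ ∑-mono elems (λ {x} _ → indicators-cover (G? x) (G? (t + x)) (G? (- t + x)) neighbour) ⟩
      ∑ elems (λ x → u x ℕ.* v x ℕ.+ u x ℕ.* v′ x) ≡⟨ ∑-distrib-+ elems _ _ ⟩
      ∑ elems (λ x → u x ℕ.* v x) ℕ.+ ∑ elems (λ x → u x ℕ.* v′ x) ≡⟨ cong₂ ℕ._+_ (∑-filter G? elems v) (∑-filter G? elems v′) ⟨
      pairs t ℕ.+ pairs (- t) ∎

    T≤e : T ≤ e
    T≤e = ℕ.*-cancelˡ-≤ 2 (ℕ.+-cancelˡ-≤ (2 ℕ.* m) _ _ (begin
      2 ℕ.* m ℕ.+ 2 ℕ.* T ≡⟨ ℕ.*-distribˡ-+ 2 m T ⟨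
      2 ℕ.* (m ℕ.+ T) ≤⟨ ℕ.*-monoʳ-≤ 2 T-bound ⟩
      2 ℕ.* (pairs t ℕ.+ pairs (- t)) ≡⟨ ℕ.*-distribˡ-+ 2 (pairs t) _ ⟩
      2 ℕ.* pairs t ℕ.+ 2 ℕ.* pairs (- t) ≤⟨ ℕ.+-mono-≤ (pairs-upper t t≢0) (pairs-upper (- t) -t≢0) ⟩
      (m ℕ.+ e) ℕ.+ (m ℕ.+ e) ≡⟨ solve 2 (λ m e → (m :+ e) :+ (m :+ e) := con 2 :* m :+ con 2 :* e) refl m e ⟩
      2 ℕ.* m ℕ.+ 2 ℕ.* e ∎))

    nv-bound : ∑ elems nv ≤ m ℕ.+ Err
    nv-bound = value-bound F pp K 2 r 12Kd≤r r²≤q q<[r+1]² 2 m q≡ ℕ.≤-refl 0# ((t , 1) ∷ (- t , 1) ∷ [])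
      (t≢0 ∷ -t≢0 ∷ []) (s≤s z≤n ∷ s≤s z≤n ∷ []) (ℕ.≤-trans (ℕ.n≤1+n 3) 4≤K) (- 1#)

    z-bound : ∑ elems z ≤ 3
    z-bound = ℕ.≤-trans (ℕ.≤-reflexive (trans (∑-distrib-+ elems _ _) (cong (∑ elems (λ x → ⟦ 0# + x ≟ 0# ⟧) ℕ.+_) (∑-distrib-+ elems _ _))))
      (ℕ.+-mono-≤ (count-zeros 0#) (ℕ.+-mono-≤ (count-zeros t) (count-zeros (- t))))

    r₂-upper : 2 ℕ.* r₂ ≤ 2 ℕ.* Err ℕ.+ 6 ℕ.+ 4 ℕ.* e
    r₂-upper = ℕ.+-cancelˡ-≤ (2 ℕ.* m) _ _ (begin
      2 ℕ.* m ℕ.+ 2 ℕ.* r₂ ≡⟨ trans (sym (ℕ.*-distribˡ-+ 2 m r₂)) (cong (λ y → 2 ℕ.* (y ℕ.+ r₂)) (sym ∑u)) ⟩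
      2 ℕ.* (∑ elems u ℕ.+ r₂) ≡⟨ cong (2 ℕ.*_) (∑-distrib-+ elems u _) ⟨
      2 ℕ.* ∑ elems (λ x → u x ℕ.+ v x ℕ.* v′ x) ≤⟨ ℕ.*-monoʳ-≤ 2 (∑-mono elems (λ {x} _ → parity x)) ⟩
      2 ℕ.* ∑ elems (λ x → nv x ℕ.+ z x ℕ.+ 2 ℕ.* (u x ℕ.* (v x ℕ.* v′ x)))
        ≡⟨ cong (2 ℕ.*_) (trans (∑-distrib-+ elems _ _) (cong₂ ℕ._+_ (∑-distrib-+ elems nv z) (∑-*ˡ elems 2 (λ x → u x ℕ.* (v x ℕ.* v′ x))))) ⟩
      2 ℕ.* (∑ elems nv ℕ.+ ∑ elems z ℕ.+ 2 ℕ.* T) ≤⟨ ℕ.*-monoʳ-≤ 2 (ℕ.+-mono-≤ (ℕ.+-mono-≤ nv-bound z-bound) (ℕ.*-monoʳ-≤ 2 T≤e)) ⟩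
      2 ℕ.* (m ℕ.+ Err ℕ.+ 3 ℕ.+ 2 ℕ.* e) ≡⟨ solve 3 (λ m E e → con 2 :* (m :+ E :+ con 3 :+ con 2 :* e) := con 2 :* m :+ (con 2 :* E :+ con 6 :+ con 4 :* e)) refl m Err e ⟩
      2 ℕ.* m ℕ.+ (2 ℕ.* Err ℕ.+ 6 ℕ.+ 4 ℕ.* e) ∎)

    r₂-lower : m ≤ 2 ℕ.* r₂ ℕ.+ e
    r₂-lower with t + t ≟ 0#
    -- Here both shifts coincide and `r₂` is even at least `m`. In the other case `x = t + y` turns
    -- `r₂` into a count of pairs at distance `t + t`, about `m/2`.
    ... | yes 2t≡0 = ℕ.≤-trans (count-shifted-unity 2 m q≡ t) (ℕ.≤-trans (ℕ.≤-reflexive (∑-cong elems (λ {x} _ → same x))) (ℕ.≤-trans (ℕ.m≤m+n r₂ _) (ℕ.m≤m+n _ e)))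
      where
      t≡-t : t ≡ - t
      t≡-t = +-cancelʳ t _ _ (trans 2t≡0 (sym (-‿inverseˡ t)))
      idempotent : ∀ {P : Set} (d : Dec P) → ⟦ d ⟧ ≡ ⟦ d ⟧ ℕ.* ⟦ d ⟧
      idempotent (yes _) = refl
      idempotent (no _)  = refl
      same : ∀ x → v x ≡ v x ℕ.* v′ x
      same x = trans (idempotent (G? (t + x))) (cong (λ s → v x ℕ.* ⟦ G? (s + x) ⟧) t≡-t)
    ... | no 2t≢0 = ℕ.≤-trans (pairs-lower (t + t) 2t≢0) (ℕ.+-monoˡ-≤ e (ℕ.*-monoʳ-≤ 2 (begin
      pairs (t + t) ≤⟨ ∑-mono G (λ {y} y∈ → ℕ.≤-reflexive (shifted y∈)) ⟩
      ∑ G (λ y → v (t + y) ℕ.* v′ (t + y)) ≤⟨ ∑-injection (t +_) (λ x → v x ℕ.* v′ x) (λ _ _ → +-cancelˡ t _ _) (μ-unique F m) (λ {y} _ → ∈elems (t + y)) ⟩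
      r₂ ∎)))
      where
      shifted : ∀ {y} → y ∈ G → ⟦ (t + t + y) ^ m ≟ 1# ⟧ ≡ v (t + y) ℕ.* v′ (t + y)
      shifted {y} y∈ = trans (sym (ℕ.*-identityʳ _)) (cong₂ ℕ._*_ (cong (λ s → ⟦ G? s ⟧) (+-assoc t t y))
        (sym (⟦⟧-yes (G? (- t + (t + y))) (trans (cong (_^ m) (trans (sym (+-assoc (- t) t y)) (trans (cong (_+ y) (-‿inverseˡ t)) (+-identityˡ y)))) (∈G-^m y∈)))))

  module _ (A Y : List Carrier) (A-unique : Unique A) (Y-unique : Unique Y)
           (sums : ∀ {a y} → a ∈ A → y ∈ Y → (a + y) ^ m ≡ 1#)
           (cover : ∀ {s} → s ^ m ≡ 1# → ∃ λ a → ∃ λ y → a ∈ A × y ∈ Y × s ≡ a + y) where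

    m≤αY : m ≤ length A ℕ.* length Y
    m≤αY = begin
      m ≡⟨ length-G ⟨
      length G ≤⟨ length-⊆ {ys = cartesianProductWith _+_ A Y} (μ-unique F m) (λ s∈ → let (a , y , a∈ , y∈ , eq) = cover (∈μ⁻ F m s∈)
          in subst (_∈ cartesianProductWith _+_ A Y) (sym eq) (∈-cartesianProductWith⁺ _+_ a∈ y∈)) ⟩
      length (cartesianProductWith _+_ A Y) ≡⟨ length-cartesianProductWith _+_ A Y ⟩
      length A ℕ.* length Y ∎
      where
      open ℕ.≤-Reasoning

    Y≤count : ∀ conds → (∀ {y} → y ∈ Y → Satisfies conds y) → length Y ≤ count conds
    Y≤count conds h = length≤count (satisfies? conds) Y-unique (λ {y} y∈ → ∈elems y , h y∈)

    multiple-power : ∀ {x} e → x ^ m ≡ 1# → x ^ (e ℕ.* m) ≡ 1#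
    multiple-power {x} e eq = trans (cong (x ^_) (ℕ.*-comm e m)) (trans (sym (^-assocʳ x m e)) (trans (cong (_^ e) eq) (1^n e)))

    satisfied : ∀ e cs → All (_∈ A) cs → ∀ {y} → y ∈ Y → Satisfies (map (_, e ℕ.* m) cs) y
    satisfied e cs h y∈ = All.map⁺ {f = _, e ℕ.* m} (All.map (λ a∈ → multiple-power e (sums a∈ y∈)) h)

    -- The translate `a + Y` lies in `G` and remains there when shifted by `a′ - a`, so `Y` is no
    -- larger than the intersection of two translates of `G`.
    dY≤ : ∀ {a a′} → a ∈ A → a′ ∈ A → ¬ (a ≡ a′) → d ℕ.* length Y ≤ m ℕ.+ d ℕ.* suc r
    dY≤ {a} {a′} a∈ a′∈ a≢a′ = ℕ.≤-trans (ℕ.*-monoʳ-≤ d Y≤pairs) (pairs-upper t (λ eq → a≢a′ (sym (x∙y⁻¹≈ε⇒x≈y a′ a eq))))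
      where
      t = a′ - a
      into : ∀ {x} → x ∈ map (a +_) Y → x ∈ G × (t + x) ^ m ≡ 1#
      into x∈ with ∈-map⁻ (a +_) x∈
      ... | y , y∈ , refl = ∈μ F m (sums a∈ y∈) ,
            trans (cong (_^ m) (trans (sym (+-assoc t a y)) (cong (_+ y) (trans (+-comm t a) (shift-cancel a a′))))) (sums a′∈ y∈)
      Y≤pairs : length Y ≤ pairs t
      Y≤pairs = ℕ.≤-trans (ℕ.≤-reflexive (sym (length-map (a +_) Y)))
        (length≤count (λ x → (t + x) ^ m ≟ 1#) (map⁺ (+-cancelˡ a _ _) Y-unique) into)

    two-elements : 2 ≤ length A → ∃ λ a → ∃ λ a′ → a ∈ A × a′ ∈ A × ¬ (a ≡ a′)
    two-elements = go A-unique
      where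
      go : ∀ {B} → Unique B → 2 ≤ length B → ∃ λ a → ∃ λ a′ → a ∈ B × a′ ∈ B × ¬ (a ≡ a′)
      go (_ ∷ [])               (s≤s ())
      go ((a≢a′ ∷ _) ∷ (_ ∷ _)) _ = _ , _ , here refl , there (here refl) , a≢a′

    -- With at most `d - 1` elements in `A` and about `m/d` in `Y`, the sums would miss a share
    -- `1/d` of `G`, which exceeds the error by `d²r<m`.
    d≤α : 2 ≤ length A → d ≤ length A
    d≤α 2≤α = ℕ.≮⇒≥ (λ α<d → ℕ.<⇒≱ d²r<m (ℕ.+-cancelˡ-≤ (ℕ.pred d ℕ.* m) _ _ (begin
      ℕ.pred d ℕ.* m ℕ.+ m ≡⟨ trans (ℕ.+-comm _ m) (cong (ℕ._* m) (ℕ.suc-pred d)) ⟩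
      d ℕ.* m ≤⟨ ℕ.*-monoʳ-≤ d m≤αY ⟩
      d ℕ.* (length A ℕ.* length Y) ≡⟨ solve 3 (λ d α y → d :* (α :* y) := α :* (d :* y)) refl d (length A) (length Y) ⟩
      length A ℕ.* (d ℕ.* length Y) ≤⟨ ℕ.*-mono-≤ (ℕ.≤-pred (ℕ.≤-trans α<d (ℕ.≤-reflexive (sym (ℕ.suc-pred d))))) (dY≤ a∈ a′∈ a≢a′) ⟩
      ℕ.pred d ℕ.* (m ℕ.+ d ℕ.* suc r) ≡⟨ ℕ.*-distribˡ-+ (ℕ.pred d) m _ ⟩
      ℕ.pred d ℕ.* m ℕ.+ ℕ.pred d ℕ.* (d ℕ.* suc r) ≤⟨ ℕ.+-monoʳ-≤ (ℕ.pred d ℕ.* m) (ℕ.*-monoˡ-≤ (d ℕ.* suc r) (ℕ.pred[n]≤n {d})) ⟩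
      ℕ.pred d ℕ.* m ℕ.+ d ℕ.* (d ℕ.* suc r) ∎)))
      where
      open ℕ.≤-Reasoning
      pair = two-elements 2≤α
      a∈ = proj₁ (proj₂ (proj₂ pair))
      a′∈ = proj₁ (proj₂ (proj₂ (proj₂ pair)))
      a≢a′ = proj₂ (proj₂ (proj₂ (proj₂ pair)))

    module _ (Kδ<m : 100 ℕ.* (K ℕ.* δ) < m) where
      private
        1≤K : 1 ≤ K
        1≤K = ℕ.≤-trans (s≤s z≤n) 4≤K

        1≤δ : 1 ≤ δ
        1≤δ = ℕ.≤-trans 1≤K (ℕ.m≤n+m K Err)

      -- With `d = ℓ e`, the group `G` lies in the larger group of the `e m`-th roots of unity, of
      -- index `ℓ`, to which the bound for prime index applies.
      multifold : ∀ ℓ e → Prime ℓ → d ≡ ℓ ℕ.* e → ∀ cs → All (_∈ A) cs → Unique cs → length cs ≤ K →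
                  ℓ ℕ.^ length cs ℕ.* length Y ≤ q ℕ.+ 2 ℕ.* (ℓ ℕ.^ length cs ℕ.* δ)
      multifold ℓ e ℓ-prime d≡ cs cs⊆A cs-unique cs≤K = ℕ.≤-trans
        (ℕ.*-monoʳ-≤ (ℓ ℕ.^ length cs) (Y≤count (map (_, e ℕ.* m) cs) (satisfied e cs cs⊆A)))
        (multifold-bound ℓ ℓ-prime (e ℕ.* m) {{em≢0}} (trans q≡ (cong suc (trans (cong (ℕ._* m) d≡) (ℕ.*-assoc ℓ e m)))) ℓ≤d cs cs-unique cs≤K)
        where
        ℓe≢0 : NonZero (ℓ ℕ.* e)
        ℓe≢0 = subst NonZero d≡ d≢0
        e≢0 : NonZero e
        e≢0 = ℕ.m*n≢0⇒n≢0 ℓ {{ℓe≢0}}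
        em≢0 : NonZero (e ℕ.* m)
        em≢0 = ℕ.m*n≢0 e m {{e≢0}}
        ℓ≤d : ℓ ≤ d
        ℓ≤d = ℕ.≤-trans (ℕ.m≤m*n ℓ e {{e≢0}}) (ℕ.≤-reflexive (sym d≡))

      -- In `32 m ≤ 32 |A| |Y|` the main term of the right side is at most `25 m`. The other `7 m`
      -- would have to be at most `96 K δ`.
      generic-contradiction : ∀ ℓ e → Prime ℓ → d ≡ ℓ ℕ.* e → length A ≤ K → 32 ℕ.* (length A ℕ.* d) ≤ 25 ℕ.* ℓ ℕ.^ length A → ⊥
      generic-contradiction ℓ e ℓ-prime d≡ α≤K h = ℕ.<⇒≱ (begin-strict
        96 ℕ.* (K ℕ.* δ) ≤⟨ ℕ.*-monoˡ-≤ (K ℕ.* δ) {96} {100} (ℕ.m≤m+n 96 4) ⟩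
        100 ℕ.* (K ℕ.* δ) <⟨ Kδ<m ⟩
        m ≤⟨ ℕ.m≤n*m m 7 ⟩
        7 ℕ.* m ∎) (ℕ.*-cancelˡ-≤ L {{L≢0}} (ℕ.+-cancelˡ-≤ (25 ℕ.* L ℕ.* m) _ _ (begin
        25 ℕ.* L ℕ.* m ℕ.+ L ℕ.* (7 ℕ.* m) ≡⟨ solve 2 (λ L m → con 25 :* L :* m :+ L :* (con 7 :* m) := con 32 :* (L :* m)) refl L m ⟩
        32 ℕ.* (L ℕ.* m) ≤⟨ ℕ.*-monoʳ-≤ 32 (ℕ.*-monoʳ-≤ L m≤αY) ⟩
        32 ℕ.* (L ℕ.* (α ℕ.* length Y)) ≡⟨ solve 3 (λ L α y → con 32 :* (L :* (α :* y)) := con 32 :* (α :* (L :* y))) refl L α (length Y) ⟩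
        32 ℕ.* (α ℕ.* (L ℕ.* length Y)) ≤⟨ ℕ.*-monoʳ-≤ 32 (ℕ.*-monoʳ-≤ α (multifold ℓ e ℓ-prime d≡ A (All.tabulate (λ a∈ → a∈)) A-unique α≤K)) ⟩
        32 ℕ.* (α ℕ.* (q ℕ.+ 2 ℕ.* (L ℕ.* δ))) ≡⟨ cong (λ z → 32 ℕ.* (α ℕ.* (z ℕ.+ 2 ℕ.* (L ℕ.* δ)))) q≡ ⟩
        32 ℕ.* (α ℕ.* (suc (d ℕ.* m) ℕ.+ 2 ℕ.* (L ℕ.* δ))) ≡⟨ solve 5 (λ α d m L δ → con 32 :* (α :* (con 1 :+ d :* m :+ con 2 :* (L :* δ))) := con 32 :* (α :* d) :* m :+ (con 32 :* (con 1 :* (α :* con 1)) :+ con 64 :* (L :* (α :* δ)))) refl α d m L δ ⟩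
        32 ℕ.* (α ℕ.* d) ℕ.* m ℕ.+ (32 ℕ.* (1 ℕ.* (α ℕ.* 1)) ℕ.+ 64 ℕ.* (L ℕ.* (α ℕ.* δ)))
          ≤⟨ ℕ.+-mono-≤ (ℕ.*-monoˡ-≤ m h) (ℕ.+-mono-≤ (ℕ.*-monoʳ-≤ 32 (ℕ.*-mono-≤ 1≤L (ℕ.*-mono-≤ α≤K 1≤δ))) (ℕ.*-monoʳ-≤ 64 (ℕ.*-monoʳ-≤ L (ℕ.*-monoˡ-≤ δ α≤K)))) ⟩
        25 ℕ.* L ℕ.* m ℕ.+ (32 ℕ.* (L ℕ.* (K ℕ.* δ)) ℕ.+ 64 ℕ.* (L ℕ.* (K ℕ.* δ)))
          ≡⟨ solve 3 (λ x L y → x :+ (con 32 :* (L :* y) :+ con 64 :* (L :* y)) := x :+ L :* (con 96 :* y)) refl (25 ℕ.* L ℕ.* m) L (K ℕ.* δ) ⟩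
        25 ℕ.* L ℕ.* m ℕ.+ L ℕ.* (96 ℕ.* (K ℕ.* δ)) ∎)))
        where
        open ℕ.≤-Reasoning
        α = length A
        L = ℓ ℕ.^ α
        L≢0 : NonZero L
        L≢0 = ℕ.m^n≢0 ℓ α {{prime⇒nonZero ℓ-prime}}
        1≤L : 1 ≤ L
        1≤L = ℕ.>-nonZero⁻¹ L {{L≢0}}

      -- Four conditions on squares leave about `q/16`, that is `m/4`, elements for `Y`, just enough
      -- for `m ≤ 4 |Y|`. Demanding a fourth power at one of the four elements halves the count to
      -- `q/32`.
      not-four-four : d ≡ 4 → length A ≡ 4 → ⊥
      not-four-four refl α≡4 = go A refl A-unique
        where
        open ℕ.≤-Reasoning
        2-prime : Prime 2
        2-prime = from-yes (prime? 2)
        2m≢0 : NonZero (2 ℕ.* m)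
        2m≢0 = ℕ.m*n≢0 2 m
        go : ∀ B → A ≡ B → Unique B → ⊥
        go []       refl _ = contradiction α≡4 λ ()
        go (c ∷ cs) refl (c∉ ∷ _) = ℕ.<⇒≱ Kδ<m (begin
          m ≤⟨ ℕ.m≤n*m m 4 ⟩
          4 ℕ.* m ≤⟨ ℕ.+-cancelˡ-≤ (4 ℕ.* m) _ _ double ⟩
          1 ℕ.+ 64 ℕ.* δ ≤⟨ ℕ.+-monoˡ-≤ (64 ℕ.* δ) 1≤δ ⟩
          65 ℕ.* δ ≤⟨ ℕ.*-mono-≤ {65} {100} (ℕ.m≤m+n 65 35) (ℕ.m≤n*m δ K {{ℕ.>-nonZero 1≤K}}) ⟩
          100 ℕ.* (K ℕ.* δ) ∎)
          where
          X = count ((c , m) ∷ map (_, 2 ℕ.* m) cs)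
          X′ = count (map (_, 2 ℕ.* m) A)
          cs<K : length cs < K
          cs<K = ℕ.≤-trans (ℕ.≤-reflexive α≡4) 4≤K
          Y≤X : length Y ≤ X
          Y≤X = Y≤count _ (λ y∈ → sums (here refl) y∈ ∷ satisfied 2 cs (All.tabulate there) y∈)
          step : 2 ℕ.* X ≤ X′ ℕ.+ 2 ℕ.* δ
          step = subst (λ M → 2 ℕ.* X ≤ count ((c , M) ∷ map (_, 2 ℕ.* m) cs) ℕ.+ 2 ℕ.* δ) (ℕ.*-comm m 2)
            (count-step 2 2-prime 2 m (trans q≡ (cong suc (solve 1 (λ m → con 4 :* m := con 2 :* (m :* con 2)) refl m))) ℕ.≤-refl c cs c∉ cs<K)
          X′-bound : 16 ℕ.* X′ ≤ q ℕ.+ 2 ℕ.* (16 ℕ.* δ)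
          X′-bound = subst (λ α → 2 ℕ.^ α ℕ.* X′ ≤ q ℕ.+ 2 ℕ.* (2 ℕ.^ α ℕ.* δ)) α≡4
            (multifold-bound 2 2-prime (2 ℕ.* m) {{2m≢0}} (trans q≡ (cong suc (solve 1 (λ m → con 4 :* m := con 2 :* (con 2 :* m)) refl m))) (s≤s (s≤s z≤n)) A A-unique (ℕ.≤-trans (ℕ.≤-reflexive α≡4) 4≤K))
          double : 4 ℕ.* m ℕ.+ 4 ℕ.* m ≤ 4 ℕ.* m ℕ.+ (1 ℕ.+ 64 ℕ.* δ)
          double = begin
            4 ℕ.* m ℕ.+ 4 ℕ.* m ≡⟨ solve 1 (λ m → con 4 :* m :+ con 4 :* m := con 8 :* m) refl m ⟩
            8 ℕ.* m ≤⟨ ℕ.*-monoʳ-≤ 8 (ℕ.≤-trans m≤αY (ℕ.≤-trans (ℕ.≤-reflexive (cong (ℕ._* length Y) α≡4)) (ℕ.*-monoʳ-≤ 4 Y≤X))) ⟩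
            8 ℕ.* (4 ℕ.* X) ≡⟨ solve 1 (λ x → con 8 :* (con 4 :* x) := con 16 :* (con 2 :* x)) refl X ⟩
            16 ℕ.* (2 ℕ.* X) ≤⟨ ℕ.*-monoʳ-≤ 16 step ⟩
            16 ℕ.* (X′ ℕ.+ 2 ℕ.* δ) ≡⟨ ℕ.*-distribˡ-+ 16 X′ _ ⟩
            16 ℕ.* X′ ℕ.+ 16 ℕ.* (2 ℕ.* δ) ≤⟨ ℕ.+-monoˡ-≤ _ X′-bound ⟩
            q ℕ.+ 2 ℕ.* (16 ℕ.* δ) ℕ.+ 16 ℕ.* (2 ℕ.* δ) ≡⟨ cong (λ z → z ℕ.+ 2 ℕ.* (16 ℕ.* δ) ℕ.+ 16 ℕ.* (2 ℕ.* δ)) q≡ ⟩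
            suc (4 ℕ.* m) ℕ.+ 2 ℕ.* (16 ℕ.* δ) ℕ.+ 16 ℕ.* (2 ℕ.* δ) ≡⟨ solve 2 (λ m δ → con 1 :+ con 4 :* m :+ con 2 :* (con 16 :* δ) :+ con 16 :* (con 2 :* δ) := con 4 :* m :+ (con 1 :+ con 64 :* δ)) refl m δ ⟩
            4 ℕ.* m ℕ.+ (1 ℕ.+ 64 ℕ.* δ) ∎

      -- For `A = {a, a′}` a square `a + y` comes with the square `a′ + y`, and conversely. So every
      -- square has another one at distance `± (a′ - a)`.
      not-two-two : d ≡ 2 → length A ≡ 2 → ⊥
      not-two-two d≡2 α≡2 = go A refl A-unique α≡2
        where
        go : ∀ B → A ≡ B → Unique B → length B ≡ 2 → ⊥
        go (a ∷ a′ ∷ []) refl ((a≢a′ ∷ _) ∷ _) _ = no-isolated-squares Kδ<m d≡2 (a′ - a) (λ eq → a≢a′ (sym (x∙y⁻¹≈ε⇒x≈y a′ a eq))) neighbour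
          where
          a→a′ : ∀ y → a′ - a + (a + y) ≡ a′ + y
          a→a′ y = trans (sym (+-assoc (a′ - a) a y)) (cong (_+ y) (trans (+-comm (a′ - a) a) (shift-cancel a a′)))
          a′→a : ∀ y → - (a′ - a) + (a′ + y) ≡ a + y
          a′→a y = +-cancelˡ (a′ - a) _ _ (trans (sym (+-assoc _ _ _)) (trans (cong (_+ (a′ + y)) (-‿inverseʳ (a′ - a))) (trans (+-identityˡ _) (sym (a→a′ y)))))
          neighbour : ∀ {x} → x ^ m ≡ 1# → (a′ - a + x) ^ m ≡ 1# ⊎ (- (a′ - a) + x) ^ m ≡ 1#
          neighbour x^m≡1 with cover x^m≡1
          ... | .a , y , here refl , y∈ , refl = inj₁ (trans (cong (_^ m) (a→a′ y)) (sums (there (here refl)) y∈))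
          ... | .a′ , y , there (here refl) , y∈ , refl = inj₂ (trans (cong (_^ m) (a′→a y)) (sums (here refl) y∈))

      not-small : 2 ≤ length A → length A ≤ K → ⊥
      not-small 2≤α α≤K with 5 ℕ.≤? length A
      ... | yes 5≤α = let (ℓ , e , ℓ-prime , d≡) = prime-divisor d 2≤d in generic-contradiction ℓ e ℓ-prime d≡ α≤K (begin
          32 ℕ.* (length A ℕ.* d) ≤⟨ ℕ.*-monoʳ-≤ 32 (ℕ.*-monoʳ-≤ (length A) (d≤α 2≤α)) ⟩
          32 ℕ.* (length A ℕ.* length A) ≤⟨ large (ℕ.m≤n⇒∃[o]m+o≡n 5≤α) ⟩
          25 ℕ.* 2 ℕ.^ length A ≤⟨ ℕ.*-monoʳ-≤ 25 (ℕ.^-monoˡ-≤ (length A) (ℕ.nonTrivial⇒n>1 ℓ {{prime⇒nonTrivial ℓ-prime}})) ⟩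
          25 ℕ.* ℓ ℕ.^ length A ∎)
        where
        open ℕ.≤-Reasoning
        large : (∃ λ k → 5 ℕ.+ k ≡ length A) → 32 ℕ.* (length A ℕ.* length A) ≤ 25 ℕ.* 2 ℕ.^ length A
        large (k , eq) = subst (λ α → 32 ℕ.* (α ℕ.* α) ≤ 25 ℕ.* 2 ℕ.^ α) eq (32α²≤25·2^α k)
      ... | no  5≰α = few (length A) d refl refl 2≤d (d≤α 2≤α) (ℕ.≤-pred (ℕ.≰⇒> 5≰α))
        where
        direct : ∀ α D → length A ≡ α → d ≡ D → Prime D → 32 ℕ.* (α ℕ.* D) ≤ 25 ℕ.* D ℕ.^ α → ⊥
        direct α D refl refl D-prime = generic-contradiction d 1 D-prime (sym (ℕ.*-identityʳ d)) α≤K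
        -- These are the pairs with `2 ≤ D ≤ α ≤ 4`. Only (2, 2) and (4, 4) have `α D = ℓ^α`; among
        -- the others (3, 2) is the tightest, with `192 ≤ 200`.
        few : ∀ α D → length A ≡ α → d ≡ D → 2 ≤ D → D ≤ α → α ≤ 4 → ⊥
        few α 0 _ _ () _ _
        few α 1 _ _ (s≤s ()) _ _
        few 0 (suc _) _ _ _ () _
        few 1 (suc (suc _)) _ _ _ (s≤s ()) _
        few 2 2 α≡ d≡ _ _ _ = not-two-two d≡ α≡
        few 3 2 α≡ d≡ _ _ _ = direct 3 2 α≡ d≡ (from-yes (prime? 2)) (from-yes (192 ℕ.≤? 200))
        few 4 2 α≡ d≡ _ _ _ = direct 4 2 α≡ d≡ (from-yes (prime? 2)) (from-yes (256 ℕ.≤? 400))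
        few 2 (suc (suc (suc _))) _ _ _ (s≤s (s≤s ())) _
        few 3 3 α≡ d≡ _ _ _ = direct 3 3 α≡ d≡ (from-yes (prime? 3)) (from-yes (288 ℕ.≤? 675))
        few 4 3 α≡ d≡ _ _ _ = direct 4 3 α≡ d≡ (from-yes (prime? 3)) (from-yes (384 ℕ.≤? 2025))
        few 3 (suc (suc (suc (suc _)))) _ _ _ (s≤s (s≤s (s≤s ()))) _
        few 4 4 α≡ d≡ _ _ _ = not-four-four d≡ α≡
        few 4 (suc (suc (suc (suc (suc _))))) _ _ _ (s≤s (s≤s (s≤s (s≤s ())))) _
        few (suc (suc (suc (suc (suc _))))) D _ _ _ _ (s≤s (s≤s (s≤s (s≤s ()))))

      -- Once `A` has `K` elements, `K` of them suffice: `q ≤ 2^K ≤ ℓ^K` reduces the main term to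
      -- the summand 1.
      summand-bound : 2 ≤ length A → length Y ≤ 1 ℕ.+ 2 ℕ.* δ
      summand-bound 2≤α with K ℕ.≤? length A
      ... | no  K≰α = ⊥-elim (not-small 2≤α (ℕ.<⇒≤ (ℕ.≰⇒> K≰α)))
      ... | yes K≤α = let (ℓ , e , ℓ-prime , d≡) = prime-divisor d 2≤d in by-multifold ℓ e ℓ-prime d≡
        where
        open ℕ.≤-Reasoning
        cs = take K A
        cs-length : length cs ≡ K
        cs-length = trans (length-take K A) (ℕ.m≤n⇒m⊓n≡m K≤α)
        by-multifold : ∀ ℓ e → Prime ℓ → d ≡ ℓ ℕ.* e → length Y ≤ 1 ℕ.+ 2 ℕ.* δ
        by-multifold ℓ e ℓ-prime d≡ = ℕ.*-cancelˡ-≤ (ℓ ℕ.^ K) {{ℕ.m^n≢0 ℓ K {{prime⇒nonZero ℓ-prime}}}} (begin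
          ℓ ℕ.^ K ℕ.* length Y ≤⟨ subst (λ k → ℓ ℕ.^ k ℕ.* length Y ≤ q ℕ.+ 2 ℕ.* (ℓ ℕ.^ k ℕ.* δ)) cs-length
              (multifold ℓ e ℓ-prime d≡ cs (All.take⁺ K (All.tabulate (λ a∈ → a∈))) (take⁺ K A-unique) (ℕ.≤-reflexive cs-length)) ⟩
          q ℕ.+ 2 ℕ.* (ℓ ℕ.^ K ℕ.* δ) ≤⟨ ℕ.+-monoˡ-≤ _ (ℕ.≤-trans q≤2^K (ℕ.^-monoˡ-≤ K (ℕ.nonTrivial⇒n>1 ℓ {{prime⇒nonTrivial ℓ-prime}}))) ⟩
          ℓ ℕ.^ K ℕ.+ 2 ℕ.* (ℓ ℕ.^ K ℕ.* δ) ≡⟨ solve 2 (λ L δ → L :+ con 2 :* (L :* δ) := L :* (con 1 :+ con 2 :* δ)) refl (ℓ ℕ.^ K) δ ⟩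
          ℓ ℕ.^ K ℕ.* (1 ℕ.+ 2 ℕ.* δ) ∎)

-- Decompositions into three summands

-- The summands are arbitrary predicates. Over a finite type they are all decidable up to double
-- negation, which is enough because the goal is a contradiction, and then they can be turned into
-- lists.
¬¬-decidable : ∀ {n} (P : Fin n → Set) → ¬ ¬ (∀ i → Dec (P i))
¬¬-decidable {zero}  P k = k λ ()
¬¬-decidable {suc n} P k = ¬¬-decidable (P ∘ suc) λ rest →
  k′ rest (no (λ p → k′ rest (yes p)))
  where
  k′ : (∀ i → Dec (P (suc i))) → Dec (P zero) → ⊥
  k′ rest d = k λ { zero → d ; (suc i) → rest i }

module _ {q : ℕ} (F : FiniteField q) (pp : IsPrimePower q) (K d r m : ℕ) (2≤d : 2 ≤ d) (q≡ : q ≡ suc (d ℕ.* m))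
         (q≤2^K : q ≤ 2 ℕ.^ K) (4≤K : 4 ≤ K) (r²≤q : r ℕ.* r ≤ q) (q<[r+1]² : q < suc r ℕ.* suc r)
         (big : 10000000 ℕ.* (K ℕ.* K ℕ.* K ℕ.* d ℕ.^ 5) ≤ r) where
  open Field F
  open Constants K d r m (ℕ.≤-trans (s≤s z≤n) 4≤K) (ℕ.≤-trans (s≤s z≤n) 2≤d) (subst (r ℕ.* r ≤_) q≡ r²≤q) big
  private
    instance
      d≢0 : NonZero d
      d≢0 = ℕ.>-nonZero (ℕ.≤-trans (s≤s z≤n) 2≤d)
      m≢0 : NonZero m
      m≢0 = ℕ.>-nonZero (ℕ.≤-trans (s≤s z≤n) d²r<m)

  sumset : List Carrier → List Carrier → List Carrier
  sumset B C = deduplicate _≟_ (cartesianProductWith _+_ B C)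

  ∈sumset⁺ : ∀ {B C b c} → b ∈ B → c ∈ C → b + c ∈ sumset B C
  ∈sumset⁺ b∈ c∈ = ∈-deduplicate⁺ _≟_ (∈-cartesianProductWith⁺ _+_ b∈ c∈)

  ∈sumset⁻ : ∀ {B C y} → y ∈ sumset B C → ∃ λ b → ∃ λ c → b ∈ B × c ∈ C × y ≡ b + c
  ∈sumset⁻ {B} {C} y∈ = ∈-cartesianProductWith⁻ _+_ B C (∈-deduplicate⁻ _≟_ (cartesianProductWith _+_ B C) y∈)

  IsDecomposition : List Carrier → List Carrier → List Carrier → Set
  IsDecomposition A B C = (∀ {a b c} → a ∈ A → b ∈ B → c ∈ C → (a + b + c) ^ m ≡ 1#) ×
                          (∀ {s} → s ^ m ≡ 1# → ∃ λ a → ∃ λ b → ∃ λ c → a ∈ A × b ∈ B × c ∈ C × s ≡ a + b + c)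

  sumset-bound : ∀ {A B C} → Unique A → 2 ≤ length A → IsDecomposition A B C → length (sumset B C) ≤ 1 ℕ.+ 2 ℕ.* δ
  sumset-bound {A} {B} {C} A-unique 2≤A (sums , cover) =
    Decomposition.summand-bound F pp K d r m 12Kd≤r r²≤q q<[r+1]² q≡ 2≤d q≤2^K 4≤K d²r<m
      A (sumset B C) A-unique (Data.List.Relation.Unary.Unique.DecPropositional.Properties.deduplicate-! _≟_ (cartesianProductWith _+_ B C))
      (λ {a} a∈ y∈ → let (b , c , b∈ , c∈ , eq) = ∈sumset⁻ {B} {C} y∈
                     in trans (cong (_^ m) (trans (cong (a +_) eq) (sym (+-assoc a b c)))) (sums a∈ b∈ c∈))
      (λ s∈ → let (a , b , c , a∈ , b∈ , c∈ , eq) = cover s∈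
              in a , b + c , a∈ , ∈sumset⁺ b∈ c∈ , trans eq (+-assoc a b c))
      Kδ<m 2≤A

  rotate : ∀ {A B C} → IsDecomposition A B C → IsDecomposition B A C
  rotate (sums , cover) = (λ {b} {a} {c} b∈ a∈ c∈ → trans (cong (λ z → (z + c) ^ m) (+-comm b a)) (sums a∈ b∈ c∈)) ,
    λ s∈ → let (a , b , c , a∈ , b∈ , c∈ , eq) = cover s∈ in b , a , c , b∈ , a∈ , c∈ , trans eq (cong (_+ c) (+-comm a b))

  rotate′ : ∀ {A B C} → IsDecomposition A B C → IsDecomposition C A B
  rotate′ (sums , cover) = (λ {c} {a} {b} c∈ a∈ b∈ → trans (cong (_^ m) (reorder c a b)) (sums a∈ b∈ c∈)) ,
    λ s∈ → let (a , b , c , a∈ , b∈ , c∈ , eq) = cover s∈ in c , a , b , c∈ , a∈ , b∈ , trans eq (sym (reorder c a b))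
    where
    reorder : ∀ c a b → c + a + b ≡ a + b + c
    reorder c a b = trans (+-assoc c a b) (+-comm c (a + b))

  no-decomposition : ∀ {A B C} → Unique A → Unique B → Unique C → 2 ≤ length A → 2 ≤ length B → 2 ≤ length C → ¬ IsDecomposition A B C
  no-decomposition {A} {B} {C} uA uB uC 2≤A 2≤B 2≤C dec@(sums , cover) = ℕ.<⇒≱ E³<m² (begin
    m ℕ.* m ≡⟨ cong₂ ℕ._*_ length-G length-G ⟨
    length (μ F m) ℕ.* length (μ F m) ≤⟨ sumset-inequality F B C (sumset B C) (∈sumset⁻ {B} {C}) ∈sumset⁺ A (μ F m) (sumset A B) (sumset A C) (μ-unique F m)
        (λ s∈ → cover (∈μ⁻ F m s∈)) (λ a∈ b∈ c∈ _ → ∈sumset⁺ a∈ b∈ , ∈sumset⁺ a∈ c∈) ⟩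
    length (sumset B C) ℕ.* (length (sumset A B) ℕ.* length (sumset A C)) ≤⟨ ℕ.*-mono-≤ (sumset-bound uA 2≤A dec) (ℕ.*-mono-≤ (sumset-bound uC 2≤C (rotate′ {A} {B} {C} dec)) (sumset-bound uB 2≤B (rotate {A} {B} {C} dec))) ⟩
    E ℕ.* (E ℕ.* E) ∎)
    where
    open ℕ.≤-Reasoning
    E = 1 ℕ.+ 2 ℕ.* δ
    length-G : length (μ F m) ≡ m
    length-G = length-μ F d m q≡

  open FiniteField F using (S; SumSet; AtLeastTwo)

  no-ternary-decomposition : ∀ A B C → AtLeastTwo A → AtLeastTwo B → AtLeastTwo C → ¬ (∀ x → S d x ⇔ SumSet A B C x)
  no-ternary-decomposition A B C A₂ B₂ C₂ S⇔A+B+C =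
    decide A λ A? → decide B λ B? → decide C λ C? →
    no-decomposition (unique A?) (unique B?) (unique C?) (two A? A₂) (two B? B₂) (two C? C₂)
      ( (λ a∈ b∈ c∈ → Equivalence.to (S⇔ F d m q≡) (Equivalence.from (S⇔A+B+C _) (_ , _ , _ , ∈⁻ A? a∈ , ∈⁻ B? b∈ , ∈⁻ C? c∈ , refl)))
      , (λ {s} s^m≡1 → let (a , b , c , Aa , Bb , Cc , eq) = Equivalence.to (S⇔A+B+C s) (Equivalence.from (S⇔ F d m q≡) s^m≡1)
                       in a , b , c , ∈⁺ A? Aa , ∈⁺ B? Bb , ∈⁺ C? Cc , eq) )
    where
    decide : (P : Carrier → Set) → ¬ ¬ (∀ x → Dec (P x))
    decide P k = ¬¬-decidable (P ∘ elem) λ P? → k λ x → subst (Dec ∘ P) (elem-index x) (P? (index x))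
    module _ {P : Carrier → Set} (P? : ∀ x → Dec (P x)) where
      unique : Unique (filter P? elems)
      unique = filter⁺ P? elems-unique
      ∈⁺ : ∀ {x} → P x → x ∈ filter P? elems
      ∈⁺ {x} Px = ∈-filter⁺ P? (∈elems x) Px
      ∈⁻ : ∀ {x} → x ∈ filter P? elems → P x
      ∈⁻ x∈ = proj₂ (∈-filter⁻ P? {xs = elems} x∈)
      two : AtLeastTwo P → 2 ≤ length (filter P? elems)
      two (x , y , Px , Py , x≢y) = length-⊆ {xs = x ∷ y ∷ []} ((x≢y ∷ []) ∷ [] ∷ []) λ { (here refl) → ∈⁺ Px ; (there (here refl)) → ∈⁺ Py }

open import Data.Nat using (_^_; _*_)

-- Here `ε = a/b`. The condition `d ≤ q^(1/10 - ε)` is raised to the power `10 b`, and the negative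
-- part of the exponent of `q` is moved to the left.
theorem1p6 : (a b : ℕ) → 0 < a → 0 < b →
    Σ ℕ λ Q → (q : ℕ) → Q < q → IsPrimePower q → (F : FiniteField q) →
    (d : ℕ) → d ∣ (q ∸ 1) → 2 ≤ d → (d ^ (10 * b)) * (q ^ (10 * a)) ≤ q ^ b →
    (A B C : FiniteField.Carrier F → Set) →
    FiniteField.AtLeastTwo F A → FiniteField.AtLeastTwo F B → FiniteField.AtLeastTwo F C →
    ¬ (∀ x → FiniteField.S F d x ⇔ FiniteField.SumSet F A B C x)
theorem1p6 a b 0<a _ = Q , λ where
    q Q<q pp F d (divides m q-1≡md) 2≤d small →
      let (K , r , q≤2^K , 4≤K , r²≤q , q<[r+1]² , big) = large q d Q<q small
          q≡1+dm = trans (sym (ℕ.m+[n∸m]≡n (ℕ.≤-trans (s≤s z≤n) Q<q))) (cong suc (trans q-1≡md (ℕ.*-comm m d)))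
      in no-ternary-decomposition F pp K d r m 2≤d q≡1+dm q≤2^K 4≤K r²≤q q<[r+1]² big
  where
  open Σ (sqrt-dominates 10000000 a b 0<a) renaming (proj₁ to Q; proj₂ to large)
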